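{- For every integer $t\ge2$ and every graph $G$ with adjacency matrix $A$, $$\hom(K_{t,t},G)\ge\|A\|_{q\to t}^{t^2},\qquad q:=\frac{t}{t-1}.$$ Consequently, if $M(G)>0$, then $$\hom(K_{t,t},G)\ge\frac{\lambda(G)^{2t(t-1)}}{M(G)^{t(t-2)}}.$$
   Context: Graphs are finite and simple. $\hom(H,G)$ is the number of homomorphisms from $H$ to $G$; $M(G):=2e(G)$ is twice the number of edges; $\lambda(G)$ is the spectral radius of the adjacency matrix. For a real $n\times n$ matrix $A$ and $1\le p,r\le\infty$, $\|A\|_{p\to r}:=\sup_{x\ne0}\|Ax\|_r/\|x\|_p$. -}

module Defs where

open import Level using (0ℓ)
open import Algebra.Bundles.Raw using (RawSemiring)
open import Data.Bool.Base using (Bool; true; false; T; _xor_; if_then_else_)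
open import Data.Bool.Properties using (T?; xor-comm; xor-same)
open import Data.Fin.Base as Fin using (Fin; splitAt)
open import Data.Fin.Properties using (all?; _<?_)
open import Data.Integer.Base as ℤ using (+_; -[1+_])
import Data.Integer.Properties as ℤ
open import Data.List.Base as List using (List; []; _∷_)
open import Data.Nat.Base as ℕ using (ℕ; zero; suc)
import Data.Nat.Properties as ℕ
open import Data.Product.Base using (∃-syntax; _×_; _,_)
open import Data.Rational.Base as ℚ using (ℚ; mkℚ; 0ℚ; 1ℚ; ½)
import Data.Rational.Properties as ℚ
open import Data.Rational.Solver using (module +-*-Solver)
open import Data.Rational.Unnormalised.Base as ℚᵘ using (mkℚᵘ)
import Data.Rational.Unnormalised.Properties as ℚᵘ
open import Data.Sum.Base using (inj₁; inj₂)
open import Data.Vec.Base as Vec using (Vec)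
open import Function.Base using (_∘_)
open import Relation.Nullary using (¬_; Dec; yes; no)
open import Relation.Nullary.Decidable using (_→-dec_; _×-dec_)
open import Relation.Binary.PropositionalEquality

open import Algebra.Definitions.RawSemiring ℚ.+-*-rawSemiring using () renaming (_^_ to _^ℚ_)

*-mono : ∀ {a b c d} → 0ℚ ℚ.≤ a → a ℚ.≤ b → 0ℚ ℚ.≤ c → c ℚ.≤ d → a ℚ.* c ℚ.≤ b ℚ.* d
*-mono {a} {b} {c} {d} 0≤a a≤b 0≤c c≤d = ℚ.≤-trans
  (ℚ.*-monoʳ-≤-nonNeg c {{ℚ.nonNegative 0≤c}} a≤b)
  (ℚ.*-monoˡ-≤-nonNeg b {{ℚ.nonNegative (ℚ.≤-trans 0≤a a≤b)}} c≤d)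

*-nonNeg : ∀ {a c} → 0ℚ ℚ.≤ a → 0ℚ ℚ.≤ c → 0ℚ ℚ.≤ a ℚ.* c
*-nonNeg {a} {c} 0≤a 0≤c =
  subst (ℚ._≤ a ℚ.* c) (ℚ.*-zeroˡ 0ℚ) (*-mono {0ℚ} {a} {0ℚ} {c} ℚ.≤-refl 0≤a ℚ.≤-refl 0≤c)

*-pos : ∀ {a c} → 0ℚ ℚ.< a → 0ℚ ℚ.< c → 0ℚ ℚ.< a ℚ.* c
*-pos {a} {c} 0<a 0<c =
  ℚ.positive⁻¹ (a ℚ.* c) {{ℚ.pos*pos⇒pos a {{ℚ.positive 0<a}} c {{ℚ.positive 0<c}}}}

+-nonNeg : ∀ {a c} → 0ℚ ℚ.≤ a → 0ℚ ℚ.≤ c → 0ℚ ℚ.≤ a ℚ.+ c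
+-nonNeg {a} {c} 0≤a 0≤c = ℚ.+-mono-≤ {0ℚ} {a} {0ℚ} {c} 0≤a 0≤c

^-nonNeg : ∀ {a} → 0ℚ ℚ.≤ a → ∀ k → 0ℚ ℚ.≤ a ^ℚ k
^-nonNeg 0≤a zero    = ℚ.nonNegative⁻¹ 1ℚ
^-nonNeg {a} 0≤a (suc k) = *-nonNeg {a} {a ^ℚ k} 0≤a (^-nonNeg 0≤a k)

^-pos : ∀ {a} → 0ℚ ℚ.< a → ∀ k → 0ℚ ℚ.< a ^ℚ k
^-pos 0<a zero    = ℚ.positive⁻¹ 1ℚ
^-pos {a} 0<a (suc k) = *-pos {a} {a ^ℚ k} 0<a (^-pos 0<a k)

^-mono : ∀ {a b} → 0ℚ ℚ.≤ a → a ℚ.≤ b → ∀ k → a ^ℚ k ℚ.≤ b ^ℚ k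
^-mono 0≤a a≤b zero    = ℚ.≤-refl
^-mono {a} {b} 0≤a a≤b (suc k) = *-mono {a} {b} {a ^ℚ k} {b ^ℚ k} 0≤a a≤b (^-nonNeg 0≤a k) (^-mono 0≤a a≤b k)

1≤^ : ∀ {a} → 1ℚ ℚ.≤ a → ∀ k → 1ℚ ℚ.≤ a ^ℚ k
1≤^ 1≤a zero    = ℚ.≤-refl
1≤^ {a} 1≤a (suc k) = *-mono {1ℚ} {a} {1ℚ} {a ^ℚ k} (ℚ.nonNegative⁻¹ 1ℚ) 1≤a (ℚ.nonNegative⁻¹ 1ℚ) (1≤^ 1≤a k)

x≤x^ : ∀ {a} → 1ℚ ℚ.≤ a → ∀ k → a ℚ.≤ a ^ℚ suc k
x≤x^ {a} 1≤a k = subst (ℚ._≤ a ^ℚ suc k) (ℚ.*-identityʳ a)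
  (*-mono {a} {a} {1ℚ} {a ^ℚ k} (ℚ.≤-trans (ℚ.nonNegative⁻¹ 1ℚ) 1≤a) ℚ.≤-refl (ℚ.nonNegative⁻¹ 1ℚ) (1≤^ 1≤a k))

x≤x+y : ∀ {x y} → 0ℚ ℚ.≤ y → x ℚ.≤ x ℚ.+ y
x≤x+y {x} {y} 0≤y = subst (ℚ._≤ x ℚ.+ y) (ℚ.+-identityʳ x) (ℚ.+-monoʳ-≤ x 0≤y)

y≤x+y : ∀ {x y} → 0ℚ ℚ.≤ x → y ℚ.≤ x ℚ.+ y
y≤x+y {x} {y} 0≤x = subst (ℚ._≤ x ℚ.+ y) (ℚ.+-identityˡ y) (ℚ.+-monoˡ-≤ y 0≤x)

^-superadditive : ∀ {a h} → 0ℚ ℚ.≤ a → 0ℚ ℚ.≤ h → ∀ k →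
  a ^ℚ suc k ℚ.+ h ^ℚ suc k ℚ.≤ (a ℚ.+ h) ^ℚ suc k
^-superadditive {a} {h} 0≤a 0≤h zero    = ℚ.≤-reflexive (sym (ℚ.*-distribʳ-+ 1ℚ a h))
^-superadditive {a} {h} 0≤a 0≤h (suc k) = begin
  a ℚ.* A ℚ.+ h ℚ.* H
    ≤⟨ ℚ.+-mono-≤ {a ℚ.* A} {a ℚ.* (A ℚ.+ H)} {h ℚ.* H} {h ℚ.* (A ℚ.+ H)}
         (*-mono {a} {a} {A} {A ℚ.+ H} 0≤a ℚ.≤-refl 0≤A (x≤x+y {A} {H} 0≤H))
         (*-mono {h} {h} {H} {A ℚ.+ H} 0≤h ℚ.≤-refl 0≤H (y≤x+y {A} {H} 0≤A)) ⟩
  a ℚ.* (A ℚ.+ H) ℚ.+ h ℚ.* (A ℚ.+ H)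
    ≡⟨ ℚ.*-distribʳ-+ (A ℚ.+ H) a h ⟨
  (a ℚ.+ h) ℚ.* (A ℚ.+ H)
    ≤⟨ *-mono {a ℚ.+ h} {a ℚ.+ h} {A ℚ.+ H} {(a ℚ.+ h) ^ℚ suc k}
         (+-nonNeg {a} {h} 0≤a 0≤h) ℚ.≤-refl (+-nonNeg {A} {H} 0≤A 0≤H)
         (^-superadditive {a} {h} 0≤a 0≤h k) ⟩
  (a ℚ.+ h) ^ℚ suc (suc k) ∎
  where
  open ℚ.≤-Reasoning
  A H : ℚ
  A = a ^ℚ suc k
  H = h ^ℚ suc k
  0≤A : 0ℚ ℚ.≤ A
  0≤A = ^-nonNeg {a} 0≤a (suc k)
  0≤H : 0ℚ ℚ.≤ H
  0≤H = ^-nonNeg {h} 0≤h (suc k)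

abstract
  half : ℚ → ℚ
  half ε = ½ ℚ.* ε

  half-pos : ∀ {ε} → 0ℚ ℚ.< ε → 0ℚ ℚ.< half ε
  half-pos {ε} = *-pos {½} {ε} (ℚ.positive⁻¹ ½)

  half+half : ∀ ε → half ε ℚ.+ half ε ≡ ε
  half+half ε = trans (sym (ℚ.*-distribʳ-+ ε ½ ½)) (ℚ.*-identityˡ ε)

divide-pos : ∀ {B ε} → 0ℚ ℚ.< B → 0ℚ ℚ.< ε → ∃[ δ ] (0ℚ ℚ.< δ × B ℚ.* δ ≡ ε)
divide-pos {B} {ε} 0<B 0<ε = ℚ.1/ B ℚ.* ε , *-pos {ℚ.1/ B} {ε} (ℚ.positive⁻¹ (ℚ.1/ B) {{ℚ.1/pos⇒pos B}}) 0<ε ,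
  trans (sym (ℚ.*-assoc B (ℚ.1/ B) ε)) (trans (cong (ℚ._* ε) (ℚ.*-inverseʳ B)) (ℚ.*-identityˡ ε))
  where instance
  B-pos = ℚ.positive 0<B
  B-nonZero = ℚ.pos⇒nonZero B

∣-∣≤ : ∀ {p q ε} → p ℚ.≤ q ℚ.+ ε → q ℚ.≤ p ℚ.+ ε → ℚ.∣ p ℚ.- q ∣ ℚ.≤ ε
∣-∣≤ {p} {q} {ε} p≤q+ε q≤p+ε with ℚ.∣p∣≡p∨∣p∣≡-p (p ℚ.- q)
... | inj₁ eq = subst (ℚ._≤ ε) (sym eq) (subst (p ℚ.- q ℚ.≤_)
        (solve 2 (λ q ε → q :+ ε :- q := ε) refl q ε) (ℚ.+-monoˡ-≤ (ℚ.- q) p≤q+ε))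
  where open +-*-Solver
... | inj₂ eq = subst (ℚ._≤ ε) (sym eq) (subst₂ ℚ._≤_
        (solve 2 (λ p q → q :- p := :- (p :- q)) refl p q)
        (solve 2 (λ p ε → p :+ ε :- p := ε) refl p ε) (ℚ.+-monoˡ-≤ (ℚ.- p) q≤p+ε))
  where open +-*-Solver

∣p∣≤∣q∣+∣p-q∣ : ∀ p q → ℚ.∣ p ∣ ℚ.≤ ℚ.∣ q ∣ ℚ.+ ℚ.∣ p ℚ.- q ∣
∣p∣≤∣q∣+∣p-q∣ p q = subst (λ z → ℚ.∣ z ∣ ℚ.≤ ℚ.∣ q ∣ ℚ.+ ℚ.∣ p ℚ.- q ∣)
  (solve 2 (λ p q → q :+ (p :- q) := p) refl p q) (ℚ.∣p+q∣≤∣p∣+∣q∣ q (p ℚ.- q))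
  where open +-*-Solver

∣-∣-sym : ∀ p q → ℚ.∣ p ℚ.- q ∣ ≡ ℚ.∣ q ℚ.- p ∣
∣-∣-sym p q = trans (sym (ℚ.∣-p∣≡∣p∣ (p ℚ.- q)))
  (cong ℚ.∣_∣ (solve 2 (λ p q → :- (p :- q) := q :- p) refl p q))
  where open +-*-Solver

-- Real numbers as Cauchy sequences of rationals, with equality and order as
-- relations on sequences.  The Cauchy proof is constructive, so it contains a
-- modulus of convergence.

Cauchy : (ℕ → ℚ) → Set
Cauchy x = ∀ ε → 0ℚ ℚ.< ε → ∃[ N ] (∀ m n → N ℕ.≤ m → N ℕ.≤ n → ℚ.∣ x m ℚ.- x n ∣ ℚ.≤ ε)

record ℝ : Set where
  constructor mkℝ
  field
    seq    : ℕ → ℚ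
    cauchy : Cauchy seq

open ℝ public

infix 4 _≈_ _≤_
infixl 6 _+_
infixl 7 _*_
infix 8 -_

_≈_ : ℝ → ℝ → Set
x ≈ y = ∀ ε → 0ℚ ℚ.< ε → ∃[ N ] (∀ n → N ℕ.≤ n → ℚ.∣ seq x n ℚ.- seq y n ∣ ℚ.≤ ε)

_≤_ : ℝ → ℝ → Set
x ≤ y = ∀ ε → 0ℚ ℚ.< ε → ∃[ N ] (∀ n → N ℕ.≤ n → seq x n ℚ.≤ seq y n ℚ.+ ε)

fromℚ : ℚ → ℝ
fromℚ q = mkℝ (λ _ → q) λ ε 0<ε → 0 , λ _ _ _ _ →
  subst (ℚ._≤ ε) (sym (cong ℚ.∣_∣ (ℚ.+-inverseʳ q))) (ℚ.<⇒≤ 0<ε)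

fromℕ : ℕ → ℝ
fromℕ n = fromℚ (+ n ℚ./ 1)

0ℝ 1ℝ : ℝ
0ℝ = fromℚ 0ℚ
1ℝ = fromℚ 1ℚ

+-cauchy : ∀ x y → Cauchy (λ n → seq x n ℚ.+ seq y n)
+-cauchy x y ε 0<ε with cauchy x (half ε) (half-pos 0<ε) | cauchy y (half ε) (half-pos 0<ε)
... | N₁ , h₁ | N₂ , h₂ = N₁ ℕ.⊔ N₂ , λ m n N≤m N≤n → begin
  ℚ.∣ (seq x m ℚ.+ seq y m) ℚ.- (seq x n ℚ.+ seq y n) ∣
    ≡⟨ cong ℚ.∣_∣ (rearrange (seq x m) (seq x n) (seq y m) (seq y n)) ⟩
  ℚ.∣ (seq x m ℚ.- seq x n) ℚ.+ (seq y m ℚ.- seq y n) ∣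
    ≤⟨ ℚ.∣p+q∣≤∣p∣+∣q∣ (seq x m ℚ.- seq x n) (seq y m ℚ.- seq y n) ⟩
  ℚ.∣ seq x m ℚ.- seq x n ∣ ℚ.+ ℚ.∣ seq y m ℚ.- seq y n ∣
    ≤⟨ ℚ.+-mono-≤
         (h₁ m n (ℕ.m⊔n≤o⇒m≤o N₁ N₂ N≤m) (ℕ.m⊔n≤o⇒m≤o N₁ N₂ N≤n))
         (h₂ m n (ℕ.m⊔n≤o⇒n≤o N₁ N₂ N≤m) (ℕ.m⊔n≤o⇒n≤o N₁ N₂ N≤n)) ⟩
  half ε ℚ.+ half ε
    ≡⟨ half+half ε ⟩
  ε ∎
  where
  open ℚ.≤-Reasoning
  open +-*-Solver
  rearrange : ∀ a b c d → (a ℚ.+ c) ℚ.- (b ℚ.+ d) ≡ (a ℚ.- b) ℚ.+ (c ℚ.- d)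
  rearrange = solve 4 (λ a b c d → (a :+ c) :- (b :+ d) := (a :- b) :+ (c :- d)) refl

_+_ : ℝ → ℝ → ℝ
x + y = mkℝ (λ n → seq x n ℚ.+ seq y n) (+-cauchy x y)

neg-cauchy : ∀ x → Cauchy (λ n → ℚ.- seq x n)
neg-cauchy x ε 0<ε with cauchy x ε 0<ε
... | N , h = N , λ m n N≤m N≤n → subst (ℚ._≤ ε)
  (trans (∣-∣-sym (seq x m) (seq x n)) (cong ℚ.∣_∣ (rearrange (seq x m) (seq x n))))
  (h m n N≤m N≤n)
  where
  open +-*-Solver
  rearrange : ∀ a b → b ℚ.- a ≡ (ℚ.- a) ℚ.- (ℚ.- b)
  rearrange = solve 2 (λ a b → b :- a := (:- a) :- (:- b)) refl

-_ : ℝ → ℝ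
- x = mkℝ (λ n → ℚ.- seq x n) (neg-cauchy x)

eventually-bounded : ∀ x →
  ∃[ B ] (0ℚ ℚ.< B × ∃[ N ] (∀ n → N ℕ.≤ n → ℚ.∣ seq x n ∣ ℚ.≤ B))
eventually-bounded x with cauchy x 1ℚ (ℚ.positive⁻¹ 1ℚ)
... | N , h = ℚ.∣ seq x N ∣ ℚ.+ 1ℚ
  , ℚ.+-mono-≤-< {0ℚ} {ℚ.∣ seq x N ∣} {0ℚ} {1ℚ} (ℚ.0≤∣p∣ (seq x N)) (ℚ.positive⁻¹ 1ℚ)
  , N , λ n N≤n → ℚ.≤-trans (∣p∣≤∣q∣+∣p-q∣ (seq x n) (seq x N))
      (ℚ.+-monoʳ-≤ ℚ.∣ seq x N ∣ (h n N N≤n ℕ.≤-refl))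

∣ab∣≤ : ∀ a b {c d} → ℚ.∣ a ∣ ℚ.≤ c → ℚ.∣ b ∣ ℚ.≤ d → ℚ.∣ a ℚ.* b ∣ ℚ.≤ c ℚ.* d
∣ab∣≤ a b {c} {d} a≤c b≤d = subst (ℚ._≤ c ℚ.* d) (sym (ℚ.∣p*q∣≡∣p∣*∣q∣ a b))
  (*-mono (ℚ.0≤∣p∣ a) a≤c (ℚ.0≤∣p∣ b) b≤d)

∣ab-cd∣≤ : ∀ a b c d {B C η δ} → ℚ.∣ a ∣ ℚ.≤ B → ℚ.∣ d ∣ ℚ.≤ C →
  ℚ.∣ a ℚ.- c ∣ ℚ.≤ η → ℚ.∣ b ℚ.- d ∣ ℚ.≤ δ →
  ℚ.∣ a ℚ.* b ℚ.- c ℚ.* d ∣ ℚ.≤ B ℚ.* δ ℚ.+ C ℚ.* η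
∣ab-cd∣≤ a b c d {B} {C} {η} {δ} a≤B d≤C a-c≤η b-d≤δ = begin
  ℚ.∣ a ℚ.* b ℚ.- c ℚ.* d ∣
    ≡⟨ cong ℚ.∣_∣ (rearrange a b c d) ⟩
  ℚ.∣ a ℚ.* (b ℚ.- d) ℚ.+ d ℚ.* (a ℚ.- c) ∣
    ≤⟨ ℚ.∣p+q∣≤∣p∣+∣q∣ (a ℚ.* (b ℚ.- d)) (d ℚ.* (a ℚ.- c)) ⟩
  ℚ.∣ a ℚ.* (b ℚ.- d) ∣ ℚ.+ ℚ.∣ d ℚ.* (a ℚ.- c) ∣
    ≤⟨ ℚ.+-mono-≤ (∣ab∣≤ a (b ℚ.- d) a≤B b-d≤δ) (∣ab∣≤ d (a ℚ.- c) d≤C a-c≤η) ⟩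
  B ℚ.* δ ℚ.+ C ℚ.* η ∎
  where
  open ℚ.≤-Reasoning
  open +-*-Solver
  rearrange : ∀ a b c d → a ℚ.* b ℚ.- c ℚ.* d ≡ a ℚ.* (b ℚ.- d) ℚ.+ d ℚ.* (a ℚ.- c)
  rearrange = solve 4 (λ a b c d → a :* b :- c :* d := a :* (b :- d) :+ d :* (a :- c)) refl

*-cauchy : ∀ x y → Cauchy (λ n → seq x n ℚ.* seq y n)
*-cauchy x y ε 0<ε = combine (eventually-bounded x) (eventually-bounded y)
  where
  combine :
    ∃[ B ] (0ℚ ℚ.< B × ∃[ N ] (∀ n → N ℕ.≤ n → ℚ.∣ seq x n ∣ ℚ.≤ B)) →
    ∃[ C ] (0ℚ ℚ.< C × ∃[ N ] (∀ n → N ℕ.≤ n → ℚ.∣ seq y n ∣ ℚ.≤ C)) →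
    ∃[ N ] (∀ m n → N ℕ.≤ m → N ℕ.≤ n →
      ℚ.∣ seq x m ℚ.* seq y m ℚ.- seq x n ℚ.* seq y n ∣ ℚ.≤ ε)
  combine (B , 0<B , M₁ , bx) (C , 0<C , M₂ , by) =
    choose (divide-pos 0<B (half-pos 0<ε)) (divide-pos 0<C (half-pos 0<ε))
    where
    choose : ∃[ δ ] (0ℚ ℚ.< δ × B ℚ.* δ ≡ half ε) → ∃[ η ] (0ℚ ℚ.< η × C ℚ.* η ≡ half ε) →
      ∃[ N ] (∀ m n → N ℕ.≤ m → N ℕ.≤ n →
        ℚ.∣ seq x m ℚ.* seq y m ℚ.- seq x n ℚ.* seq y n ∣ ℚ.≤ ε)
    choose (δ , 0<δ , Bδ≡) (η , 0<η , Cη≡) = finish (cauchy x η 0<η) (cauchy y δ 0<δ)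
      where
      finish :
        ∃[ N ] (∀ m n → N ℕ.≤ m → N ℕ.≤ n → ℚ.∣ seq x m ℚ.- seq x n ∣ ℚ.≤ η) →
        ∃[ N ] (∀ m n → N ℕ.≤ m → N ℕ.≤ n → ℚ.∣ seq y m ℚ.- seq y n ∣ ℚ.≤ δ) →
        ∃[ N ] (∀ m n → N ℕ.≤ m → N ℕ.≤ n →
          ℚ.∣ seq x m ℚ.* seq y m ℚ.- seq x n ℚ.* seq y n ∣ ℚ.≤ ε)
      finish (N₁ , hx) (N₂ , hy) = (M₁ ℕ.⊔ M₂) ℕ.⊔ (N₁ ℕ.⊔ N₂) , λ m n N≤m N≤n →
        subst (ℚ.∣ seq x m ℚ.* seq y m ℚ.- seq x n ℚ.* seq y n ∣ ℚ.≤_)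
          (trans (cong₂ ℚ._+_ Bδ≡ Cη≡) (half+half ε))
          (∣ab-cd∣≤ (seq x m) (seq y m) (seq x n) (seq y n)
            (bx m (ℕ.m⊔n≤o⇒m≤o M₁ M₂ (left N≤m))) (by n (ℕ.m⊔n≤o⇒n≤o M₁ M₂ (left N≤n)))
            (hx m n (ℕ.m⊔n≤o⇒m≤o N₁ N₂ (right N≤m)) (ℕ.m⊔n≤o⇒m≤o N₁ N₂ (right N≤n)))
            (hy m n (ℕ.m⊔n≤o⇒n≤o N₁ N₂ (right N≤m)) (ℕ.m⊔n≤o⇒n≤o N₁ N₂ (right N≤n))))
        where
        left : ∀ {m} → (M₁ ℕ.⊔ M₂) ℕ.⊔ (N₁ ℕ.⊔ N₂) ℕ.≤ m → M₁ ℕ.⊔ M₂ ℕ.≤ m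
        left = ℕ.m⊔n≤o⇒m≤o (M₁ ℕ.⊔ M₂) (N₁ ℕ.⊔ N₂)
        right : ∀ {m} → (M₁ ℕ.⊔ M₂) ℕ.⊔ (N₁ ℕ.⊔ N₂) ℕ.≤ m → N₁ ℕ.⊔ N₂ ℕ.≤ m
        right = ℕ.m⊔n≤o⇒n≤o (M₁ ℕ.⊔ M₂) (N₁ ℕ.⊔ N₂)

_*_ : ℝ → ℝ → ℝ
x * y = mkℝ (λ n → seq x n ℚ.* seq y n) (*-cauchy x y)

∣-∣-cauchy : ∀ x → Cauchy (λ n → ℚ.∣ seq x n ∣)
∣-∣-cauchy x ε 0<ε with cauchy x ε 0<ε
... | N , h = N , λ m n N≤m N≤n → ∣-∣≤ (below m n N≤m N≤n) (below n m N≤n N≤m)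
  where
  below : ∀ m n → N ℕ.≤ m → N ℕ.≤ n → ℚ.∣ seq x m ∣ ℚ.≤ ℚ.∣ seq x n ∣ ℚ.+ ε
  below m n N≤m N≤n = ℚ.≤-trans (∣p∣≤∣q∣+∣p-q∣ (seq x m) (seq x n))
    (ℚ.+-monoʳ-≤ ℚ.∣ seq x n ∣ (h m n N≤m N≤n))

∣_∣ : ℝ → ℝ
∣ x ∣ = mkℝ (λ n → ℚ.∣ seq x n ∣) (∣-∣-cauchy x)

ℝ-rawSemiring : RawSemiring 0ℓ 0ℓ
ℝ-rawSemiring = record
  { Carrier = ℝ ; _≈_ = _≈_ ; _+_ = _+_ ; _*_ = _*_ ; 0# = 0ℝ ; 1# = 1ℝ }

open import Algebra.Definitions.RawSemiring ℝ-rawSemiring public using (_^_; sum)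

_÷ℕ_ : ℝ → (m : ℕ) .{{_ : ℕ.NonZero m}} → ℝ
x ÷ℕ m = x * fromℚ (+ 1 ℚ./ m)

infixl 7 _÷ℕ_

-- Roots.  The (k+1)-st root of a rational q ≥ 0 is approximated from below by
-- j/(n+1) with j as large as possible; every such j is at most rootBound n q.

rootBound : ℕ → ℚ → ℕ
rootBound n q = suc ℤ.∣ ℚ.↥ q ∣ ℕ.* suc n

rootSearch : (ℕ → ℚ) → ℕ → ℚ → ℕ → ℕ
rootSearch g k q zero    = zero
rootSearch g k q (suc b) with g (suc b) ^ℚ suc k ℚ.≤? q
... | yes _ = suc b
... | no  _ = rootSearch g k q b

grid : ℕ → ℕ → ℚ
grid n j = + j ℚ./ suc n

rootℚ : ℕ → ℕ → ℚ → ℚ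
rootℚ k n q = grid n (rootSearch (grid n) k q (rootBound n q))

toℚᵘ-/ : ∀ i n → ℚ.toℚᵘ (i ℚ./ suc n) ℚᵘ.≃ mkℚᵘ i n
toℚᵘ-/ i n = ℚ.toℚᵘ-fromℚᵘ (mkℚᵘ i n)

/-≤ : ∀ {i j m n} → i ℤ.* + suc n ℤ.≤ j ℤ.* + suc m → i ℚ./ suc m ℚ.≤ j ℚ./ suc n
/-≤ {i} {j} {m} {n} le = ℚ.toℚᵘ-cancel-≤
  (ℚᵘ.≤-trans (ℚᵘ.≤-reflexive (toℚᵘ-/ i m))
    (ℚᵘ.≤-trans (ℚᵘ.*≤* le) (ℚᵘ.≤-reflexive (ℚᵘ.≃-sym (toℚᵘ-/ j n)))))

0≤ℕ/ : ∀ j n → 0ℚ ℚ.≤ grid n j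
0≤ℕ/ j n = ℚ.nonNegative⁻¹ _ {{ℚ.normalize-nonNeg j (suc n)}}

suc-/ : ∀ j n → grid n (suc j) ≡ grid n j ℚ.+ grid n 1
suc-/ j n = ℚ.toℚᵘ-injective (ℚᵘ.≃-trans (toℚᵘ-/ (+ suc j) n) (ℚᵘ.≃-sym
  (ℚᵘ.≃-trans (ℚ.toℚᵘ-homo-+ (+ j ℚ./ suc n) (+ 1 ℚ./ suc n))
    (ℚᵘ.≃-trans (ℚᵘ.+-cong (toℚᵘ-/ (+ j) n) (toℚᵘ-/ (+ 1) n)) (ℚᵘ.*≡* eq)))))
  where
  d = + suc n
  eq : (+ j ℤ.* d ℤ.+ + 1 ℤ.* d) ℤ.* d ≡ + suc j ℤ.* (d ℤ.* d)
  eq = trans (cong (ℤ._* d) (sym (ℤ.*-distribʳ-+ d (+ j) (+ 1))))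
    (trans (cong (λ z → z ℤ.* d ℤ.* d) (ℤ.+-comm (+ j) (+ 1))) (ℤ.*-assoc (+ suc j) d d))

≤-∣↥∣ : ∀ q → q ℚ.≤ grid 0 ℤ.∣ ℚ.↥ q ∣
≤-∣↥∣ q@(mkℚ i d _) = ℚ.toℚᵘ-cancel-≤ (ℚᵘ.≤-trans (ℚᵘ.*≤* (le i))
  (ℚᵘ.≤-reflexive (ℚᵘ.≃-sym (toℚᵘ-/ (+ ℤ.∣ i ∣) 0))))
  where
  le : ∀ i → i ℤ.* + 1 ℤ.≤ + ℤ.∣ i ∣ ℤ.* + suc d
  le (+ j)    = ℤ.*-monoˡ-≤-nonNeg (+ j) (ℤ.+≤+ (ℕ.s≤s ℕ.z≤n))
  le -[1+ j ] = subst (-[1+ j ] ℤ.* + 1 ℤ.≤_) (ℤ.pos-* (suc j) (suc d)) ℤ.-≤+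

1/suc≤ : ∀ ε → 0ℚ ℚ.< ε → ∃[ N ] (∀ n → N ℕ.≤ n → grid n 1 ℚ.≤ ε)
1/suc≤ ε@(mkℚ (+ suc a) d _) 0<ε = d , λ n d≤n → ℚ.toℚᵘ-cancel-≤
  (ℚᵘ.≤-trans (ℚᵘ.≤-reflexive (toℚᵘ-/ (+ 1) n)) (ℚᵘ.*≤*
    (subst₂ ℤ._≤_ (ℤ.pos-* 1 (suc d)) (ℤ.pos-* (suc a) (suc n))
      (ℤ.+≤+ (ℕ.*-mono-≤ {1} {suc a} (ℕ.s≤s ℕ.z≤n) (ℕ.s≤s d≤n))))))
1/suc≤ (mkℚ (+ zero) d _)   (ℚ.*<* (ℤ.+<+ ()))
1/suc≤ (mkℚ -[1+ a ] d _)   (ℚ.*<* ())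

rootSearch-lower : ∀ (g : ℕ → ℚ) (k : ℕ) (q : ℚ) (b : ℕ) → g 0 ≡ 0ℚ → 0ℚ ℚ.≤ q → g (rootSearch g k q b) ^ℚ suc k ℚ.≤ q
rootSearch-lower g k q zero    g0≡0 0≤q = subst (λ z → z ℚ.* z ^ℚ k ℚ.≤ q) (sym g0≡0)
  (subst (ℚ._≤ q) (sym (ℚ.*-zeroˡ (0ℚ ^ℚ k))) 0≤q)
rootSearch-lower g k q (suc b) g0≡0 0≤q with g (suc b) ^ℚ suc k ℚ.≤? q
... | yes le = le
... | no  _  = rootSearch-lower g k q b g0≡0 0≤q

rootSearch-upper : ∀ (g : ℕ → ℚ) (k : ℕ) (q : ℚ) (b : ℕ) → q ℚ.< g (suc b) ^ℚ suc k →
  q ℚ.< g (suc (rootSearch g k q b)) ^ℚ suc k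
rootSearch-upper g k q zero    lt = lt
rootSearch-upper g k q (suc b) lt with g (suc b) ^ℚ suc k ℚ.≤? q
... | yes _  = lt
... | no ¬le = rootSearch-upper g k q b (ℚ.≰⇒> ¬le)

rootℚ-lower : ∀ k n q → 0ℚ ℚ.≤ q → rootℚ k n q ^ℚ suc k ℚ.≤ q
rootℚ-lower k n q = rootSearch-lower (grid n) k q (rootBound n q) (ℚ.0/n≡0 (suc n))

<^suc : ∀ {q C G} → q ℚ.< C → 1ℚ ℚ.≤ C → C ℚ.≤ G → ∀ k → q ℚ.< G ^ℚ suc k
<^suc {q} {C} {G} q<C 1≤C C≤G k = ℚ.<-≤-trans q<C
  (ℚ.≤-trans C≤G (x≤x^ {G} (ℚ.≤-trans 1≤C C≤G) k))

<-suc-grid : ∀ q → q ℚ.< grid 0 (suc ℤ.∣ ℚ.↥ q ∣)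
<-suc-grid q = subst₂ ℚ._<_ (ℚ.+-identityʳ q) (sym (suc-/ ℤ.∣ ℚ.↥ q ∣ 0))
  (ℚ.+-mono-≤-< {q} {grid 0 ℤ.∣ ℚ.↥ q ∣} {0ℚ} {grid 0 1} (≤-∣↥∣ q) (ℚ.positive⁻¹ 1ℚ))

1≤suc-grid : ∀ c → 1ℚ ℚ.≤ grid 0 (suc c)
1≤suc-grid c = /-≤ {+ 1} {+ suc c} {0} {0} (ℤ.+≤+ (ℕ.s≤s ℕ.z≤n))

suc-grid≤ : ∀ c n → grid 0 (suc c) ℚ.≤ grid n (suc (suc c ℕ.* suc n))
suc-grid≤ c n = /-≤ {+ suc c} {+ suc (suc c ℕ.* suc n)} {0} {n}
  (subst₂ ℤ._≤_ (ℤ.pos-* (suc c) (suc n)) (sym (ℤ.*-identityʳ (+ suc (suc c ℕ.* suc n))))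
    (ℤ.+≤+ (ℕ.n≤1+n (suc c ℕ.* suc n))))

rootℚ-upper : ∀ k n q → q ℚ.< (rootℚ k n q ℚ.+ grid n 1) ^ℚ suc k
rootℚ-upper k n q = subst (λ z → q ℚ.< z ^ℚ suc k) (suc-/ j n)
  (rootSearch-upper (grid n) k q (rootBound n q)
    (<^suc {q} {grid 0 (suc c)} {grid n (suc (rootBound n q))}
      (<-suc-grid q) (1≤suc-grid c) (suc-grid≤ c n) k))
  where
  c j : ℕ
  c = ℤ.∣ ℚ.↥ q ∣
  j = rootSearch (grid n) k q (rootBound n q)

-- The next two lemmas are stated for arbitrary numbers so that no grid point
-- is unfolded to a normalised fraction during type checking.

root-gap : ∀ k r r′ δ a b ε → 0ℚ ℚ.< ε → 0ℚ ℚ.≤ r → 0ℚ ℚ.≤ δ → δ ℚ.≤ half ε →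
  r′ ^ℚ suc k ℚ.≤ a → b ℚ.< (r ℚ.+ δ) ^ℚ suc k → a ℚ.≤ b ℚ.+ half ε ^ℚ suc k →
  r′ ℚ.≤ r ℚ.+ ε
root-gap k r r′ δ a b ε 0<ε 0≤r 0≤δ δ≤ lower upper a≤ = ℚ.≮⇒≥ λ lt →
  ℚ.<-irrefl refl (begin-strict
    r^ ℚ.+ h^                      ≤⟨ ^-superadditive 0≤r+δ 0≤h k ⟩
    (r ℚ.+ δ ℚ.+ half ε) ^ℚ suc k  ≤⟨ ^-mono (+-nonNeg 0≤r+δ 0≤h) (r+δ+h≤ lt) (suc k) ⟩
    r′ ^ℚ suc k                    ≤⟨ lower ⟩
    a                              ≤⟨ a≤ ⟩
    b ℚ.+ h^                       <⟨ ℚ.+-monoˡ-< h^ upper ⟩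
    r^ ℚ.+ h^                      ∎)
  where
  open ℚ.≤-Reasoning
  r^ h^ : ℚ
  r^ = (r ℚ.+ δ) ^ℚ suc k
  h^ = half ε ^ℚ suc k
  0≤h : 0ℚ ℚ.≤ half ε
  0≤h = ℚ.<⇒≤ (half-pos 0<ε)
  0≤r+δ : 0ℚ ℚ.≤ r ℚ.+ δ
  0≤r+δ = +-nonNeg 0≤r 0≤δ
  r+δ+h≤ : r ℚ.+ ε ℚ.< r′ → r ℚ.+ δ ℚ.+ half ε ℚ.≤ r′
  r+δ+h≤ lt = begin
    r ℚ.+ δ ℚ.+ half ε         ≤⟨ ℚ.+-monoˡ-≤ (half ε) (ℚ.+-monoʳ-≤ r δ≤) ⟩
    r ℚ.+ half ε ℚ.+ half ε    ≡⟨ ℚ.+-assoc r (half ε) (half ε) ⟩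
    r ℚ.+ (half ε ℚ.+ half ε)  ≡⟨ cong (r ℚ.+_) (half+half ε) ⟩
    r ℚ.+ ε                    <⟨ lt ⟩
    r′                         ∎

root-cauchy′ : ∀ k (x : ℝ) (R : ℕ → ℚ → ℚ) (δ : ℕ → ℚ) →
  (∀ n q → 0ℚ ℚ.≤ R n q) → (∀ n → 0ℚ ℚ.≤ δ n) →
  (∀ n q → 0ℚ ℚ.≤ q → R n q ^ℚ suc k ℚ.≤ q) →
  (∀ n q → q ℚ.< (R n q ℚ.+ δ n) ^ℚ suc k) →
  (∀ ε → 0ℚ ℚ.< ε → ∃[ N ] (∀ n → N ℕ.≤ n → δ n ℚ.≤ ε)) →
  Cauchy (λ n → R n ℚ.∣ seq x n ∣)
root-cauchy′ k x R δ 0≤R 0≤δ lower upper δ→0 ε 0<ε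
  with cauchy x (half ε ^ℚ suc k) (^-pos (half-pos 0<ε) (suc k)) | δ→0 (half ε) (half-pos 0<ε)
... | N₁ , h | N₂ , g = N₁ ℕ.⊔ N₂ , λ m n N≤m N≤n →
  ∣-∣≤ (below m n N≤m N≤n) (below n m N≤n N≤m)
  where
  below : ∀ m n → N₁ ℕ.⊔ N₂ ℕ.≤ m → N₁ ℕ.⊔ N₂ ℕ.≤ n →
    R m ℚ.∣ seq x m ∣ ℚ.≤ R n ℚ.∣ seq x n ∣ ℚ.+ ε
  below m n N≤m N≤n = root-gap k (R n b) (R m a) (δ n) a b ε 0<ε
    (0≤R n b) (0≤δ n) (g n (ℕ.m⊔n≤o⇒n≤o N₁ N₂ N≤n))
    (lower m a (ℚ.0≤∣p∣ (seq x m))) (upper n b)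
    (ℚ.≤-trans (∣p∣≤∣q∣+∣p-q∣ (seq x m) (seq x n))
      (ℚ.+-monoʳ-≤ b (h m n (ℕ.m⊔n≤o⇒m≤o N₁ N₂ N≤m) (ℕ.m⊔n≤o⇒m≤o N₁ N₂ N≤n))))
    where
    a b : ℚ
    a = ℚ.∣ seq x m ∣
    b = ℚ.∣ seq x n ∣

root-cauchy : ∀ k x → Cauchy (λ n → rootℚ k n ℚ.∣ seq x n ∣)
root-cauchy k x = root-cauchy′ k x (rootℚ k) (λ n → grid n 1)
  (λ n q → 0≤ℕ/ (rootSearch (grid n) k q (rootBound n q)) n) (0≤ℕ/ 1)
  (rootℚ-lower k) (rootℚ-upper k) 1/suc≤

-- root k x is the k-th root of ∣ x ∣, used only for k ≥ 1 and x ≥ 0; root 0 x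
-- is a junk value.

root : ℕ → ℝ → ℝ
root zero    x = 0ℝ
root (suc k) x = mkℝ (λ n → rootℚ k n ℚ.∣ seq x n ∣) (root-cauchy k x)

-- Positive rational exponents a / b, with a , b ≥ 1.

record Exponent : Set where
  constructor _/_
  field
    num den : ℕ

infixl 7 _/_
infixr 8 _^ᵉ_

inv : Exponent → Exponent
inv (a / b) = b / a

_^ᵉ_ : ℝ → Exponent → ℝ
x ^ᵉ (a / b) = root b (x ^ a)

Vector : ℕ → Set
Vector n = Fin n → ℝ

Matrix : ℕ → Set
Matrix n = Fin n → Fin n → ℝ

0ⱽ : ∀ {n} → Vector n
0ⱽ _ = 0ℝ

_≈ⱽ_ : ∀ {n} → Vector n → Vector n → Set
x ≈ⱽ y = ∀ i → x i ≈ y i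

_·_ : ∀ {n} → Matrix n → Vector n → Vector n
(A · x) i = sum (λ j → A i j * x j)

norm : ∀ {n} → Exponent → Vector n → ℝ
norm p x = sum (λ i → ∣ x i ∣ ^ᵉ p) ^ᵉ inv p

-- s is ‖Ax‖ᵣ / ‖x‖ₚ for some x ≠ 0.  A constructive reciprocal would need a
-- positive lower bound for ‖x‖ₚ, so the quotient is given by s ‖x‖ₚ = ‖Ax‖ᵣ.

IsNormRatio : ∀ {n} → Exponent → Exponent → Matrix n → ℝ → Set
IsNormRatio p r A s = ∃[ x ] (¬ x ≈ⱽ 0ⱽ × s * norm p x ≈ norm r (A · x))

-- The supremum of these quotients is taken in [0,∞), so that it is 0 for the
-- 0 × 0 matrix.

IsOperatorNorm : ∀ {n} → Exponent → Exponent → Matrix n → ℝ → Set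
IsOperatorNorm p r A N =
    0ℝ ≤ N
  × (∀ s → IsNormRatio p r A s → s ≤ N)
  × (∀ K → 0ℝ ≤ K → (∀ s → IsNormRatio p r A s → s ≤ K) → N ≤ K)

record ℂ : Set where
  constructor _+i_
  field
    re im : ℝ

open ℂ public

infix 4 _≈ᶜ_
infixl 7 _*ᶜ_

0ᶜ : ℂ
0ᶜ = 0ℝ +i 0ℝ

_≈ᶜ_ : ℂ → ℂ → Set
z ≈ᶜ w = re z ≈ re w × im z ≈ im w

_*ᶜ_ : ℂ → ℂ → ℂ
z *ᶜ w = (re z * re w + - (im z * im w)) +i (re z * im w + im z * re w)

modulus : ℂ → ℝ
modulus z = root 2 (re z ^ 2 + im z ^ 2)

_·ᶜ_ : ∀ {n} → Matrix n → (Fin n → ℂ) → (Fin n → ℂ)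
(A ·ᶜ z) i = (A · (re ∘ z)) i +i (A · (im ∘ z)) i

IsEigenvalue : ∀ {n} → Matrix n → ℂ → Set
IsEigenvalue A μ = ∃[ z ] (¬ (∀ i → z i ≈ᶜ 0ᶜ) × (∀ i → (A ·ᶜ z) i ≈ᶜ μ *ᶜ z i))

IsSpectralRadius : ∀ {n} → Matrix n → ℝ → Set
IsSpectralRadius A ρ =
    (∃[ μ ] (IsEigenvalue A μ × modulus μ ≈ ρ))
  × (∀ μ → IsEigenvalue A μ → modulus μ ≤ ρ)

record Graph (n : ℕ) : Set where
  field
    adj    : Fin n → Fin n → Bool
    symm   : ∀ i j → adj i j ≡ adj j i
    irrefl : ∀ i → adj i i ≡ false

open Graph public

adjacencyMatrix : ∀ {n} → Graph n → Matrix n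
adjacencyMatrix G i j = if adj G i j then 1ℝ else 0ℝ

edges : ∀ {n} → Graph n → List (Fin n × Fin n)
edges {n} G = List.filter (λ (i , j) → i <? j ×-dec T? (adj G i j))
  (List.cartesianProduct (List.allFin n) (List.allFin n))

M : ∀ {n} → Graph n → ℕ
M G = 2 ℕ.* List.length (edges G)

IsHom : ∀ {h n} → Graph h → Graph n → (Fin h → Fin n) → Set
IsHom H G f = ∀ i j → T (adj H i j) → T (adj G (f i) (f j))

isHom? : ∀ {h n} (H : Graph h) (G : Graph n) f → Dec (IsHom H G f)
isHom? H G f = all? λ i → all? λ j → T? (adj H i j) →-dec T? (adj G (f i) (f j))

-- All maps Fin h → Fin n, as value tables.

allMaps : ∀ h n → List (Vec (Fin n) h)
allMaps zero    n = Vec.[] ∷ []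
allMaps (suc h) n = List.cartesianProductWith Vec._∷_ (List.allFin n) (allMaps h n)

hom : ∀ {h n} → Graph h → Graph n → ℕ
hom {h} {n} H G = List.length (List.filter (isHom? H G ∘ Vec.lookup) (allMaps h n))

-- The vertices of K a b are Fin a ⊎ Fin b, encoded as Fin (a + b) by splitAt.

inLeft : ∀ a {b} → Fin (a ℕ.+ b) → Bool
inLeft a i with splitAt a i
... | inj₁ _ = true
... | inj₂ _ = false

K : ∀ a b → Graph (a ℕ.+ b)
K a b = record
  { adj    = λ i j → inLeft a i xor inLeft a j
  ; symm   = λ i j → xor-comm (inLeft a i) (inLeft a j)
  ; irrefl = λ i → xor-same (inLeft a i)
  }

module Submission where

-- Let c(v) be the number of common neighbours of a t-tuple v of vertices.  Sorting
-- the homomorphisms K_{t,t} → G by the images of one side gives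
-- hom(K_{t,t}, G) = Σ_v c(v)^t, while ‖Ax‖_t^t ≤ Σ_v c(v) Π_k |x(v_k)|; Hölder's
-- inequality with exponents t and t/(t-1) compares the two.
-- For the second bound let v = |z| for an eigenvector z whose eigenvalue has modulus
-- ρ, so that ρ Σ v_i² ≤ Σ A_ij v_i v_j.  The power mean inequality over the M(G) ordered
-- pairs of adjacent vertices passes from v to x = v^(2(t-1)/t), and
-- Σ A_ij x_i x_j is bounded by Hölder and the first part.
-- With x_j = y_j^(t-1) and v_i = w_i^t these are polynomial inequalities between
-- nonnegative rationals, so they are proved for each term of the sequences that
-- represent y and w.

open import Defs
open import Data.Nat as ℕ using (ℕ; _∸_; >-nonZero)
open import Data.Nat.Properties using (m^n≢0)
open import Data.Product using (_×_)

open import Algebra.Bundles using (module CommutativeRing)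
open import Data.Bool.Base using (Bool; true; false; T; _∧_; if_then_else_)
open import Data.Bool.Properties using (T?)
open import Data.Empty using (⊥-elim)
open import Data.Fin.Base as Fin using (Fin; zero; suc; splitAt)
open import Data.Fin.Properties using (_<?_; <-cmp; <-asym)
open import Data.Integer.Base as ℤ using (+_)
import Data.Integer.Properties as ℤ
open import Data.List.Base as List using (List; []; _∷_)
open import Data.Nat.Base using (zero; suc)
import Data.Nat.Properties as ℕ
open import Data.Nat.Tactic.RingSolver using (solve-∀)
open import Data.Product.Base using (_,_; ∃-syntax; proj₁; proj₂)
open import Data.Rational.Base as ℚ using (ℚ; 0ℚ; 1ℚ)
import Data.Rational.Properties as ℚ
open import Data.Rational.Solver using (module +-*-Solver)
import Data.Rational.Unnormalised.Base as ℚᵘ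
import Data.Rational.Unnormalised.Properties as ℚᵘ
open import Data.Sum.Base using (_⊎_; inj₁; inj₂)
open import Data.Vec.Base using (Vec; []; _∷_; _++_; lookup)
open import Data.Vec.Properties using (lookup-splitAt)
open import Function.Base using (_∘_)
open import Level using (0ℓ)
open import Relation.Binary.Bundles using (Preorder)
open import Relation.Binary.Definitions using (tri<; tri≈; tri>)
open import Relation.Binary.PropositionalEquality using (_≡_; refl; sym; trans; cong; cong₂; subst; subst₂)
open import Relation.Nullary using (¬_; Dec; does; yes; no)
open import Relation.Nullary.Decidable using (_×-dec_)

open import Algebra.Properties.CommutativeSemiring.Exp (CommutativeRing.commutativeSemiring ℚ.+-*-commutativeRing)
  using () renaming (_^_ to _^ℚ_; ^-homo-* to ^ℚ-homo-*; ^-assocʳ to ^ℚ-assocʳ; ^-distrib-* to ^ℚ-distrib-*)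
open import Algebra.Properties.Semiring.Mult (CommutativeRing.semiring ℚ.+-*-commutativeRing)
  using () renaming (_×_ to _×ℚ_; ×-comm-* to ×ℚ-comm-*)

-- Hölder's inequality over ℚ

-- The exponent 2(t-1)/t is dictated by q = t/(t-1): it gives x_i^q = v_i^2, so the norm of x that
-- Hölder and the first part produce is a power of Σ v_i², the very sum in the Rayleigh inequality.
-- With y_i = w_i², both v and x are powers of the single vector w.
--
-- Working term by term meets an obstacle: the sequence representing a root satisfies the defining
-- equation of the root only in the limit. Since the entries of A are nonnegative, it is enough that
-- the powers of the roots dominate the given values at every index, so roots are approximated from
-- above.
--
-- The supremum is never computed: the t²-th root of hom(K_{t,t}, G) bounds every norm ratio, and
-- leastness does the rest. The vectors x and z are nonzero only in the negated sense, which yields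
-- no positive lower bound to divide by; the factors ‖x‖ and Σ v_i² are therefore cancelled by
-- contradiction.

private variable
  I J : Set

p≤q⇒0≤q-p : ∀ {p q} → p ℚ.≤ q → 0ℚ ℚ.≤ q ℚ.- p
p≤q⇒0≤q-p {p} {q} p≤q = subst (ℚ._≤ q ℚ.- p) (ℚ.+-inverseʳ p) (ℚ.+-monoˡ-≤ (ℚ.- p) p≤q)

+-cancelʳ-≤ : ∀ r {p q} → p ℚ.+ r ℚ.≤ q ℚ.+ r → p ℚ.≤ q
+-cancelʳ-≤ r {p} {q} p+r≤q+r = subst₂ ℚ._≤_ (cancel p r) (cancel q r) (ℚ.+-monoˡ-≤ (ℚ.- r) p+r≤q+r)
  where
  open +-*-Solver
  cancel : ∀ p r → p ℚ.+ r ℚ.- r ≡ p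
  cancel = solve 2 (λ p r → p :+ r :- r := p) refl

-- Superadditivity of the power at `y = x + (y - x)` leaves the positive surplus `(y - x) ^ suc k`.
^ℚ-mono-< : ∀ {x y} → 0ℚ ℚ.≤ x → x ℚ.< y → ∀ k → x ^ℚ suc k ℚ.< y ^ℚ suc k
^ℚ-mono-< {x} {y} 0≤x x<y k = begin-strict
  x ^ℚ suc k                            ≡⟨ ℚ.+-identityʳ (x ^ℚ suc k) ⟨
  x ^ℚ suc k ℚ.+ 0ℚ                     <⟨ ℚ.+-monoʳ-< (x ^ℚ suc k) (^-pos 0<y-x (suc k)) ⟩
  x ^ℚ suc k ℚ.+ (y ℚ.- x) ^ℚ suc k     ≤⟨ ^-superadditive 0≤x (ℚ.<⇒≤ 0<y-x) k ⟩
  (x ℚ.+ (y ℚ.- x)) ^ℚ suc k            ≡⟨ cong (_^ℚ suc k) (solve 2 (λ x y → x :+ (y :- x) := y) refl x y) ⟩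
  y ^ℚ suc k                            ∎
  where
  open ℚ.≤-Reasoning
  open +-*-Solver
  0<y-x : 0ℚ ℚ.< y ℚ.- x
  0<y-x = subst (ℚ._< y ℚ.- x) (ℚ.+-inverseʳ x) (ℚ.+-monoˡ-< (ℚ.- x) x<y)

^ℚ-cancel-≤ : ∀ k {x y} → 0ℚ ℚ.≤ y → x ^ℚ suc k ℚ.≤ y ^ℚ suc k → x ℚ.≤ y
^ℚ-cancel-≤ k 0≤y x^≤y^ = ℚ.≮⇒≥ λ y<x → ℚ.<-irrefl refl (ℚ.<-≤-trans (^ℚ-mono-< 0≤y y<x k) x^≤y^)

rearrangement : ∀ {a b c d} → a ℚ.≤ b → c ℚ.≤ d → b ℚ.* c ℚ.+ a ℚ.* d ℚ.≤ a ℚ.* c ℚ.+ b ℚ.* d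
rearrangement {a} {b} {c} {d} a≤b c≤d = subst₂ ℚ._≤_
  (solve 4 (λ a b c d → (b :- a) :* c :+ (a :* c :+ a :* d) := b :* c :+ a :* d) refl a b c d)
  (solve 4 (λ a b c d → (b :- a) :* d :+ (a :* c :+ a :* d) := a :* c :+ b :* d) refl a b c d)
  (ℚ.+-monoˡ-≤ (a ℚ.* c ℚ.+ a ℚ.* d)
    (ℚ.*-monoˡ-≤-nonNeg (b ℚ.- a) {{ℚ.nonNegative (p≤q⇒0≤q-p a≤b)}} c≤d))
  where open +-*-Solver

-- This is AM-GM for one `x ^ suc k` and `k` copies of `y ^ suc k`, with integer multiples in place
-- of fractional weights. The induction multiplies the case `k` by `y`; the remaining comparison is
-- the rearrangement inequality `swap`.
young : ∀ k {x y} → 0ℚ ℚ.≤ x → 0ℚ ℚ.≤ y → suc k ×ℚ (x ℚ.* y ^ℚ k) ℚ.≤ x ^ℚ suc k ℚ.+ k ×ℚ (y ^ℚ suc k)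
young zero    0≤x 0≤y = ℚ.≤-refl
young (suc k) {x} {y} 0≤x 0≤y = begin
  z ℚ.+ suc k ×ℚ z
    ≡⟨ cong (λ u → z ℚ.+ suc k ×ℚ u) (solve 3 (λ x y u → x :* (y :* u) := y :* (x :* u)) refl x y (y ^ℚ k)) ⟩
  z ℚ.+ suc k ×ℚ (y ℚ.* (x ℚ.* y ^ℚ k))
    ≡⟨ cong (z ℚ.+_) (×ℚ-comm-* (suc k) y (x ℚ.* y ^ℚ k)) ⟨
  z ℚ.+ y ℚ.* (suc k ×ℚ (x ℚ.* y ^ℚ k))
    ≤⟨ ℚ.+-monoʳ-≤ z (ℚ.*-monoˡ-≤-nonNeg y {{ℚ.nonNegative 0≤y}} (young k 0≤x 0≤y)) ⟩
  z ℚ.+ y ℚ.* (x ^ℚ suc k ℚ.+ k ×ℚ (y ^ℚ suc k))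
    ≡⟨ cong (z ℚ.+_) (trans (ℚ.*-distribˡ-+ y (x ^ℚ suc k) _) (cong (y ℚ.* x ^ℚ suc k ℚ.+_) (×ℚ-comm-* k y _))) ⟩
  z ℚ.+ (y ℚ.* x ^ℚ suc k ℚ.+ r)
    ≡⟨ ℚ.+-assoc z _ r ⟨
  z ℚ.+ y ℚ.* x ^ℚ suc k ℚ.+ r
    ≤⟨ ℚ.+-monoˡ-≤ r swap ⟩
  x ^ℚ suc (suc k) ℚ.+ y ^ℚ suc (suc k) ℚ.+ r
    ≡⟨ ℚ.+-assoc (x ^ℚ suc (suc k)) _ r ⟩
  x ^ℚ suc (suc k) ℚ.+ (y ^ℚ suc (suc k) ℚ.+ r) ∎
  where
  open ℚ.≤-Reasoning
  open +-*-Solver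
  z r : ℚ
  z = x ℚ.* y ^ℚ suc k
  r = k ×ℚ (y ^ℚ suc (suc k))
  swap : z ℚ.+ y ℚ.* x ^ℚ suc k ℚ.≤ x ^ℚ suc (suc k) ℚ.+ y ^ℚ suc (suc k)
  swap with ℚ.≤-total x y
  ... | inj₁ x≤y = subst (ℚ._≤ x ^ℚ suc (suc k) ℚ.+ y ^ℚ suc (suc k)) (ℚ.+-comm (y ℚ.* x ^ℚ suc k) z)
    (rearrangement x≤y (^-mono 0≤x x≤y (suc k)))
  ... | inj₂ y≤x = subst (z ℚ.+ y ℚ.* x ^ℚ suc k ℚ.≤_) (ℚ.+-comm (y ^ℚ suc (suc k)) _)
    (rearrangement y≤x (^-mono 0≤y y≤x (suc k)))

∑ : List I → (I → ℚ) → ℚ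
∑ []       f = 0ℚ
∑ (x ∷ xs) f = f x ℚ.+ ∑ xs f

syntax ∑ xs (λ x → e) = ∑[ x ∈ xs ] e

∑-cong : ∀ (xs : List I) {f g} → (∀ x → f x ≡ g x) → ∑ xs f ≡ ∑ xs g
∑-cong []       f≡g = refl
∑-cong (x ∷ xs) f≡g = cong₂ ℚ._+_ (f≡g x) (∑-cong xs f≡g)

∑-mono : ∀ (xs : List I) {f g} → (∀ x → f x ℚ.≤ g x) → ∑ xs f ℚ.≤ ∑ xs g
∑-mono []       f≤g = ℚ.≤-refl
∑-mono (x ∷ xs) f≤g = ℚ.+-mono-≤ (f≤g x) (∑-mono xs f≤g)

∑-nonNeg : ∀ (xs : List I) {f} → (∀ x → 0ℚ ℚ.≤ f x) → 0ℚ ℚ.≤ ∑ xs f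
∑-nonNeg []       0≤f = ℚ.≤-refl
∑-nonNeg (x ∷ xs) 0≤f = +-nonNeg (0≤f x) (∑-nonNeg xs 0≤f)

∑-zero : ∀ (xs : List I) → ∑[ x ∈ xs ] 0ℚ ≡ 0ℚ
∑-zero []       = refl
∑-zero (x ∷ xs) = trans (ℚ.+-identityˡ _) (∑-zero xs)

∑-distrib-+ : ∀ (xs : List I) f g → ∑[ x ∈ xs ] (f x ℚ.+ g x) ≡ ∑ xs f ℚ.+ ∑ xs g
∑-distrib-+ []       f g = refl
∑-distrib-+ (x ∷ xs) f g = trans (cong (f x ℚ.+ g x ℚ.+_) (∑-distrib-+ xs f g))
  (solve 4 (λ a b c d → (a :+ b) :+ (c :+ d) := (a :+ c) :+ (b :+ d)) refl (f x) (g x) (∑ xs f) (∑ xs g))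
  where open +-*-Solver

*-distribˡ-∑ : ∀ c (xs : List I) f → c ℚ.* ∑ xs f ≡ ∑[ x ∈ xs ] (c ℚ.* f x)
*-distribˡ-∑ c []       f = ℚ.*-zeroʳ c
*-distribˡ-∑ c (x ∷ xs) f = trans (ℚ.*-distribˡ-+ c (f x) _) (cong (c ℚ.* f x ℚ.+_) (*-distribˡ-∑ c xs f))

*-distribʳ-∑ : ∀ c (xs : List I) f → ∑ xs f ℚ.* c ≡ ∑[ x ∈ xs ] (f x ℚ.* c)
*-distribʳ-∑ c xs f = trans (ℚ.*-comm (∑ xs f) c)
  (trans (*-distribˡ-∑ c xs f) (∑-cong xs λ x → ℚ.*-comm c (f x)))

×ℚ-distrib-∑ : ∀ n (xs : List I) f → ∑[ x ∈ xs ] (n ×ℚ f x) ≡ n ×ℚ ∑ xs f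
×ℚ-distrib-∑ zero    xs f = ∑-zero xs
×ℚ-distrib-∑ (suc n) xs f = trans (∑-distrib-+ xs f (λ x → n ×ℚ f x)) (cong (∑ xs f ℚ.+_) (×ℚ-distrib-∑ n xs f))

∑-swap : ∀ (xs : List I) (ys : List J) (f : I → J → ℚ) → ∑[ x ∈ xs ] ∑[ y ∈ ys ] f x y ≡ ∑[ y ∈ ys ] ∑[ x ∈ xs ] f x y
∑-swap []       ys f = sym (∑-zero ys)
∑-swap (x ∷ xs) ys f = trans (cong (∑ ys (f x) ℚ.+_) (∑-swap xs ys f))
  (sym (∑-distrib-+ ys (f x) (λ y → ∑[ x ∈ xs ] f x y)))

∑≡0⇒∑≡0 : ∀ (xs : List I) {f g} → (∀ x → 0ℚ ℚ.≤ f x) → (∀ x → f x ≡ 0ℚ → g x ≡ 0ℚ) →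
  ∑ xs f ≡ 0ℚ → ∑ xs g ≡ 0ℚ
∑≡0⇒∑≡0 []       0≤f f⇒g eq = refl
∑≡0⇒∑≡0 (x ∷ xs) {f} 0≤f f⇒g eq = cong₂ ℚ._+_
  (f⇒g x (ℚ.≤-antisym (subst (f x ℚ.≤_) eq (x≤x+y (∑-nonNeg xs 0≤f))) (0≤f x)))
  (∑≡0⇒∑≡0 xs 0≤f f⇒g (ℚ.≤-antisym (subst (∑ xs f ℚ.≤_) eq (y≤x+y (0≤f x))) (∑-nonNeg xs 0≤f)))

-- Young's inequality for the pairs (a x · B , P · b x), summed over x, is
-- homogeneous in P and B, so no (k+1)-st root of B is needed to normalise b.

hölder : ∀ k (xs : List I) (a b : I → ℚ) → (∀ x → 0ℚ ℚ.≤ a x) → (∀ x → 0ℚ ℚ.≤ b x) →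
  (∑[ x ∈ xs ] (a x ℚ.* b x ^ℚ k)) ^ℚ suc k ℚ.≤
  ∑[ x ∈ xs ] (a x ^ℚ suc k) ℚ.* (∑[ x ∈ xs ] (b x ^ℚ suc k)) ^ℚ k
hölder zero        xs a b 0≤a 0≤b = ℚ.≤-refl
hölder {I} k@(suc k′) xs a b 0≤a 0≤b = by-cases (ℚ.<-cmp 0ℚ B)
  where
  open ℚ.≤-Reasoning
  open +-*-Solver
  P A B : ℚ
  P = ∑[ x ∈ xs ] (a x ℚ.* b x ^ℚ k)
  A = ∑[ x ∈ xs ] (a x ^ℚ suc k)
  B = ∑[ x ∈ xs ] (b x ^ℚ suc k)
  0≤P : 0ℚ ℚ.≤ P
  0≤P = ∑-nonNeg xs λ x → *-nonNeg (0≤a x) (^-nonNeg (0≤b x) k)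
  0≤B : 0ℚ ℚ.≤ B
  0≤B = ∑-nonNeg xs λ x → ^-nonNeg (0≤b x) (suc k)

  lhs : ∀ x → P ^ℚ k ℚ.* B ℚ.* (a x ℚ.* b x ^ℚ k) ≡ a x ℚ.* B ℚ.* (P ℚ.* b x) ^ℚ k
  lhs x = trans
    (solve 4 (λ p b a c → p :* b :* (a :* c) := a :* b :* (p :* c)) refl (P ^ℚ k) B (a x) (b x ^ℚ k))
    (cong (a x ℚ.* B ℚ.*_) (sym (^ℚ-distrib-* P (b x) k)))

  summed : suc k ×ℚ (P ^ℚ k ℚ.* B ℚ.* P) ℚ.≤ A ℚ.* B ^ℚ suc k ℚ.+ k ×ℚ (P ^ℚ suc k ℚ.* B)
  summed = begin
    suc k ×ℚ (P ^ℚ k ℚ.* B ℚ.* P)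
      ≡⟨ cong (suc k ×ℚ_) (*-distribˡ-∑ (P ^ℚ k ℚ.* B) xs _) ⟩
    suc k ×ℚ (∑[ x ∈ xs ] (P ^ℚ k ℚ.* B ℚ.* (a x ℚ.* b x ^ℚ k)))
      ≡⟨ cong (suc k ×ℚ_) (∑-cong xs lhs) ⟩
    suc k ×ℚ (∑[ x ∈ xs ] (a x ℚ.* B ℚ.* (P ℚ.* b x) ^ℚ k))
      ≡⟨ ×ℚ-distrib-∑ (suc k) xs _ ⟨
    ∑[ x ∈ xs ] (suc k ×ℚ (a x ℚ.* B ℚ.* (P ℚ.* b x) ^ℚ k))
      ≤⟨ ∑-mono xs (λ x → young k (*-nonNeg (0≤a x) 0≤B) (*-nonNeg 0≤P (0≤b x))) ⟩
    ∑[ x ∈ xs ] ((a x ℚ.* B) ^ℚ suc k ℚ.+ k ×ℚ ((P ℚ.* b x) ^ℚ suc k))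
      ≡⟨ ∑-cong xs (λ x → cong₂ (λ u v → u ℚ.+ k ×ℚ v) (^ℚ-distrib-* (a x) B (suc k)) (^ℚ-distrib-* P (b x) (suc k))) ⟩
    ∑[ x ∈ xs ] (a x ^ℚ suc k ℚ.* B ^ℚ suc k ℚ.+ k ×ℚ (P ^ℚ suc k ℚ.* b x ^ℚ suc k))
      ≡⟨ ∑-distrib-+ xs _ _ ⟩
    ∑[ x ∈ xs ] (a x ^ℚ suc k ℚ.* B ^ℚ suc k) ℚ.+ ∑[ x ∈ xs ] (k ×ℚ (P ^ℚ suc k ℚ.* b x ^ℚ suc k))
      ≡⟨ cong₂ ℚ._+_ (sym (*-distribʳ-∑ (B ^ℚ suc k) xs _))
           (trans (×ℚ-distrib-∑ k xs _) (cong (k ×ℚ_) (sym (*-distribˡ-∑ (P ^ℚ suc k) xs _)))) ⟩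
    A ℚ.* B ^ℚ suc k ℚ.+ k ×ℚ (P ^ℚ suc k ℚ.* B) ∎

  P^B≤AB^ : P ^ℚ suc k ℚ.* B ℚ.≤ A ℚ.* B ^ℚ k ℚ.* B
  P^B≤AB^ = subst (P ^ℚ suc k ℚ.* B ℚ.≤_)
    (solve 3 (λ a b c → a :* (b :* c) := a :* c :* b) refl A B (B ^ℚ k))
    (+-cancelʳ-≤ (k ×ℚ (P ^ℚ suc k ℚ.* B))
      (subst (λ z → suc k ×ℚ z ℚ.≤ A ℚ.* B ^ℚ suc k ℚ.+ k ×ℚ (P ^ℚ suc k ℚ.* B))
        (solve 3 (λ p b q → q :* b :* p := p :* q :* b) refl P B (P ^ℚ k)) summed))

  by-cases : _ → P ^ℚ suc k ℚ.≤ A ℚ.* B ^ℚ k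
  by-cases (tri< 0<B _ _) = ℚ.*-cancelʳ-≤-pos B {{ℚ.positive 0<B}} P^B≤AB^
  by-cases (tri> _ _ B<0) = ⊥-elim (ℚ.<-irrefl refl (ℚ.<-≤-trans B<0 0≤B))
  by-cases (tri≈ _ 0≡B _) = begin
    P ^ℚ suc k     ≡⟨ cong (_^ℚ suc k) P≡0 ⟩
    0ℚ ^ℚ suc k    ≡⟨ ℚ.*-zeroˡ (0ℚ ^ℚ k) ⟩
    0ℚ             ≤⟨ *-nonNeg (∑-nonNeg xs λ x → ^-nonNeg (0≤a x) (suc k)) (^-nonNeg 0≤B k) ⟩
    A ℚ.* B ^ℚ k   ∎
    where
    b≡0 : ∀ x → b x ^ℚ suc k ≡ 0ℚ → b x ≡ 0ℚ
    b≡0 x eq = ℚ.≤-antisym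
      (^ℚ-cancel-≤ k ℚ.≤-refl (ℚ.≤-reflexive (trans eq (sym (ℚ.*-zeroˡ (0ℚ ^ℚ k)))))) (0≤b x)
    P≡0 : P ≡ 0ℚ
    P≡0 = ∑≡0⇒∑≡0 xs (λ x → ^-nonNeg (0≤b x) (suc k))
      -- Here `k = suc k′` is positive, so `b x ^ k` has a vanishing factor. For exponent zero it
      -- would be 1, hence the separate first clause.
      (λ x eq → trans (cong (λ z → a x ℚ.* (z ℚ.* z ^ℚ k′)) (b≡0 x eq))
        (trans (cong (a x ℚ.*_) (ℚ.*-zeroˡ (0ℚ ^ℚ k′))) (ℚ.*-zeroʳ (a x)))) (sym 0≡B)

-- Power means with 0/1 weights

^ℚ-idem : ∀ {c} → c ℚ.* c ≡ c → ∀ k → c ^ℚ suc k ≡ c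
^ℚ-idem {c} cc≡c zero    = ℚ.*-identityʳ c
^ℚ-idem {c} cc≡c (suc k) = trans (cong (c ℚ.*_) (^ℚ-idem cc≡c k)) cc≡c

^ℚ-assoc-comm : ∀ x m n → (x ^ℚ m) ^ℚ n ≡ (x ^ℚ n) ^ℚ m
^ℚ-assoc-comm x m n = trans (^ℚ-assocʳ x m n) (trans (cong (x ^ℚ_) (ℕ.*-comm m n)) (sym (^ℚ-assocʳ x n m)))

-- Idempotent weights satisfy `(c * z) ^ k = c * z ^ k` for `k ≥ 1`, so the weight can be put into
-- both Hölder factors without extracting roots of it.
module PowerMean {I : Set} (xs : List I) (c z : I → ℚ)
  (0≤c : ∀ x → 0ℚ ℚ.≤ c x) (cc≡c : ∀ x → c x ℚ.* c x ≡ c x) (0≤z : ∀ x → 0ℚ ℚ.≤ z x) where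

  total : ℚ
  total = ∑ xs c

  moment : ℕ → ℚ
  moment m = ∑[ x ∈ xs ] (c x ℚ.* z x ^ℚ m)

  0≤total : 0ℚ ℚ.≤ total
  0≤total = ∑-nonNeg xs 0≤c

  0≤moment : ∀ m → 0ℚ ℚ.≤ moment m
  0≤moment m = ∑-nonNeg xs λ x → *-nonNeg (0≤c x) (^-nonNeg (0≤z x) m)

  weighted-^ : ∀ k x → (c x ℚ.* z x) ^ℚ suc k ≡ c x ℚ.* z x ^ℚ suc k
  weighted-^ k x = trans (^ℚ-distrib-* (c x) (z x) (suc k)) (cong (ℚ._* z x ^ℚ suc k) (^ℚ-idem (cc≡c x) k))

  moment-step : ∀ m → moment (suc m) ^ℚ suc (suc m) ℚ.≤ total ℚ.* moment (suc (suc m)) ^ℚ suc m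
  moment-step m = subst₂ ℚ._≤_
    (cong (_^ℚ suc (suc m)) (∑-cong xs λ x → trans (cong (c x ℚ.*_) (weighted-^ m x))
      (trans (sym (ℚ.*-assoc (c x) (c x) _)) (cong (ℚ._* z x ^ℚ suc m) (cc≡c x)))))
    (cong₂ (λ u v → u ℚ.* v ^ℚ suc m) (∑-cong xs λ x → ^ℚ-idem (cc≡c x) (suc m)) (∑-cong xs (weighted-^ (suc m))))
    (hölder (suc m) xs c (λ x → c x ℚ.* z x) 0≤c (λ x → *-nonNeg (0≤c x) (0≤z x)))

  -- Chains `moment-step` over consecutive orders without fractional exponents: the induction
  -- hypothesis is raised to the power `suc n`, the next link to the power `suc m`, and a common
  -- `n`-th power is cancelled at the end.
  power-mean : ∀ m j → moment (suc m) ^ℚ (suc m ℕ.+ j) ℚ.≤ moment (suc m ℕ.+ j) ^ℚ suc m ℚ.* total ^ℚ j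
  power-mean m zero    = ℚ.≤-reflexive
    (trans (cong (λ n → moment (suc m) ^ℚ suc n) (ℕ.+-identityʳ m))
      (trans (cong (λ n → moment (suc n) ^ℚ suc m) (sym (ℕ.+-identityʳ m))) (sym (ℚ.*-identityʳ _))))
  power-mean m (suc j) = subst (λ n′ → moment (suc m) ^ℚ n′ ℚ.≤ moment n′ ^ℚ suc m ℚ.* total ^ℚ suc j)
    (sym (ℕ.+-suc (suc m) j))
    (^ℚ-cancel-≤ (m ℕ.+ j) (*-nonNeg (^-nonNeg (0≤moment (suc n)) (suc m)) (^-nonNeg 0≤total (suc j))) (begin
      (moment (suc m) ^ℚ suc n) ^ℚ n
        ≡⟨ ^ℚ-assoc-comm (moment (suc m)) (suc n) n ⟩
      (moment (suc m) ^ℚ n) ^ℚ suc n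
        ≤⟨ ^-mono (^-nonNeg (0≤moment (suc m)) n) (power-mean m j) (suc n) ⟩
      (moment n ^ℚ suc m ℚ.* total ^ℚ j) ^ℚ suc n
        ≡⟨ ^ℚ-distrib-* (moment n ^ℚ suc m) (total ^ℚ j) (suc n) ⟩
      (moment n ^ℚ suc m) ^ℚ suc n ℚ.* (total ^ℚ j) ^ℚ suc n
        ≡⟨ cong₂ ℚ._*_ (^ℚ-assoc-comm (moment n) (suc m) (suc n)) (^ℚ-assocʳ total j (suc n)) ⟩
      (moment n ^ℚ suc n) ^ℚ suc m ℚ.* total ^ℚ (j ℕ.* suc n)
        ≤⟨ *-mono (^-nonNeg (^-nonNeg (0≤moment n) (suc n)) (suc m))
             (^-mono (^-nonNeg (0≤moment n) (suc n)) (moment-step (m ℕ.+ j)) (suc m))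
             (^-nonNeg 0≤total (j ℕ.* suc n)) ℚ.≤-refl ⟩
      (total ℚ.* moment (suc n) ^ℚ n) ^ℚ suc m ℚ.* total ^ℚ (j ℕ.* suc n)
        ≡⟨ cong (ℚ._* total ^ℚ (j ℕ.* suc n)) (^ℚ-distrib-* total (moment (suc n) ^ℚ n) (suc m)) ⟩
      total ^ℚ suc m ℚ.* (moment (suc n) ^ℚ n) ^ℚ suc m ℚ.* total ^ℚ (j ℕ.* suc n)
        ≡⟨ solve 3 (λ a b d → a :* b :* d := b :* (a :* d)) refl
             (total ^ℚ suc m) ((moment (suc n) ^ℚ n) ^ℚ suc m) (total ^ℚ (j ℕ.* suc n)) ⟩
      (moment (suc n) ^ℚ n) ^ℚ suc m ℚ.* (total ^ℚ suc m ℚ.* total ^ℚ (j ℕ.* suc n))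
        ≡⟨ cong₂ ℚ._*_ (^ℚ-assoc-comm (moment (suc n)) n (suc m)) (begin-equality
             total ^ℚ suc m ℚ.* total ^ℚ (j ℕ.* suc n) ≡⟨ ^ℚ-homo-* total (suc m) (j ℕ.* suc n) ⟨
             total ^ℚ (suc m ℕ.+ j ℕ.* suc n)          ≡⟨ cong (total ^ℚ_) (exponents m j) ⟩
             total ^ℚ (suc j ℕ.* n)                    ≡⟨ ^ℚ-assocʳ total (suc j) n ⟨
             (total ^ℚ suc j) ^ℚ n                     ∎) ⟩
      (moment (suc n) ^ℚ suc m) ^ℚ n ℚ.* (total ^ℚ suc j) ^ℚ n
        ≡⟨ ^ℚ-distrib-* (moment (suc n) ^ℚ suc m) (total ^ℚ suc j) n ⟨
      (moment (suc n) ^ℚ suc m ℚ.* total ^ℚ suc j) ^ℚ n ∎))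
    where
    open ℚ.≤-Reasoning
    open +-*-Solver
    n : ℕ
    n = suc (m ℕ.+ j)
    exponents : ∀ m j → suc m ℕ.+ j ℕ.* suc (suc (m ℕ.+ j)) ≡ suc j ℕ.* suc (m ℕ.+ j)
    exponents = solve-∀

-- Counting homomorphisms from complete bipartite graphs

∏ : ∀ {h} → (I → ℚ) → Vec I h → ℚ
∏ f []      = 1ℚ
∏ f (x ∷ v) = f x ℚ.* ∏ f v

∏-nonNeg : ∀ {h} {f : I → ℚ} → (∀ x → 0ℚ ℚ.≤ f x) → (v : Vec I h) → 0ℚ ℚ.≤ ∏ f v
∏-nonNeg 0≤f []      = ℚ.nonNegative⁻¹ 1ℚ
∏-nonNeg 0≤f (x ∷ v) = *-nonNeg (0≤f x) (∏-nonNeg 0≤f v)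

∏-distrib-* : ∀ {h} (f g : I → ℚ) (v : Vec I h) → ∏ (λ x → f x ℚ.* g x) v ≡ ∏ f v ℚ.* ∏ g v
∏-distrib-* f g []      = refl
∏-distrib-* f g (x ∷ v) = trans (cong (f x ℚ.* g x ℚ.*_) (∏-distrib-* f g v))
  (solve 4 (λ a b c d → (a :* b) :* (c :* d) := (a :* c) :* (b :* d)) refl (f x) (g x) (∏ f v) (∏ g v))
  where open +-*-Solver

∏-^ : ∀ {h} (f : I → ℚ) k (v : Vec I h) → ∏ (λ x → f x ^ℚ k) v ≡ ∏ f v ^ℚ k
∏-^ f zero    []      = refl
∏-^ f zero    (x ∷ v) = trans (ℚ.*-identityˡ _) (∏-^ f zero v)
∏-^ f (suc k) v       = trans (∏-distrib-* f (λ x → f x ^ℚ k) v) (cong (∏ f v ℚ.*_) (∏-^ f k v))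

∏-indicator : ∀ {h} {f : I → ℚ} {P : I → Set} → (∀ x → f x ≡ 0ℚ ⊎ f x ≡ 1ℚ × P x) →
  (v : Vec I h) → ∏ f v ≡ 0ℚ ⊎ ∏ f v ≡ 1ℚ × (∀ i → P (lookup v i))
∏-indicator f01 [] = inj₂ (refl , λ ())
∏-indicator {f = f} f01 (x ∷ v) with f01 x | ∏-indicator f01 v
... | inj₁ eq      | _                = inj₁ (trans (cong (ℚ._* ∏ f v) eq) (ℚ.*-zeroˡ (∏ f v)))
... | inj₂ (_ , _) | inj₁ eq          = inj₁ (trans (cong (f x ℚ.*_) eq) (ℚ.*-zeroʳ (f x)))
... | inj₂ (e , p) | inj₂ (e′ , all)  = inj₂ (cong₂ ℚ._*_ e e′ , λ { zero → p ; (suc i) → all i })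

∑-++ : (xs ys : List I) (f : I → ℚ) → ∑ (xs List.++ ys) f ≡ ∑ xs f ℚ.+ ∑ ys f
∑-++ []       ys f = sym (ℚ.+-identityˡ _)
∑-++ (x ∷ xs) ys f = trans (cong (f x ℚ.+_) (∑-++ xs ys f)) (sym (ℚ.+-assoc (f x) _ _))

∑-map : (g : J → I) (xs : List J) (f : I → ℚ) → ∑ (List.map g xs) f ≡ ∑[ x ∈ xs ] f (g x)
∑-map g []       f = refl
∑-map g (x ∷ xs) f = cong (f (g x) ℚ.+_) (∑-map g xs f)

∑-cartesianProductWith : ∀ {L : Set} (g : I → J → L) xs ys (f : L → ℚ) →
  ∑ (List.cartesianProductWith g xs ys) f ≡ ∑[ x ∈ xs ] ∑[ y ∈ ys ] f (g x y)
∑-cartesianProductWith g []       ys f = refl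
∑-cartesianProductWith g (x ∷ xs) ys f = trans (∑-++ (List.map (g x) ys) _ f)
  (cong₂ ℚ._+_ (∑-map (g x) ys f) (∑-cartesianProductWith g xs ys f))

∑-allMaps-++ : ∀ a b n (f : Vec (Fin n) (a ℕ.+ b) → ℚ) →
  ∑ (allMaps (a ℕ.+ b) n) f ≡ ∑[ u ∈ allMaps a n ] ∑[ v ∈ allMaps b n ] f (u ++ v)
∑-allMaps-++ zero    b n f = sym (ℚ.+-identityʳ _)
∑-allMaps-++ (suc a) b n f = trans (∑-cartesianProductWith _∷_ (List.allFin n) _ f)
  (trans (∑-cong (List.allFin n) λ i → ∑-allMaps-++ a b n λ v → f (i ∷ v))
    (sym (∑-cartesianProductWith _∷_ (List.allFin n) _ _)))

-- Multinomial expansion with no terms collected: choosing a summand in each of the `h` factors is a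
-- map from `Fin h`.
∑-^ : ∀ h n (f : Fin n → ℚ) → ∑ (List.allFin n) f ^ℚ h ≡ ∑ (allMaps h n) (∏ f)
∑-^ zero    n f = sym (ℚ.+-identityʳ 1ℚ)
∑-^ (suc h) n f = begin-equality
  ∑ (List.allFin n) f ℚ.* ∑ (List.allFin n) f ^ℚ h
    ≡⟨ cong (∑ (List.allFin n) f ℚ.*_) (∑-^ h n f) ⟩
  ∑ (List.allFin n) f ℚ.* ∑ (allMaps h n) (∏ f)
    ≡⟨ *-distribʳ-∑ _ (List.allFin n) f ⟩
  ∑[ i ∈ List.allFin n ] (f i ℚ.* ∑ (allMaps h n) (∏ f))
    ≡⟨ ∑-cong (List.allFin n) (λ i → *-distribˡ-∑ (f i) (allMaps h n) _) ⟩
  ∑[ i ∈ List.allFin n ] ∑[ v ∈ allMaps h n ] (f i ℚ.* ∏ f v)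
    ≡⟨ ∑-cartesianProductWith _∷_ (List.allFin n) (allMaps h n) (∏ f) ⟨
  ∑ (allMaps (suc h) n) (∏ f) ∎
  where open ℚ.≤-Reasoning

toℚ : ℕ → ℚ
toℚ n = + n ℚ./ 1

toℚ-suc : ∀ n → toℚ (suc n) ≡ 1ℚ ℚ.+ toℚ n
toℚ-suc n = trans (suc-/ n 0) (ℚ.+-comm (toℚ n) 1ℚ)

toℚ-+ : ∀ m n → toℚ (m ℕ.+ n) ≡ toℚ m ℚ.+ toℚ n
toℚ-+ zero    n = sym (ℚ.+-identityˡ (toℚ n))
toℚ-+ (suc m) n = trans (toℚ-suc (m ℕ.+ n)) (trans (cong (1ℚ ℚ.+_) (toℚ-+ m n))
  (trans (sym (ℚ.+-assoc 1ℚ (toℚ m) (toℚ n))) (cong (ℚ._+ toℚ n) (sym (toℚ-suc m)))))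

χ : Bool → ℚ
χ b = if b then 1ℚ else 0ℚ

0≤χ : ∀ b → 0ℚ ℚ.≤ χ b
0≤χ true  = ℚ.nonNegative⁻¹ 1ℚ
0≤χ false = ℚ.≤-refl

χ-idem : ∀ b → χ b ℚ.* χ b ≡ χ b
χ-idem true  = refl
χ-idem false = refl

χ-indicator : ∀ b → χ b ≡ 0ℚ ⊎ χ b ≡ 1ℚ × T b
χ-indicator true  = inj₂ (refl , _)
χ-indicator false = inj₁ refl

indicator≤χ : ∀ {q} {P : Set} (P? : Dec P) → q ≡ 0ℚ ⊎ q ≡ 1ℚ × P → q ℚ.≤ χ (does P?)
indicator≤χ P?       (inj₁ refl)       = 0≤χ (does P?)
indicator≤χ (yes _)  (inj₂ (refl , _)) = ℚ.≤-refl
indicator≤χ (no ¬p)  (inj₂ (_ , p))    = ⊥-elim (¬p p)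

toℚ-length-filter : ∀ {P : I → Set} (P? : ∀ x → Dec (P x)) xs →
  toℚ (List.length (List.filter P? xs)) ≡ ∑[ x ∈ xs ] χ (does (P? x))
toℚ-length-filter P? [] = refl
toℚ-length-filter P? (x ∷ xs) with does (P? x)
... | false = trans (toℚ-length-filter P? xs) (sym (ℚ.+-identityˡ _))
... | true  = trans (toℚ-suc (List.length (List.filter P? xs))) (cong (1ℚ ℚ.+_) (toℚ-length-filter P? xs))

module _ {n} (G : Graph n) where

  private
    V : List (Fin n)
    V = List.allFin n

  A : Fin n → Fin n → ℚ
  A i j = χ (adj G i j)

  0≤A : ∀ i j → 0ℚ ℚ.≤ A i j
  0≤A i j = 0≤χ (adj G i j)

  -- An ordered adjacent pair is either an entry of `edges`, where `i < j`, or the reversal of one;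
  -- irreflexivity empties the diagonal.
  ∑A≡M : ∑[ i ∈ V ] ∑[ j ∈ V ] A i j ≡ toℚ (M G)
  ∑A≡M = begin-equality
    ∑[ i ∈ V ] ∑[ j ∈ V ] A i j
      ≡⟨ ∑-cong V (λ i → ∑-cong V λ j → split i j) ⟩
    ∑[ i ∈ V ] ∑[ j ∈ V ] (E i j ℚ.+ E j i)
      ≡⟨ ∑-cong V (λ i → ∑-distrib-+ V (E i) _) ⟩
    ∑[ i ∈ V ] (∑ V (E i) ℚ.+ ∑[ j ∈ V ] E j i)
      ≡⟨ ∑-distrib-+ V _ _ ⟩
    ∑[ i ∈ V ] ∑ V (E i) ℚ.+ ∑[ i ∈ V ] ∑[ j ∈ V ] E j i
      ≡⟨ cong (∑[ i ∈ V ] ∑ V (E i) ℚ.+_) (∑-swap V V (λ i j → E j i)) ⟩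
    ∑[ i ∈ V ] ∑ V (E i) ℚ.+ ∑[ i ∈ V ] ∑ V (E i)
      ≡⟨ cong₂ ℚ._+_ ∑E≡∣E∣ ∑E≡∣E∣ ⟩
    toℚ e ℚ.+ toℚ e
      ≡⟨ toℚ-+ e e ⟨
    toℚ (e ℕ.+ e)
      ≡⟨ cong (λ m → toℚ (e ℕ.+ m)) (ℕ.+-identityʳ e) ⟨
    toℚ (M G) ∎
    where
    open ℚ.≤-Reasoning
    e : ℕ
    e = List.length (edges G)
    E : Fin n → Fin n → ℚ
    E i j = χ (does (i <? j ×-dec T? (adj G i j)))
    ∑E≡∣E∣ : ∑[ i ∈ V ] ∑ V (E i) ≡ toℚ e
    ∑E≡∣E∣ = sym (trans
      (toℚ-length-filter (λ (i , j) → i <? j ×-dec T? (adj G i j)) (List.cartesianProduct V V))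
      (∑-cartesianProductWith _,_ V V _))
    split : ∀ i j → A i j ≡ E i j ℚ.+ E j i
    split i j = trans (cong χ (symm G i j)) (trans (by-order (i <? j) (j <? i))
      (cong (λ b → χ (does (i <? j) ∧ b) ℚ.+ E j i) (symm G j i)))
      where
      by-order : (p : Dec (i Fin.< j)) (q : Dec (j Fin.< i)) →
        χ (adj G j i) ≡ χ (does p ∧ adj G j i) ℚ.+ χ (does q ∧ adj G j i)
      by-order (yes i<j) (yes j<i) = ⊥-elim (<-asym i<j j<i)
      by-order (yes _)   (no _)    = sym (ℚ.+-identityʳ _)
      by-order (no _)    (yes _)   = sym (ℚ.+-identityˡ _)
      by-order (no i≮j)  (no j≮i)  with <-cmp i j
      ... | tri< i<j _ _  = ⊥-elim (i≮j i<j)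
      ... | tri> _ _ j<i  = ⊥-elim (j≮i j<i)
      ... | tri≈ _ refl _ = cong χ (irrefl G i)

  K-isHom : ∀ {a b} (u : Vec (Fin n) a) (v : Vec (Fin n) b) →
    (∀ i j → T (adj G (lookup u i) (lookup v j))) → IsHom (K a b) G (lookup (u ++ v))
  K-isHom {a} u v u~v i j i~j
    rewrite lookup-splitAt a u v i | lookup-splitAt a u v j with splitAt a i | splitAt a j
  -- Two vertices on the same side would make `i~j` a proof of `T false`, so only the mixed cases
  -- remain.
  ... | inj₁ i′ | inj₂ j′ = u~v i′ j′
  ... | inj₂ i′ | inj₁ j′ = subst T (symm G (lookup u j′) (lookup v i′)) (u~v j′ i′)

  codegree : ∀ {h} → Vec (Fin n) h → ℚ
  codegree v = ∑[ i ∈ V ] ∏ (A i) v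

  -- Expanding the `a`-th power of a codegree chooses `a` common neighbours `u` of `v`, that is, the
  -- images of the other side. Each term is 0 or 1, and a term equal to 1 makes every entry of `u`
  -- adjacent to every entry of `v`, so that `u ++ v` is a homomorphism.
  ∑codegree^≤hom : ∀ a b → ∑[ v ∈ allMaps b n ] (codegree v ^ℚ a) ℚ.≤ toℚ (hom (K a b) G)
  ∑codegree^≤hom a b = begin
    ∑[ v ∈ allMaps b n ] (codegree v ^ℚ a)
      ≡⟨ ∑-cong (allMaps b n) (λ v → ∑-^ a n (λ i → ∏ (A i) v)) ⟩
    ∑[ v ∈ allMaps b n ] ∑[ u ∈ allMaps a n ] ∏ (λ i → ∏ (A i) v) u
      ≡⟨ ∑-swap (allMaps b n) (allMaps a n) _ ⟩
    ∑[ u ∈ allMaps a n ] ∑[ v ∈ allMaps b n ] ∏ (λ i → ∏ (A i) v) u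
      ≤⟨ ∑-mono (allMaps a n) (λ u → ∑-mono (allMaps b n) (counted u)) ⟩
    ∑[ u ∈ allMaps a n ] ∑[ v ∈ allMaps b n ] χ (does (isHom? (K a b) G (lookup (u ++ v))))
      ≡⟨ ∑-allMaps-++ a b n _ ⟨
    ∑[ w ∈ allMaps (a ℕ.+ b) n ] χ (does (isHom? (K a b) G (lookup w)))
      ≡⟨ toℚ-length-filter _ (allMaps (a ℕ.+ b) n) ⟨
    toℚ (hom (K a b) G) ∎
    where
    open ℚ.≤-Reasoning
    counted : ∀ u v → ∏ (λ i → ∏ (A i) v) u ℚ.≤ χ (does (isHom? (K a b) G (lookup (u ++ v))))
    counted u v = indicator≤χ (isHom? (K a b) G (lookup (u ++ v))) (all-adjacent
      (∏-indicator (λ i → ∏-indicator (λ j → χ-indicator (adj G i j)) v) u))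
      where
      all-adjacent : ∀ {q} → q ≡ 0ℚ ⊎ q ≡ 1ℚ × _ → q ≡ 0ℚ ⊎ q ≡ 1ℚ × IsHom (K a b) G (lookup (u ++ v))
      all-adjacent (inj₁ eq)         = inj₁ eq
      all-adjacent (inj₂ (eq , u~v)) = inj₂ (eq , K-isHom u v u~v)

  -- With Y v = ∏ y v, expanding the inner power writes the outer sum as
  -- ∑ᵥ codegree v · (Y v)ᵏ, to which Hölder applies.

  hom-bound : ∀ k (y : Fin n → ℚ) → (∀ i → 0ℚ ℚ.≤ y i) →
    (∑[ i ∈ V ] ((∑[ j ∈ V ] (A i j ℚ.* y j ^ℚ k)) ^ℚ suc k)) ^ℚ suc k ℚ.≤
    toℚ (hom (K (suc k) (suc k)) G) ℚ.* ((∑[ i ∈ V ] (y i ^ℚ suc k)) ^ℚ suc k) ^ℚ k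
  hom-bound k y 0≤y = begin
    (∑[ i ∈ V ] ((∑[ j ∈ V ] (A i j ℚ.* y j ^ℚ k)) ^ℚ suc k)) ^ℚ suc k
      ≡⟨ cong (_^ℚ suc k) expand ⟩
    (∑[ v ∈ W ] (codegree v ℚ.* ∏ y v ^ℚ k)) ^ℚ suc k
      ≤⟨ hölder k W codegree (∏ y) (λ v → ∑-nonNeg V λ i → ∏-nonNeg (0≤A i) v) (∏-nonNeg 0≤y) ⟩
    ∑[ v ∈ W ] (codegree v ^ℚ suc k) ℚ.* (∑[ v ∈ W ] (∏ y v ^ℚ suc k)) ^ℚ k
      ≡⟨ cong (λ q → ∑[ v ∈ W ] (codegree v ^ℚ suc k) ℚ.* q ^ℚ k) ∑∏ ⟩
    ∑[ v ∈ W ] (codegree v ^ℚ suc k) ℚ.* ((∑[ i ∈ V ] (y i ^ℚ suc k)) ^ℚ suc k) ^ℚ k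
      ≤⟨ ℚ.*-monoʳ-≤-nonNeg _ {{ℚ.nonNegative (^-nonNeg (^-nonNeg
           (∑-nonNeg V λ i → ^-nonNeg (0≤y i) (suc k)) (suc k)) k)}} (∑codegree^≤hom (suc k) (suc k)) ⟩
    toℚ (hom (K (suc k) (suc k)) G) ℚ.* ((∑[ i ∈ V ] (y i ^ℚ suc k)) ^ℚ suc k) ^ℚ k ∎
    where
    open ℚ.≤-Reasoning
    W : List (Vec (Fin n) (suc k))
    W = allMaps (suc k) n
    ∑∏ : ∑[ v ∈ W ] (∏ y v ^ℚ suc k) ≡ (∑[ i ∈ V ] (y i ^ℚ suc k)) ^ℚ suc k
    ∑∏ = trans (∑-cong W λ v → sym (∏-^ y (suc k) v)) (sym (∑-^ (suc k) n _))
    expand : ∑[ i ∈ V ] ((∑[ j ∈ V ] (A i j ℚ.* y j ^ℚ k)) ^ℚ suc k) ≡ ∑[ v ∈ W ] (codegree v ℚ.* ∏ y v ^ℚ k)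
    expand = begin-equality
      ∑[ i ∈ V ] ((∑[ j ∈ V ] (A i j ℚ.* y j ^ℚ k)) ^ℚ suc k)
        ≡⟨ ∑-cong V (λ i → ∑-^ (suc k) n (λ j → A i j ℚ.* y j ^ℚ k)) ⟩
      ∑[ i ∈ V ] ∑[ v ∈ W ] ∏ (λ j → A i j ℚ.* y j ^ℚ k) v
        ≡⟨ ∑-cong V (λ i → ∑-cong W λ v → trans (∏-distrib-* (A i) _ v) (cong (∏ (A i) v ℚ.*_) (∏-^ y k v))) ⟩
      ∑[ i ∈ V ] ∑[ v ∈ W ] (∏ (A i) v ℚ.* ∏ y v ^ℚ k)
        ≡⟨ ∑-swap V W _ ⟩
      ∑[ v ∈ W ] ∑[ i ∈ V ] (∏ (A i) v ℚ.* ∏ y v ^ℚ k)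
        ≡⟨ ∑-cong W (λ v → *-distribʳ-∑ (∏ y v ^ℚ k) V (λ i → ∏ (A i) v)) ⟨
      ∑[ v ∈ W ] (codegree v ℚ.* ∏ y v ^ℚ k) ∎

-- The quadratic form of the adjacency matrix over ℚ

module QuadraticForm {n} (G : Graph n) (k : ℕ) (H : ℚ)
  (H-bound : ∀ (y : Fin n → ℚ) → (∀ i → 0ℚ ℚ.≤ y i) →
    (∑[ i ∈ List.allFin n ] ((∑[ j ∈ List.allFin n ] (A G i j ℚ.* y j ^ℚ suc k)) ^ℚ suc (suc k))) ^ℚ suc (suc k) ℚ.≤
    H ℚ.* ((∑[ i ∈ List.allFin n ] (y i ^ℚ suc (suc k))) ^ℚ suc (suc k)) ^ℚ suc k)
  (w : Fin n → ℚ) (0≤w : ∀ i → 0ℚ ℚ.≤ w i) where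
  private
    V : List (Fin n)
    V = List.allFin n
    t : ℕ
    t = suc (suc k)
    -- The test vector x is `y ^ suc k`, and `f` is its image under `A`. As `t + k` equals 2(t-1),
    -- the moment of order `t` is the form at v, with entries `w i ^ t`, and the moment of order
    -- `t + k` is the form at x.
    y f : Fin n → ℚ
    y i = w i ℚ.* w i
    f i = ∑[ j ∈ V ] (A G i j ℚ.* y j ^ℚ suc k)

    open PowerMean (List.cartesianProduct V V) (λ (i , j) → A G i j) (λ (i , j) → w i ℚ.* w j)
      (λ (i , j) → 0≤A G i j) (λ (i , j) → χ-idem (adj G i j)) (λ (i , j) → *-nonNeg (0≤w i) (0≤w j))

    moment-quadratic : ∀ m → moment m ≡ ∑[ i ∈ V ] (w i ^ℚ m ℚ.* ∑[ j ∈ V ] (A G i j ℚ.* w j ^ℚ m))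
    moment-quadratic m = trans (∑-cartesianProductWith _,_ V V _)
      (∑-cong V λ i → trans (∑-cong V (separate i)) (sym (*-distribˡ-∑ (w i ^ℚ m) V _)))
      where
      open +-*-Solver
      separate : ∀ i j → A G i j ℚ.* (w i ℚ.* w j) ^ℚ m ≡ w i ^ℚ m ℚ.* (A G i j ℚ.* w j ^ℚ m)
      separate i j = trans (cong (A G i j ℚ.*_) (^ℚ-distrib-* (w i) (w j) m))
        (solve 3 (λ a b c → a :* (b :* c) := b :* (a :* c)) refl (A G i j) (w i ^ℚ m) (w j ^ℚ m))

    w^≡y^ : ∀ i → w i ^ℚ (t ℕ.+ k) ≡ y i ^ℚ suc k
    w^≡y^ i = begin-equality
      w i ^ℚ (t ℕ.+ k)                ≡⟨ cong (w i ^ℚ_) (ℕ.+-suc (suc k) k) ⟨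
      w i ^ℚ (suc k ℕ.+ suc k)        ≡⟨ ^ℚ-homo-* (w i) (suc k) (suc k) ⟩
      w i ^ℚ suc k ℚ.* w i ^ℚ suc k   ≡⟨ ^ℚ-distrib-* (w i) (w i) (suc k) ⟨
      y i ^ℚ suc k                    ∎
      where open ℚ.≤-Reasoning

    E S T′ F : ℚ
    E  = ∑[ i ∈ V ] (w i ^ℚ t ℚ.* ∑[ j ∈ V ] (A G i j ℚ.* w j ^ℚ t))
    S  = ∑[ i ∈ V ] (w i ^ℚ t ℚ.* w i ^ℚ t)
    T′ = toℚ (M G)
    F  = ∑[ i ∈ V ] (f i ^ℚ t)

    total≡M : total ≡ T′
    total≡M = trans (∑-cartesianProductWith _,_ V V _) (∑A≡M G)

    ∑y^≡S : ∑[ i ∈ V ] (y i ^ℚ t) ≡ S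
    ∑y^≡S = ∑-cong V λ i → ^ℚ-distrib-* (w i) (w i) t

    0≤y : ∀ i → 0ℚ ℚ.≤ y i
    0≤y i = *-nonNeg (0≤w i) (0≤w i)

    0≤f : ∀ i → 0ℚ ℚ.≤ f i
    0≤f i = ∑-nonNeg V λ j → *-nonNeg (0≤A G i j) (^-nonNeg (0≤y j) (suc k))

    0≤S : 0ℚ ℚ.≤ S
    0≤S = ∑-nonNeg V λ i → *-nonNeg (^-nonNeg (0≤w i) t) (^-nonNeg (0≤w i) t)

    0≤T : 0ℚ ℚ.≤ T′
    0≤T = 0≤ℕ/ (M G) 0

    -- Hölder for the pairing of x with `A` x: exponent `t` on `f`, exponent t/(t-1) on x, whose
    -- corresponding power sum is `S`.
    moment-bound : moment (t ℕ.+ k) ^ℚ t ℚ.≤ F ℚ.* S ^ℚ suc k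
    moment-bound = subst₂ (λ p q → p ^ℚ t ℚ.≤ F ℚ.* q ^ℚ suc k)
      (sym (trans (moment-quadratic (t ℕ.+ k)) (∑-cong V λ i →
        trans (cong₂ ℚ._*_ (w^≡y^ i) (∑-cong V λ j → cong (A G i j ℚ.*_) (w^≡y^ j))) (ℚ.*-comm _ (f i)))))
      ∑y^≡S
      (hölder (suc k) V f y 0≤f 0≤y)

    F-bound : F ^ℚ t ℚ.≤ H ℚ.* (S ^ℚ t) ^ℚ suc k
    F-bound = subst (λ q → F ^ℚ t ℚ.≤ H ℚ.* (q ^ℚ t) ^ℚ suc k) ∑y^≡S (H-bound y 0≤y)

  -- The power mean from order `t` to `t + k` costs `total ^ k`, the source of the power of `M G`.
  -- `S` enters twice with exponent t(t-1), once from pairing with x (`moment-bound`) and once from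
  -- bounding `A` x (`F-bound`); together they match the exponent 2t(t-1) of `E`.
  quadratic-form-bound : E ^ℚ (2 ℕ.* t ℕ.* suc k) ℚ.≤ H ℚ.* (T′ ^ℚ (t ℕ.* k) ℚ.* S ^ℚ (2 ℕ.* t ℕ.* suc k))
  quadratic-form-bound = begin
    E ^ℚ (2 ℕ.* t ℕ.* suc k)
      ≡⟨ cong (E ^ℚ_) (exponents k) ⟩
    E ^ℚ ((t ℕ.+ k) ℕ.* t)
      ≡⟨ ^ℚ-assocʳ E (t ℕ.+ k) t ⟨
    (E ^ℚ (t ℕ.+ k)) ^ℚ t
      ≡⟨ cong (λ q → (q ^ℚ (t ℕ.+ k)) ^ℚ t) (moment-quadratic t) ⟨
    (moment t ^ℚ (t ℕ.+ k)) ^ℚ t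
      ≤⟨ ^-mono (^-nonNeg (0≤moment t) (t ℕ.+ k)) (power-mean (suc k) k) t ⟩
    (moment (t ℕ.+ k) ^ℚ t ℚ.* total ^ℚ k) ^ℚ t
      ≡⟨ cong (λ q → (moment (t ℕ.+ k) ^ℚ t ℚ.* q ^ℚ k) ^ℚ t) total≡M ⟩
    (moment (t ℕ.+ k) ^ℚ t ℚ.* T′ ^ℚ k) ^ℚ t
      ≤⟨ ^-mono (*-nonNeg (^-nonNeg (0≤moment (t ℕ.+ k)) t) (^-nonNeg 0≤T k))
           (ℚ.*-monoʳ-≤-nonNeg (T′ ^ℚ k) {{ℚ.nonNegative (^-nonNeg 0≤T k)}} moment-bound) t ⟩
    (F ℚ.* S ^ℚ suc k ℚ.* T′ ^ℚ k) ^ℚ t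
      ≡⟨ trans (^ℚ-distrib-* (F ℚ.* S ^ℚ suc k) (T′ ^ℚ k) t)
           (cong (ℚ._* (T′ ^ℚ k) ^ℚ t) (^ℚ-distrib-* F (S ^ℚ suc k) t)) ⟩
    F ^ℚ t ℚ.* (S ^ℚ suc k) ^ℚ t ℚ.* (T′ ^ℚ k) ^ℚ t
      ≡⟨ cong₂ (λ p q → F ^ℚ t ℚ.* p ℚ.* q) (^ℚ-assoc-comm S (suc k) t)
           (trans (^ℚ-assocʳ T′ k t) (cong (T′ ^ℚ_) (ℕ.*-comm k t))) ⟩
    F ^ℚ t ℚ.* (S ^ℚ t) ^ℚ suc k ℚ.* T′ ^ℚ (t ℕ.* k)
      ≤⟨ *-mono (*-nonNeg (^-nonNeg (∑-nonNeg V λ i → ^-nonNeg (0≤f i) t) t) 0≤R)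
           (ℚ.*-monoʳ-≤-nonNeg R {{ℚ.nonNegative 0≤R}} F-bound)
           (^-nonNeg 0≤T (t ℕ.* k)) ℚ.≤-refl ⟩
    H ℚ.* (S ^ℚ t) ^ℚ suc k ℚ.* (S ^ℚ t) ^ℚ suc k ℚ.* T′ ^ℚ (t ℕ.* k)
      ≡⟨ solve 3 (λ h s m → h :* s :* s :* m := h :* (m :* (s :* s))) refl H R (T′ ^ℚ (t ℕ.* k)) ⟩
    H ℚ.* (T′ ^ℚ (t ℕ.* k) ℚ.* (R ℚ.* R))
      ≡⟨ cong (λ q → H ℚ.* (T′ ^ℚ (t ℕ.* k) ℚ.* q)) R*R ⟩
    H ℚ.* (T′ ^ℚ (t ℕ.* k) ℚ.* S ^ℚ (2 ℕ.* t ℕ.* suc k)) ∎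
    where
    open ℚ.≤-Reasoning
    open +-*-Solver
    R : ℚ
    R = (S ^ℚ t) ^ℚ suc k
    0≤R : 0ℚ ℚ.≤ R
    0≤R = ^-nonNeg (^-nonNeg 0≤S t) (suc k)
    exponents : ∀ k → 2 ℕ.* (2 ℕ.+ k) ℕ.* suc k ≡ ((2 ℕ.+ k) ℕ.+ k) ℕ.* (2 ℕ.+ k)
    exponents = solve-∀
    double : ∀ t k → 2 ℕ.* t ℕ.* suc k ≡ t ℕ.* suc k ℕ.+ t ℕ.* suc k
    double = solve-∀
    R*R : R ℚ.* R ≡ S ^ℚ (2 ℕ.* t ℕ.* suc k)
    R*R = begin-equality
      R ℚ.* R                                       ≡⟨ cong₂ ℚ._*_ (^ℚ-assocʳ S t (suc k)) (^ℚ-assocʳ S t (suc k)) ⟩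
      S ^ℚ (t ℕ.* suc k) ℚ.* S ^ℚ (t ℕ.* suc k)     ≡⟨ ^ℚ-homo-* S (t ℕ.* suc k) (t ℕ.* suc k) ⟨
      S ^ℚ (t ℕ.* suc k ℕ.+ t ℕ.* suc k)            ≡⟨ cong (S ^ℚ_) (double t k) ⟨
      S ^ℚ (2 ℕ.* t ℕ.* suc k)                      ∎

-- Order and arithmetic of Cauchy reals

Eventually : (ℕ → Set) → Set
Eventually P = ∃[ N ] (∀ n → N ℕ.≤ n → P n)

eventually-zip : {P Q R : ℕ → Set} → (∀ n → P n → Q n → R n) → Eventually P → Eventually Q → Eventually R
eventually-zip f (N₁ , p) (N₂ , q) = N₁ ℕ.⊔ N₂ , λ n N≤n →
  f n (p n (ℕ.m⊔n≤o⇒m≤o N₁ N₂ N≤n)) (q n (ℕ.m⊔n≤o⇒n≤o N₁ N₂ N≤n))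

eventually-map : {P Q : ℕ → Set} → (∀ n → P n → Q n) → Eventually P → Eventually Q
eventually-map f (N , p) = N , λ n N≤n → f n (p n N≤n)

always : {P : ℕ → Set} → (∀ n → P n) → Eventually P
always p = 0 , λ n _ → p n

-- Records around _≈_ and _≤_: those unfold to functions of the underlying
-- sequences, from which Agda cannot recover the real numbers.

infix 4 _≃_ _≲_

record _≃_ (x y : ℝ) : Set where
  constructor equal
  field unwrap : x ≈ y

record _≲_ (x y : ℝ) : Set where
  constructor atMost
  field unwrap : x ≤ y

p≤∣p∣ : ∀ p → p ℚ.≤ ℚ.∣ p ∣
p≤∣p∣ p with ℚ.≤-total 0ℚ p
... | inj₁ 0≤p = ℚ.≤-reflexive (sym (ℚ.0≤p⇒∣p∣≡p 0≤p))
... | inj₂ p≤0 = ℚ.≤-trans p≤0 (ℚ.0≤∣p∣ p)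

∣-∣≤⇒≤+ : ∀ p q {ε} → ℚ.∣ p ℚ.- q ∣ ℚ.≤ ε → p ℚ.≤ q ℚ.+ ε
∣-∣≤⇒≤+ p q {ε} ∣p-q∣≤ε = subst (ℚ._≤ q ℚ.+ ε) (solve 2 (λ p q → q :+ (p :- q) := p) refl p q)
  (ℚ.+-monoʳ-≤ q (ℚ.≤-trans (p≤∣p∣ (p ℚ.- q)) ∣p-q∣≤ε))
  where open +-*-Solver

pointwise-≤ : ∀ {x y} → (∀ n → seq x n ℚ.≤ seq y n) → x ≲ y
pointwise-≤ x≤y = atMost λ ε 0<ε → always λ n → ℚ.≤-trans (x≤y n) (x≤x+y (ℚ.<⇒≤ 0<ε))

≲-refl : ∀ {x} → x ≲ x
≲-refl = pointwise-≤ λ _ → ℚ.≤-refl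

+-half : ∀ x ε → x ℚ.+ half ε ℚ.+ half ε ≡ x ℚ.+ ε
+-half x ε = trans (ℚ.+-assoc x (half ε) (half ε)) (cong (x ℚ.+_) (half+half ε))

≲-trans : ∀ {x y z} → x ≲ y → y ≲ z → x ≲ z
≲-trans {x} {y} {z} (atMost x≤y) (atMost y≤z) = atMost λ ε 0<ε → eventually-zip
  (λ n p q → ℚ.≤-trans p (subst (seq y n ℚ.+ half ε ℚ.≤_) (+-half (seq z n) ε) (ℚ.+-monoˡ-≤ (half ε) q)))
  (x≤y (half ε) (half-pos 0<ε)) (y≤z (half ε) (half-pos 0<ε))

≲-antisym : ∀ {x y} → x ≲ y → y ≲ x → x ≃ y
≲-antisym (atMost x≤y) (atMost y≤x) = equal λ ε 0<ε →
  eventually-zip (λ n → ∣-∣≤) (x≤y ε 0<ε) (y≤x ε 0<ε)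

≃⇒≲ : ∀ {x y} → x ≃ y → x ≲ y
≃⇒≲ {x} {y} (equal x≈y) = atMost λ ε 0<ε → eventually-map (λ n p → ∣-∣≤⇒≤+ (seq x n) (seq y n) p)
  (x≈y ε 0<ε)

≃-sym : ∀ {x y} → x ≃ y → y ≃ x
≃-sym {x} {y} (equal x≈y) = equal λ ε 0<ε → eventually-map
  (λ n p → subst (ℚ._≤ ε) (∣-∣-sym (seq x n) (seq y n)) p) (x≈y ε 0<ε)

≃-refl : ∀ {x} → x ≃ x
≃-refl = ≲-antisym ≲-refl ≲-refl

≃-trans : ∀ {x y z} → x ≃ y → y ≃ z → x ≃ z
≃-trans p q = ≲-antisym (≲-trans (≃⇒≲ p) (≃⇒≲ q)) (≲-trans (≃⇒≲ (≃-sym q)) (≃⇒≲ (≃-sym p)))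

pointwise-≡ : ∀ {x y} → (∀ n → seq x n ≡ seq y n) → x ≃ y
pointwise-≡ x≡y = ≲-antisym (pointwise-≤ (ℚ.≤-reflexive ∘ x≡y)) (pointwise-≤ (ℚ.≤-reflexive ∘ sym ∘ x≡y))

≲-preorder : Preorder 0ℓ 0ℓ 0ℓ
≲-preorder = record
  { Carrier = ℝ ; _≈_ = _≃_ ; _≲_ = _≲_
  ; isPreorder = record
    { isEquivalence = record { refl = ≃-refl ; sym = ≃-sym ; trans = ≃-trans }
    ; reflexive = ≃⇒≲ ; trans = ≲-trans } }

module ≲-Reasoning where
  open import Relation.Binary.Reasoning.Preorder ≲-preorder public

∣-∣-cong : ∀ {x y} → x ≃ y → ∣ x ∣ ≃ ∣ y ∣
∣-∣-cong {x} {y} (equal x≈y) = equal λ ε 0<ε → eventually-map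
  (λ n p → ∣-∣≤ (ℚ.≤-trans (∣p∣≤∣q∣+∣p-q∣ (seq x n) (seq y n)) (ℚ.+-monoʳ-≤ ℚ.∣ seq y n ∣ p))
    (ℚ.≤-trans (∣p∣≤∣q∣+∣p-q∣ (seq y n) (seq x n))
      (ℚ.+-monoʳ-≤ ℚ.∣ seq x n ∣ (subst (ℚ._≤ ε) (∣-∣-sym (seq x n) (seq y n)) p))))
  (x≈y ε 0<ε)

-- Definitional equality of real numbers compares their Cauchy proofs, which is far
-- too expensive unless the operations are kept from unfolding.

infixl 6 _+ʳ_
infixl 7 _*ʳ_
infixr 8 _↑_

abstract
  _+ʳ_ _*ʳ_ : ℝ → ℝ → ℝ
  _+ʳ_ = _+_
  _*ʳ_ = _*_

  _↑_ : ℝ → ℕ → ℝ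
  _↑_ = _^_

  ∑ʳ : ∀ {n} → (Fin n → ℝ) → ℝ
  ∑ʳ = sum

  seq-+ : ∀ x y n → seq (x +ʳ y) n ≡ seq x n ℚ.+ seq y n
  seq-+ x y n = refl

  seq-* : ∀ x y n → seq (x *ʳ y) n ≡ seq x n ℚ.* seq y n
  seq-* x y n = refl

  seq-↑ : ∀ x k n → seq (x ↑ k) n ≡ seq x n ^ℚ k
  seq-↑ x zero    n = refl
  seq-↑ x (suc k) n = cong (seq x n ℚ.*_) (seq-↑ x k n)

  +-mono-≲ : ∀ {x x′ y y′} → x ≲ x′ → y ≲ y′ → x +ʳ y ≲ x′ +ʳ y′
  +-mono-≲ {x} {x′} {y} {y′} (atMost x≤x′) (atMost y≤y′) = atMost λ ε 0<ε → eventually-zip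
    (λ n p q → ℚ.≤-trans (ℚ.+-mono-≤ p q) (ℚ.≤-reflexive (trans
      (solve 3 (λ a b h → (a :+ h) :+ (b :+ h) := a :+ b :+ h :+ h) refl (seq x′ n) (seq y′ n) (half ε))
      (+-half (seq x′ n ℚ.+ seq y′ n) ε))))
    (x≤x′ (half ε) (half-pos 0<ε)) (y≤y′ (half ε) (half-pos 0<ε))
    where open +-*-Solver

  *-cong : ∀ {x x′ y y′} → x ≃ x′ → y ≃ y′ → x *ʳ y ≃ x′ *ʳ y′
  *-cong {x} {x′} {y} {y′} (equal x≈x′) (equal y≈y′) = equal λ ε 0<ε →
    let B , 0<B , x≤B = eventually-bounded x
        C , 0<C , y′≤C = eventually-bounded y′
        δ , 0<δ , Bδ≡ = divide-pos 0<B (half-pos 0<ε)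
        η , 0<η , Cη≡ = divide-pos 0<C (half-pos 0<ε)
    in eventually-zip
      (λ n (x≤B , y′≤C) (x-x′≤η , y-y′≤δ) → subst (ℚ.∣ seq x n ℚ.* seq y n ℚ.- seq x′ n ℚ.* seq y′ n ∣ ℚ.≤_)
        (trans (cong₂ ℚ._+_ Bδ≡ Cη≡) (half+half ε))
        (∣ab-cd∣≤ (seq x n) (seq y n) (seq x′ n) (seq y′ n) x≤B y′≤C x-x′≤η y-y′≤δ))
      (eventually-zip (λ _ → _,_) x≤B y′≤C)
      (eventually-zip (λ _ → _,_) (x≈x′ η 0<η) (y≈y′ δ 0<δ))

  seq-^ : ∀ x k n → seq (x ^ k) n ≡ seq x n ^ℚ k
  seq-^ = seq-↑

  seq-sum : ∀ {n} (f : Fin n → ℝ) m → seq (sum f) m ≡ ∑[ i ∈ List.allFin n ] seq (f i) m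
  -- Generalised to `tabulate g`, because the tail of `allFin (suc n)` tabulates `suc` and is not
  -- itself an `allFin`.
  seq-sum f m = tabulated f (λ i → i)
    where
    tabulated : ∀ {n} {I : Set} (f : I → ℝ) (g : Fin n → I) →
      seq (sum (λ i → f (g i))) m ≡ ∑[ i ∈ List.tabulate g ] seq (f i) m
    tabulated {zero}  f g = refl
    tabulated {suc n} f g = cong (seq (f (g zero)) m ℚ.+_) (tabulated f (g ∘ suc))

  seq-∑ʳ : ∀ {n} (f : Fin n → ℝ) m → seq (∑ʳ f) m ≡ ∑[ i ∈ List.allFin n ] seq (f i) m
  seq-∑ʳ = seq-sum

  ∑ʳ-zero : (f : Fin 0 → ℝ) → ∑ʳ f ≃ 0ℝ
  ∑ʳ-zero f = pointwise-≡ λ n → refl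

  ∑ʳ-suc : ∀ {n} (f : Fin (suc n) → ℝ) → ∑ʳ f ≃ f zero +ʳ ∑ʳ (f ∘ suc)
  ∑ʳ-suc f = pointwise-≡ λ n → refl

+-cong : ∀ {x x′ y y′} → x ≃ x′ → y ≃ y′ → x +ʳ y ≃ x′ +ʳ y′
+-cong {x} {x′} {y} {y′} p q = ≲-antisym (+-mono-≲ {x} {x′} {y} {y′} (≃⇒≲ p) (≃⇒≲ q))
  (+-mono-≲ {x′} {x} {y′} {y} (≃⇒≲ (≃-sym p)) (≃⇒≲ (≃-sym q)))

∑ʳ-mono : ∀ {n} {f g : Fin n → ℝ} → (∀ i → f i ≲ g i) → ∑ʳ f ≲ ∑ʳ g
∑ʳ-mono {zero}  {f} {g} f≤g = ≃⇒≲ (≃-trans (∑ʳ-zero f) (≃-sym (∑ʳ-zero g)))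
∑ʳ-mono {suc n} {f} {g} f≤g = begin
  ∑ʳ f                   ≈⟨ ∑ʳ-suc f ⟩
  f zero +ʳ ∑ʳ (f ∘ suc)  ≲⟨ +-mono-≲ {f zero} {g zero} {∑ʳ (f ∘ suc)} {∑ʳ (g ∘ suc)} (f≤g zero) (∑ʳ-mono (f≤g ∘ suc)) ⟩
  g zero +ʳ ∑ʳ (g ∘ suc)  ≈⟨ ∑ʳ-suc g ⟨
  ∑ʳ g                   ∎
  where open ≲-Reasoning

∑ʳ-cong : ∀ {n} {f g : Fin n → ℝ} → (∀ i → f i ≃ g i) → ∑ʳ f ≃ ∑ʳ g
∑ʳ-cong f≃g = ≲-antisym (∑ʳ-mono (≃⇒≲ ∘ f≃g)) (∑ʳ-mono (≃⇒≲ ∘ ≃-sym ∘ f≃g))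

↑≃^ : ∀ x k → x ↑ k ≃ x ^ k
↑≃^ x k = pointwise-≡ λ n → trans (seq-↑ x k n) (sym (seq-^ x k n))

∑ʳ≃sum : ∀ {n} (f : Fin n → ℝ) → ∑ʳ f ≃ sum f
∑ʳ≃sum f = pointwise-≡ λ n → trans (seq-∑ʳ f n) (sym (seq-sum f n))

↑-suc : ∀ x k → x ↑ suc k ≃ x *ʳ x ↑ k
↑-suc x k = pointwise-≡ λ n → trans (seq-↑ x (suc k) n)
  (trans (cong (seq x n ℚ.*_) (sym (seq-↑ x k n))) (sym (seq-* x (x ↑ k) n)))

↑-zero : ∀ x → x ↑ 0 ≃ 1ℝ
↑-zero x = pointwise-≡ (seq-↑ x 0)

↑-cong : ∀ {x y} k → x ≃ y → x ↑ k ≃ y ↑ k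
↑-cong {x} {y} zero    x≃y = ≃-trans (↑-zero x) (≃-sym (↑-zero y))
↑-cong {x} {y} (suc k) x≃y = begin-equality
  x ↑ suc k  ≈⟨ ↑-suc x k ⟩
  x *ʳ x ↑ k  ≈⟨ *-cong {x} {y} {x ↑ k} {y ↑ k} x≃y (↑-cong {x} {y} k x≃y) ⟩
  y *ʳ y ↑ k  ≈⟨ ↑-suc y k ⟨
  y ↑ suc k  ∎
  where open ≲-Reasoning

seq-↑-of : ∀ x {q} k n → seq x n ≡ q → seq (x ↑ k) n ≡ q ^ℚ k
seq-↑-of x k n refl = seq-↑ x k n

↑-assocʳ : ∀ x m n → (x ↑ m) ↑ n ≃ x ↑ (m ℕ.* n)
↑-assocʳ x m n = pointwise-≡ λ i → trans (seq-↑-of (x ↑ m) n i (seq-↑ x m i))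
  (trans (^ℚ-assocʳ (seq x i) m n) (sym (seq-↑ x (m ℕ.* n) i)))

↑-assoc-comm : ∀ x m n → (x ↑ m) ↑ n ≃ (x ↑ n) ↑ m
↑-assoc-comm x m n = pointwise-≡ λ i → trans (seq-↑-of (x ↑ m) n i (seq-↑ x m i))
  (trans (^ℚ-assoc-comm (seq x i) m n) (sym (seq-↑-of (x ↑ n) m i (seq-↑ x n i))))

seq-*-of : ∀ x y {p q} n → seq x n ≡ p → seq y n ≡ q → seq (x *ʳ y) n ≡ p ℚ.* q
seq-*-of x y n refl refl = seq-* x y n

↑-distrib-* : ∀ x y k → (x *ʳ y) ↑ k ≃ x ↑ k *ʳ y ↑ k
↑-distrib-* x y k = pointwise-≡ λ i → trans (seq-↑-of (x *ʳ y) k i (seq-* x y i))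
  (trans (^ℚ-distrib-* (seq x i) (seq y i) k) (sym (seq-*-of (x ↑ k) (y ↑ k) i (seq-↑ x k i) (seq-↑ y k i))))

-- A property of the representing sequence, stronger than `0ℝ ≲ x`; it is what allows an inequality
-- between nonnegative rationals to be applied at every index.
NonNeg : ℝ → Set
NonNeg x = ∀ n → 0ℚ ℚ.≤ seq x n

∣-∣-nonNeg : ∀ x → NonNeg ∣ x ∣
∣-∣-nonNeg x n = ℚ.0≤∣p∣ (seq x n)

nonNeg⇒0≲ : ∀ {x} → NonNeg x → 0ℝ ≲ x
nonNeg⇒0≲ = pointwise-≤

-- Replaces a nonnegative real by a representative without negative terms. A term `p` with
-- `0 ≤ p + half ε` satisfies `- p ≤ p + ε`, whatever its sign.
0≲⇒∣x∣≃x : ∀ {x} → 0ℝ ≲ x → ∣ x ∣ ≃ x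
0≲⇒∣x∣≃x {x} (atMost 0≤x) = ≲-antisym
  (atMost λ ε 0<ε → eventually-map (λ n p → below n p 0<ε) (0≤x (half ε) (half-pos 0<ε)))
  (pointwise-≤ λ n → p≤∣p∣ (seq x n))
  where
  open +-*-Solver
  below : ∀ n {ε} → 0ℚ ℚ.≤ seq x n ℚ.+ half ε → 0ℚ ℚ.< ε → ℚ.∣ seq x n ∣ ℚ.≤ seq x n ℚ.+ ε
  below n {ε} 0≤x+h 0<ε with ℚ.∣p∣≡p∨∣p∣≡-p (seq x n)
  ... | inj₁ eq = subst (ℚ._≤ seq x n ℚ.+ ε) (sym eq) (x≤x+y (ℚ.<⇒≤ 0<ε))
  ... | inj₂ eq = subst₂ ℚ._≤_ (trans (ℚ.+-identityʳ (ℚ.- seq x n)) (sym eq))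
    (trans (solve 2 (λ p h → :- p :+ ((p :+ h) :+ (p :+ h)) := p :+ (h :+ h)) refl (seq x n) (half ε))
      (cong (seq x n ℚ.+_) (half+half ε)))
    (ℚ.+-monoʳ-≤ (ℚ.- seq x n) (+-nonNeg 0≤x+h 0≤x+h))

nonNeg⇒∣x∣≃x : ∀ {x} → NonNeg x → ∣ x ∣ ≃ x
nonNeg⇒∣x∣≃x 0≤x = pointwise-≡ λ n → ℚ.0≤p⇒∣p∣≡p (0≤x n)

-- Up to _≃_, c is the pointwise nonnegative ∣ c ∣ and b is a + ∣ b - a ∣,
-- which is pointwise at least a.

*-monoʳ-≲ : ∀ {a b c} → 0ℝ ≲ c → a ≲ b → a *ʳ c ≲ b *ʳ c
*-monoʳ-≲ {a} {b} {c} 0≤c a≤b = begin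
  a *ʳ c                             ≈⟨ *-cong {a} {a} {c} {∣ c ∣} ≃-refl (≃-sym (0≲⇒∣x∣≃x 0≤c)) ⟩
  a *ʳ ∣ c ∣                         ≲⟨ pointwise-≤ above ⟩
  (a +ʳ ∣ b +ʳ - a ∣) *ʳ ∣ c ∣       ≈⟨ *-cong {a +ʳ ∣ b +ʳ - a ∣} {a +ʳ (b +ʳ - a)} {∣ c ∣} {c}
                                          (+-cong {a} {a} {∣ b +ʳ - a ∣} {b +ʳ - a} ≃-refl (0≲⇒∣x∣≃x 0≤b-a)) (0≲⇒∣x∣≃x 0≤c) ⟩
  (a +ʳ (b +ʳ - a)) *ʳ c             ≈⟨ *-cong {a +ʳ (b +ʳ - a)} {b} {c} {c} (pointwise-≡ cancel) ≃-refl ⟩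
  b *ʳ c                             ∎
  where
  open ≲-Reasoning
  open +-*-Solver
  above : ∀ n → seq (a *ʳ ∣ c ∣) n ℚ.≤ seq ((a +ʳ ∣ b +ʳ - a ∣) *ʳ ∣ c ∣) n
  above n = subst₂ ℚ._≤_ (sym (seq-* a ∣ c ∣ n)) (sym (seq-*-of (a +ʳ ∣ b +ʳ - a ∣) ∣ c ∣ n (seq-+ a ∣ b +ʳ - a ∣ n) refl))
    (ℚ.*-monoʳ-≤-nonNeg (seq ∣ c ∣ n) {{ℚ.nonNegative (∣-∣-nonNeg c n)}} (x≤x+y {seq a n} (∣-∣-nonNeg (b +ʳ - a) n)))
  cancel : ∀ n → seq (a +ʳ (b +ʳ - a)) n ≡ seq b n
  cancel n = trans (seq-+ a (b +ʳ - a) n) (trans (cong (seq a n ℚ.+_) (seq-+ b (- a) n))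
    (solve 2 (λ a b → a :+ (b :- a) := b) refl (seq a n) (seq b n)))
  0≤b-a : 0ℝ ≲ b +ʳ - a
  0≤b-a = begin
    0ℝ         ≈⟨ pointwise-≡ (λ n → sym (trans (seq-+ a (- a) n) (ℚ.+-inverseʳ (seq a n)))) ⟩
    a +ʳ - a   ≲⟨ +-mono-≲ {a} {b} { - a} { - a} a≤b ≲-refl ⟩
    b +ʳ - a   ∎

*-comm : ∀ x y → x *ʳ y ≃ y *ʳ x
*-comm x y = pointwise-≡ λ n → trans (seq-* x y n) (trans (ℚ.*-comm (seq x n) (seq y n)) (sym (seq-* y x n)))

*-mono-≲ : ∀ {a b c d} → 0ℝ ≲ b → a ≲ b → 0ℝ ≲ c → c ≲ d → a *ʳ c ≲ b *ʳ d
*-mono-≲ {a} {b} {c} {d} 0≤b a≤b 0≤c c≤d = begin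
  a *ʳ c  ≲⟨ *-monoʳ-≲ {a} {b} {c} 0≤c a≤b ⟩
  b *ʳ c  ≈⟨ *-comm b c ⟩
  c *ʳ b  ≲⟨ *-monoʳ-≲ {c} {d} {b} 0≤b c≤d ⟩
  d *ʳ b  ≈⟨ *-comm d b ⟩
  b *ʳ d  ∎
  where open ≲-Reasoning

*-0≲ : ∀ {a b} → 0ℝ ≲ a → 0ℝ ≲ b → 0ℝ ≲ a *ʳ b
*-0≲ {a} {b} 0≤a 0≤b = ≲-trans
  (≃⇒≲ (pointwise-≡ λ n → sym (trans (seq-* 0ℝ b n) (ℚ.*-zeroˡ (seq b n)))))
  (*-monoʳ-≲ {0ℝ} {a} {b} 0≤b 0≤a)

↑-0≲ : ∀ {a} k → 0ℝ ≲ a → 0ℝ ≲ a ↑ k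
↑-0≲ {a} zero    0≤a = ≲-trans (pointwise-≤ {0ℝ} {1ℝ} λ _ → ℚ.nonNegative⁻¹ 1ℚ) (≃⇒≲ (≃-sym (↑-zero a)))
↑-0≲ {a} (suc k) 0≤a = ≲-trans (*-0≲ {a} {a ↑ k} 0≤a (↑-0≲ {a} k 0≤a)) (≃⇒≲ (≃-sym (↑-suc a k)))

↑-mono-≲ : ∀ {a b} k → 0ℝ ≲ a → a ≲ b → a ↑ k ≲ b ↑ k
↑-mono-≲ {a} {b} zero    0≤a a≤b = ≃⇒≲ (≃-trans (↑-zero a) (≃-sym (↑-zero b)))
↑-mono-≲ {a} {b} (suc k) 0≤a a≤b = begin
  a ↑ suc k  ≈⟨ ↑-suc a k ⟩
  a *ʳ a ↑ k  ≲⟨ *-mono-≲ {a} {b} {a ↑ k} {b ↑ k} (≲-trans 0≤a a≤b) a≤b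
                  (↑-0≲ {a} k 0≤a) (↑-mono-≲ {a} {b} k 0≤a a≤b) ⟩
  b *ʳ b ↑ k  ≈⟨ ↑-suc b k ⟨
  b ↑ suc k  ∎
  where open ≲-Reasoning

half-< : ∀ {ε} → 0ℚ ℚ.< ε → half ε ℚ.< ε
half-< {ε} 0<ε = subst₂ ℚ._<_ (ℚ.+-identityʳ (half ε)) (half+half ε) (ℚ.+-monoʳ-< (half ε) (half-pos 0<ε))

-- By superadditivity, a gap `ε` between `x` and `∣ y ∣` at some index becomes a gap of at least
-- `ε ^ suc k` between the powers, which exceeds the tolerance `half (ε ^ suc k)`.
↑-cancel-≲ : ∀ {x y} k → 0ℝ ≲ y → x ↑ suc k ≲ y ↑ suc k → x ≲ y
↑-cancel-≲ {x} {y} k 0≤y x^≤y^ = ≲-trans (atMost λ ε 0<ε → eventually-map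
    (λ n p → ℚ.≮⇒≥ λ lt → ℚ.<-irrefl refl (contra n 0<ε p lt))
    (_≲_.unwrap x^≤∣y∣^ (half (ε ^ℚ suc k)) (half-pos (^-pos 0<ε (suc k)))))
  (≃⇒≲ (0≲⇒∣x∣≃x 0≤y))
  where
  x^≤∣y∣^ : x ↑ suc k ≲ ∣ y ∣ ↑ suc k
  x^≤∣y∣^ = ≲-trans x^≤y^ (≃⇒≲ (↑-cong {y} {∣ y ∣} (suc k) (≃-sym (0≲⇒∣x∣≃x 0≤y))))
  contra : ∀ n {ε} → 0ℚ ℚ.< ε → seq (x ↑ suc k) n ℚ.≤ seq (∣ y ∣ ↑ suc k) n ℚ.+ half (ε ^ℚ suc k) →
    ℚ.∣ seq y n ∣ ℚ.+ ε ℚ.< seq x n → seq x n ^ℚ suc k ℚ.< seq x n ^ℚ suc k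
  contra n {ε} 0<ε p lt = begin-strict
    seq x n ^ℚ suc k                                    ≡⟨ seq-↑ x (suc k) n ⟨
    seq (x ↑ suc k) n                                   ≤⟨ p ⟩
    seq (∣ y ∣ ↑ suc k) n ℚ.+ half (ε ^ℚ suc k)         ≡⟨ cong (ℚ._+ half (ε ^ℚ suc k)) (seq-↑ ∣ y ∣ (suc k) n) ⟩
    ℚ.∣ seq y n ∣ ^ℚ suc k ℚ.+ half (ε ^ℚ suc k)        <⟨ ℚ.+-monoʳ-< (ℚ.∣ seq y n ∣ ^ℚ suc k) (half-< (^-pos 0<ε (suc k))) ⟩
    ℚ.∣ seq y n ∣ ^ℚ suc k ℚ.+ ε ^ℚ suc k               ≤⟨ ^-superadditive (ℚ.0≤∣p∣ (seq y n)) (ℚ.<⇒≤ 0<ε) k ⟩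
    (ℚ.∣ seq y n ∣ ℚ.+ ε) ^ℚ suc k                      ≤⟨ ^-mono (+-nonNeg (ℚ.0≤∣p∣ (seq y n)) (ℚ.<⇒≤ 0<ε)) (ℚ.<⇒≤ lt) (suc k) ⟩
    seq x n ^ℚ suc k                                    ∎
    where open ℚ.≤-Reasoning

↑-cancel-≃ : ∀ {x y} k → 0ℝ ≲ x → 0ℝ ≲ y → x ↑ suc k ≃ y ↑ suc k → x ≃ y
↑-cancel-≃ k 0≤x 0≤y eq = ≲-antisym (↑-cancel-≲ k 0≤y (≃⇒≲ eq)) (↑-cancel-≲ k 0≤x (≃⇒≲ (≃-sym eq)))

∣x∣≃0⇒x≃0 : ∀ {x} → ∣ x ∣ ≃ 0ℝ → x ≃ 0ℝ
∣x∣≃0⇒x≃0 {x} (equal ∣x∣≈0) = equal λ ε 0<ε → eventually-map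
  (λ n p → subst (ℚ._≤ ε) (trans (cong ℚ.∣_∣ (ℚ.+-identityʳ ℚ.∣ seq x n ∣))
    (trans (ℚ.∣∣p∣∣≡∣p∣ (seq x n)) (cong ℚ.∣_∣ (sym (ℚ.+-identityʳ (seq x n)))))) p)
  (∣x∣≈0 ε 0<ε)

∣x∣^≃∣x^∣ : ∀ x k → ∣ x ∣ ↑ k ≃ ∣ x ↑ k ∣
∣x∣^≃∣x^∣ x k = pointwise-≡ λ n → trans (seq-↑ ∣ x ∣ k n) (trans (∣q∣^≡∣q^∣ (seq x n) k) (cong ℚ.∣_∣ (sym (seq-↑ x k n))))
  where
  ∣q∣^≡∣q^∣ : ∀ q k → ℚ.∣ q ∣ ^ℚ k ≡ ℚ.∣ q ^ℚ k ∣
  ∣q∣^≡∣q^∣ q zero    = refl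
  ∣q∣^≡∣q^∣ q (suc k) = trans (cong (ℚ.∣ q ∣ ℚ.*_) (∣q∣^≡∣q^∣ q k)) (sym (ℚ.∣p*q∣≡∣p∣*∣q∣ q (q ^ℚ k)))

0↑≃0 : ∀ k → 0ℝ ↑ suc k ≃ 0ℝ
0↑≃0 k = pointwise-≡ λ n → trans (seq-↑ 0ℝ (suc k) n) (ℚ.*-zeroˡ (0ℚ ^ℚ k))

↑≃0⇒≃0 : ∀ {x} k → x ↑ suc k ≃ 0ℝ → x ≃ 0ℝ
↑≃0⇒≃0 {x} k x^≃0 = ∣x∣≃0⇒x≃0 (↑-cancel-≃ {∣ x ∣} {0ℝ} k (nonNeg⇒0≲ (∣-∣-nonNeg x)) ≲-refl (≃-trans
  (∣x∣^≃∣x^∣ x (suc k)) (≃-trans (∣-∣-cong {x ↑ suc k} {0ℝ} x^≃0)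
    (pointwise-≡ λ n → sym (trans (seq-↑ 0ℝ (suc k) n) (ℚ.*-zeroˡ (0ℚ ^ℚ k)))))))

-- A substitute for comparing reals, which is undecidable: the alternatives overlap, so one rational
-- comparison with `half ε`, at an index after which the sequence moves by at most a quarter of `ε`,
-- selects one of them.
eventually-≤⊎≥ : ∀ {d} → Cauchy d → ∀ ε → 0ℚ ℚ.< ε →
  Eventually (λ n → d n ℚ.≤ ε) ⊎ ∃[ c ] (0ℚ ℚ.< c × Eventually λ n → c ℚ.≤ d n)
eventually-≤⊎≥ {d} cauchy-d ε 0<ε with cauchy-d (half (half ε)) (half-pos (half-pos 0<ε))
... | N , close with d N ℚ.≤? half ε
...   | yes d≤ = inj₁ (N , λ n N≤n → subst (d n ℚ.≤_) (half+half ε)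
          (ℚ.≤-trans (∣-∣≤⇒≤+ (d n) (d N) (close n N N≤n ℕ.≤-refl))
            (ℚ.+-mono-≤ d≤ (ℚ.<⇒≤ (half-< (half-pos 0<ε))))))
...   | no  d≰ = inj₂ (half (half ε) , half-pos (half-pos 0<ε) , N , λ n N≤n →
          +-cancelʳ-≤ (half (half ε)) (ℚ.≤-trans (ℚ.≤-reflexive (half+half (half ε)))
            (ℚ.≤-trans (ℚ.<⇒≤ (ℚ.≰⇒> d≰)) (∣-∣≤⇒≤+ (d N) (d n) (close N n ℕ.≤-refl N≤n)))))

-- Permits arguing about `≲` by contradiction: for each `ε` either the bound holds eventually, or
-- the difference keeps a positive lower bound, which the hypothesis refutes.
≮⇒≲ : ∀ {x y} → ¬ (∃[ c ] (0ℚ ℚ.< c × Eventually λ n → seq y n ℚ.+ c ℚ.≤ seq x n)) → x ≲ y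
≮⇒≲ {x} {y} y≮x = atMost λ ε 0<ε → decide (eventually-≤⊎≥ (cauchy (x + - y)) ε 0<ε)
  where
  open +-*-Solver
  add-y : ∀ n → seq y n ℚ.+ (seq x n ℚ.- seq y n) ≡ seq x n
  add-y n = solve 2 (λ a b → b :+ (a :- b) := a) refl (seq x n) (seq y n)
  decide : ∀ {ε} → Eventually (λ n → seq x n ℚ.- seq y n ℚ.≤ ε) ⊎
    ∃[ c ] (0ℚ ℚ.< c × Eventually λ n → c ℚ.≤ seq x n ℚ.- seq y n) →
    Eventually λ n → seq x n ℚ.≤ seq y n ℚ.+ ε
  decide {ε} (inj₁ (N , d≤ε))     = N , λ n N≤n → subst (ℚ._≤ seq y n ℚ.+ ε) (add-y n) (ℚ.+-monoʳ-≤ (seq y n) (d≤ε n N≤n))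
  decide (inj₂ (c , 0<c , N , c≤d)) = ⊥-elim (y≮x (c , 0<c , N , λ n N≤n →
    subst (seq y n ℚ.+ c ℚ.≤_) (add-y n) (ℚ.+-monoʳ-≤ (seq y n) (c≤d n N≤n))))

-- If x were larger than y by some c > 0, then c ν ≤ (x - y) ν ≤ 0.

*-cancelʳ-≲ : ∀ {x y ν} → 0ℝ ≲ ν → ¬ ν ≃ 0ℝ → x *ʳ ν ≲ y *ʳ ν → x ≲ y
*-cancelʳ-≲ {x} {y} {ν} 0≤ν ν≄0 xν≤yν = ≮⇒≲ λ (c , 0<c , y+c≤x) → ν≄0 (≲-antisym (atMost λ ε 0<ε →
    eventually-zip (λ n p q → ℚ.≮⇒≥ λ lt → ℚ.<-irrefl refl
        (contra {n} 0<c 0<ε p (subst₂ (λ u v → u ℚ.≤ v ℚ.+ c ℚ.* ε) (seq-* x ν n) (seq-* y ν n) q)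
          (subst (ℚ._< seq ν n) (ℚ.+-identityˡ ε) lt)))
      y+c≤x (_≲_.unwrap xν≤yν (c ℚ.* ε) (*-pos 0<c 0<ε)))
  0≤ν)
  where
  open ℚ.≤-Reasoning
  contra : ∀ {n c ε} → 0ℚ ℚ.< c → 0ℚ ℚ.< ε → seq y n ℚ.+ c ℚ.≤ seq x n →
    seq x n ℚ.* seq ν n ℚ.≤ seq y n ℚ.* seq ν n ℚ.+ c ℚ.* ε → ε ℚ.< seq ν n →
    seq x n ℚ.* seq ν n ℚ.< seq x n ℚ.* seq ν n
  contra {n} {c} {ε} 0<c 0<ε p q lt = begin-strict
    seq x n ℚ.* seq ν n                         ≤⟨ q ⟩
    seq y n ℚ.* seq ν n ℚ.+ c ℚ.* ε             <⟨ ℚ.+-monoʳ-< (seq y n ℚ.* seq ν n) (ℚ.*-monoʳ-<-pos c {{ℚ.positive 0<c}} lt) ⟩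
    seq y n ℚ.* seq ν n ℚ.+ c ℚ.* seq ν n       ≡⟨ ℚ.*-distribʳ-+ (seq ν n) (seq y n) c ⟨
    (seq y n ℚ.+ c) ℚ.* seq ν n                 ≤⟨ ℚ.*-monoʳ-≤-nonNeg (seq ν n) {{ℚ.nonNegative (ℚ.<⇒≤ (ℚ.<-trans 0<ε lt))}} p ⟩
    seq x n ℚ.* seq ν n                         ∎

-- Roots approximated from above

grid1 : ℝ
grid1 = mkℝ (λ n → grid n 1) λ ε 0<ε →
  let N , small = 1/suc≤ ε 0<ε in N , λ m n N≤m N≤n →
    ∣-∣≤ (ℚ.≤-trans (small m N≤m) (y≤x+y (0≤ℕ/ 1 n))) (ℚ.≤-trans (small n N≤n) (y≤x+y (0≤ℕ/ 1 m)))

grid1≃0 : grid1 ≃ 0ℝ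
grid1≃0 = ≲-antisym
  (atMost λ ε 0<ε → eventually-map (λ n p → subst (grid n 1 ℚ.≤_) (sym (ℚ.+-identityˡ ε)) p) (1/suc≤ ε 0<ε))
  (pointwise-≤ (0≤ℕ/ 1))

-- Equal to root (suc k) x, but the (k+1)-st power of every approximation is at
-- least that of ∣ x ∣.

upperRoot : ℕ → ℝ → ℝ
upperRoot k x = root (suc k) x +ʳ grid1

root-nonNeg : ∀ k x → NonNeg (root (suc k) x)
root-nonNeg k x n = 0≤ℕ/ (rootSearch (grid n) k ℚ.∣ seq x n ∣ (rootBound n ℚ.∣ seq x n ∣)) n

upperRoot-nonNeg : ∀ k x → NonNeg (upperRoot k x)
upperRoot-nonNeg k x n = subst (0ℚ ℚ.≤_) (sym (seq-+ (root (suc k) x) grid1 n)) (+-nonNeg (root-nonNeg k x n) (0≤ℕ/ 1 n))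

∣x∣≤upperRoot^ : ∀ k x n → ℚ.∣ seq x n ∣ ℚ.≤ seq (upperRoot k x) n ^ℚ suc k
∣x∣≤upperRoot^ k x n = subst (λ q → ℚ.∣ seq x n ∣ ℚ.≤ q ^ℚ suc k) (sym (seq-+ (root (suc k) x) grid1 n))
  (ℚ.<⇒≤ (rootℚ-upper k n ℚ.∣ seq x n ∣))

upperRoot≃root : ∀ k x → upperRoot k x ≃ root (suc k) x
upperRoot≃root k x = ≃-trans (+-cong {root (suc k) x} {root (suc k) x} {grid1} {0ℝ} ≃-refl grid1≃0)
  (pointwise-≡ λ n → trans (seq-+ (root (suc k) x) 0ℝ n) (ℚ.+-identityʳ (seq (root (suc k) x) n)))

-- Rounding down gives one inequality at every index; the other holds at every index for
-- `upperRoot`, which is the same real.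
root-^ : ∀ k x → root (suc k) x ↑ suc k ≃ ∣ x ∣
root-^ k x = ≲-antisym
  (pointwise-≤ λ n → subst (ℚ._≤ ℚ.∣ seq x n ∣) (sym (seq-↑ (root (suc k) x) (suc k) n))
    (rootℚ-lower k n ℚ.∣ seq x n ∣ (ℚ.0≤∣p∣ (seq x n))))
  (≲-trans (pointwise-≤ λ n → subst (ℚ.∣ seq x n ∣ ℚ.≤_) (sym (seq-↑ (upperRoot k x) (suc k) n)) (∣x∣≤upperRoot^ k x n))
    (≃⇒≲ (↑-cong {upperRoot k x} {root (suc k) x} (suc k) (upperRoot≃root k x))))

upperRoot-^ : ∀ k x → upperRoot k x ↑ suc k ≃ ∣ x ∣
upperRoot-^ k x = ≃-trans (↑-cong {upperRoot k x} {root (suc k) x} (suc k) (upperRoot≃root k x)) (root-^ k x)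

-- The operator norm

^ᵉ-↑ : ∀ x a b → (x ^ᵉ (a / suc b)) ↑ suc b ≃ ∣ x ↑ a ∣
^ᵉ-↑ x a b = ≃-trans (root-^ b (x ^ a)) (∣-∣-cong {x ^ a} {x ↑ a} (≃-sym (↑≃^ x a)))

norm-↑ : ∀ {n} a b (x : Vector n) →
  norm (suc a / b) x ↑ suc a ≃ ∣ ∑ʳ (λ i → ∣ x i ∣ ^ᵉ (suc a / b)) ↑ b ∣
norm-↑ a b x = ≃-trans (^ᵉ-↑ (sum (λ i → ∣ x i ∣ ^ᵉ (suc a / b))) b a)
  (∣-∣-cong {sum (λ i → ∣ x i ∣ ^ᵉ (suc a / b)) ↑ b} {∑ʳ (λ i → ∣ x i ∣ ^ᵉ (suc a / b)) ↑ b}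
    (↑-cong b (≃-sym (∑ʳ≃sum (λ i → ∣ x i ∣ ^ᵉ (suc a / b))))))

norm-nonNeg : ∀ {n} a b (x : Vector n) → 0ℝ ≲ norm (suc a / b) x
norm-nonNeg a b x = nonNeg⇒0≲ (root-nonNeg a (sum (λ i → ∣ x i ∣ ^ᵉ (suc a / b)) ^ b))

↑-1 : ∀ x → x ↑ 1 ≃ x
↑-1 x = pointwise-≡ λ n → trans (seq-↑ x 1 n) (ℚ.*-identityʳ (seq x n))

↑-nonNeg : ∀ {x} k → NonNeg x → NonNeg (x ↑ k)
↑-nonNeg {x} k 0≤x n = subst (0ℚ ℚ.≤_) (sym (seq-↑ x k n)) (^-nonNeg (0≤x n) k)

∑ʳ-nonNeg : ∀ {n} {f : Fin n → ℝ} → (∀ i → NonNeg (f i)) → NonNeg (∑ʳ f)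
∑ʳ-nonNeg {n} {f} 0≤f m = subst (0ℚ ℚ.≤_) (sym (seq-∑ʳ f m)) (∑-nonNeg (List.allFin n) λ i → 0≤f i m)

∣x↑k∣≃ : ∀ {x} k → NonNeg x → ∣ x ↑ k ∣ ≃ x ↑ k
∣x↑k∣≃ {x} k 0≤x = nonNeg⇒∣x∣≃x (↑-nonNeg k 0≤x)

-- Both sides have `suc k`-th power `∣ x ∣ ↑ a`. With `a` equal to t and `suc k` to t-1, this writes
-- the summands of the q-norm as integral powers of y, the (t-1)-st root of `∣ x ∣`.
upperRoot^≃∣x∣^ᵉ : ∀ a k x → ∣ x ∣ ^ᵉ (a / suc k) ≃ upperRoot k x ↑ a
upperRoot^≃∣x∣^ᵉ a k x = ↑-cancel-≃ k
  (nonNeg⇒0≲ (root-nonNeg k (∣ x ∣ ^ a))) (nonNeg⇒0≲ (↑-nonNeg a (upperRoot-nonNeg k x))) (begin-equality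
  (∣ x ∣ ^ᵉ (a / suc k)) ↑ suc k    ≈⟨ ^ᵉ-↑ ∣ x ∣ a k ⟩
  ∣ ∣ x ∣ ↑ a ∣                      ≈⟨ ∣x↑k∣≃ a (∣-∣-nonNeg x) ⟩
  ∣ x ∣ ↑ a                          ≈⟨ ↑-cong a (upperRoot-^ k x) ⟨
  (upperRoot k x ↑ suc k) ↑ a        ≈⟨ ↑-assoc-comm (upperRoot k x) (suc k) a ⟩
  (upperRoot k x ↑ a) ↑ suc k        ∎)
  where open ≲-Reasoning

-- Terms such as norm (a / 1) x and norm (a / suc 0) x are compared by unfolding
-- norm.  So, here and below, the shape of an exponent is an equation like b ≡ suc k,
-- and an adjacency matrix is a matrix B with entries equal to A G.

norm-upperRoot : ∀ {n} a k {b} (x : Vector n) → b ≡ suc k →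
  norm (suc a / b) x ↑ suc a ≃ ∑ʳ (λ i → upperRoot k (x i) ↑ suc a) ↑ suc k
norm-upperRoot a k {b} x refl = begin-equality
  norm (suc a / b) x ↑ suc a
    ≈⟨ norm-↑ a b x ⟩
  ∣ ∑ʳ (λ i → ∣ x i ∣ ^ᵉ (suc a / b)) ↑ suc k ∣           
    ≈⟨ ∣-∣-cong (↑-cong (suc k) (∑ʳ-cong λ i → upperRoot^≃∣x∣^ᵉ (suc a) k (x i))) ⟩
  ∣ ∑ʳ (λ i → upperRoot k (x i) ↑ suc a) ↑ suc k ∣        
    ≈⟨ ∣x↑k∣≃ (suc k) (∑ʳ-nonNeg λ i → ↑-nonNeg (suc a) (upperRoot-nonNeg k (x i))) ⟩
  ∑ʳ (λ i → upperRoot k (x i) ↑ suc a) ↑ suc k            ∎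
  where open ≲-Reasoning

norm-integral : ∀ {n} a (x : Vector n) → norm (suc a / 1) x ↑ suc a ≃ ∑ʳ (λ i → ∣ x i ∣ ↑ suc a)
norm-integral a x = ≃-trans (norm-upperRoot a 0 {1} x refl) (begin-equality
  ∑ʳ (λ i → upperRoot 0 (x i) ↑ suc a) ↑ 1      ≈⟨ ↑-1 (∑ʳ (λ i → upperRoot 0 (x i) ↑ suc a)) ⟩
  ∑ʳ (λ i → upperRoot 0 (x i) ↑ suc a)          ≈⟨ ∑ʳ-cong (λ i → ↑-cong (suc a) (upperRoot≃∣x∣ (x i))) ⟩
  ∑ʳ (λ i → ∣ x i ∣ ↑ suc a)                    ∎)
  where
  open ≲-Reasoning
  upperRoot≃∣x∣ : ∀ x → upperRoot 0 x ≃ ∣ x ∣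
  upperRoot≃∣x∣ x = ≃-trans (≃-sym (↑-1 (upperRoot 0 x))) (upperRoot-^ 0 x)

term≤∑ : ∀ {I : Set} {n} (g : Fin n → I) {f : I → ℚ} → (∀ x → 0ℚ ℚ.≤ f x) →
  ∀ i → f (g i) ℚ.≤ ∑ (List.tabulate g) f
term≤∑ g 0≤f zero    = x≤x+y (∑-nonNeg (List.tabulate (g ∘ suc)) 0≤f)
term≤∑ g 0≤f (suc i) = ℚ.≤-trans (term≤∑ (g ∘ suc) 0≤f i) (y≤x+y (0≤f (g zero)))

∑ʳ≃0⇒≃0 : ∀ {n} {f : Fin n → ℝ} → (∀ i → NonNeg (f i)) → ∑ʳ f ≃ 0ℝ → ∀ i → f i ≃ 0ℝ
∑ʳ≃0⇒≃0 {f = f} 0≤f ∑≃0 i = ≲-antisym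
  (≲-trans (pointwise-≤ λ m → subst (seq (f i) m ℚ.≤_) (sym (seq-∑ʳ f m)) (term≤∑ (λ i → i) (λ i → 0≤f i m) i)) (≃⇒≲ ∑≃0))
  (nonNeg⇒0≲ (0≤f i))

norm≃0 : ∀ {n} a k {b} (x : Vector n) → b ≡ suc k → norm (suc a / b) x ≃ 0ℝ → ∀ i → x i ≃ 0ℝ
norm≃0 {n} a k {b} x b≡ ν≃0 i = ∣x∣≃0⇒x≃0 (≃-trans (≃-sym (upperRoot-^ k (x i)))
    (≃-trans (↑-cong (suc k) y≃0) (0↑≃0 k)))
  where
  y : Fin n → ℝ
  y i = upperRoot k (x i)
  S≃0 : ∑ʳ (λ i → y i ↑ suc a) ≃ 0ℝ
  S≃0 = ↑≃0⇒≃0 k (≃-trans (≃-sym (norm-upperRoot a k {b} x b≡))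
    (≃-trans (↑-cong {norm (suc a / b) x} {0ℝ} (suc a) ν≃0) (0↑≃0 a)))
  y≃0 : y i ≃ 0ℝ
  y≃0 = ↑≃0⇒≃0 a (∑ʳ≃0⇒≃0 (λ i → ↑-nonNeg (suc a) (upperRoot-nonNeg k (x i))) S≃0 i)

∣∑∣≤∑∣∣ : ∀ {I : Set} (xs : List I) f → ℚ.∣ ∑ xs f ∣ ℚ.≤ ∑[ x ∈ xs ] ℚ.∣ f x ∣
∣∑∣≤∑∣∣ []       f = ℚ.≤-refl
∣∑∣≤∑∣∣ (x ∷ xs) f = ℚ.≤-trans (ℚ.∣p+q∣≤∣p∣+∣q∣ (f x) (∑ xs f)) (ℚ.+-monoʳ-≤ ℚ.∣ f x ∣ (∣∑∣≤∑∣∣ xs f))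

nonNeg-root : ∀ k x → NonNeg x → ∃[ y ] (0ℝ ≲ y × y ↑ suc k ≃ x)
nonNeg-root k x 0≤x = root (suc k) x , nonNeg⇒0≲ (root-nonNeg k x) , ≃-trans (root-^ k x) (nonNeg⇒∣x∣≃x 0≤x)

*ʳ≃* : ∀ x y → x *ʳ y ≃ x * y
*ʳ≃* x y = pointwise-≡ (seq-* x y)

seq-adjacency : ∀ {n} (G : Graph n) i j m → seq (adjacencyMatrix G i j) m ≡ A G i j
seq-adjacency G i j m with adj G i j
... | true  = refl
... | false = refl

seq-· : ∀ {n} (B : Matrix n) x i m → seq ((B · x) i) m ≡ ∑[ j ∈ List.allFin n ] (seq (B i j) m ℚ.* seq (x j) m)
seq-· B x i m = seq-sum (λ j → B i j * x j) m

module _ {n} (G : Graph n) (B : Matrix n) (B≡A : ∀ i j m → seq (B i j) m ≡ A G i j) where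

  seq-·-A : ∀ x i m → seq ((B · x) i) m ≡ ∑[ j ∈ List.allFin n ] (A G i j ℚ.* seq (x j) m)
  seq-·-A x i m = trans (seq-· B x i m) (∑-cong (List.allFin n) λ j → cong (ℚ._* seq (x j) m) (B≡A i j m))

  power-bound : ∀ k {t} → t ≡ suc k → ∀ H → (∀ m → seq H m ≡ toℚ (hom (K t t) G)) →
    ∀ (y x : Vector n) → (∀ i → NonNeg (y i)) → (∀ i m → ℚ.∣ seq (x i) m ∣ ℚ.≤ seq (y i) m ^ℚ k) →
    ∑ʳ (λ i → ∣ (B · x) i ∣ ↑ t) ↑ t ≲ H *ʳ (∑ʳ (λ i → y i ↑ t) ↑ t) ↑ k
  power-bound k {t} refl H H≡hom y x 0≤y x≤y^ = pointwise-≤ λ m → begin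
    seq (R ↑ t) m
      ≡⟨ seq-↑-of R t m (trans (seq-∑ʳ (λ i → ∣ (B · x) i ∣ ↑ t) m)
           (∑-cong V λ i → seq-↑-of ∣ (B · x) i ∣ t m (cong ℚ.∣_∣ (seq-·-A x i m)))) ⟩
    (∑[ i ∈ V ] (ℚ.∣ ∑[ j ∈ V ] (A G i j ℚ.* seq (x j) m) ∣ ^ℚ t)) ^ℚ t
      ≤⟨ ^-mono (∑-nonNeg V λ i → ^-nonNeg (ℚ.0≤∣p∣ (∑[ j ∈ V ] (A G i j ℚ.* seq (x j) m))) t)
           (∑-mono V λ i → ^-mono (ℚ.0≤∣p∣ (∑[ j ∈ V ] (A G i j ℚ.* seq (x j) m))) (row i m) t) t ⟩
    (∑[ i ∈ V ] ((∑[ j ∈ V ] (A G i j ℚ.* seq (y j) m ^ℚ k)) ^ℚ t)) ^ℚ t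
      ≤⟨ hom-bound G k (λ i → seq (y i) m) (λ i → 0≤y i m) ⟩
    toℚ (hom (K t t) G) ℚ.* ((∑[ i ∈ V ] (seq (y i) m ^ℚ t)) ^ℚ t) ^ℚ k
      ≡⟨ seq-*-of H ((S ↑ t) ↑ k) m (H≡hom m) (seq-↑-of (S ↑ t) k m (seq-↑-of S t m
           (trans (seq-∑ʳ (λ i → y i ↑ t) m) (∑-cong V λ i → seq-↑ (y i) t m)))) ⟨
    seq (H *ʳ (S ↑ t) ↑ k) m ∎
    where
    open ℚ.≤-Reasoning
    V : List (Fin n)
    V = List.allFin n
    R S : ℝ
    R = ∑ʳ (λ i → ∣ (B · x) i ∣ ↑ t)
    S = ∑ʳ (λ i → y i ↑ t)
    row : ∀ i m → ℚ.∣ ∑[ j ∈ V ] (A G i j ℚ.* seq (x j) m) ∣ ℚ.≤ ∑[ j ∈ V ] (A G i j ℚ.* seq (y j) m ^ℚ k)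
    row i m = ℚ.≤-trans (∣∑∣≤∑∣∣ V (λ j → A G i j ℚ.* seq (x j) m)) (∑-mono V λ j → subst (ℚ._≤ A G i j ℚ.* seq (y j) m ^ℚ k)
      (sym (trans (ℚ.∣p*q∣≡∣p∣*∣q∣ (A G i j) (seq (x j) m)) (cong (ℚ._* ℚ.∣ seq (x j) m ∣) (ℚ.0≤p⇒∣p∣≡p (0≤A G i j)))))
      (ℚ.*-monoˡ-≤-nonNeg (A G i j) {{ℚ.nonNegative (0≤A G i j)}} (x≤y^ j m)))

  -- After raising to the power `t * t`, the right side becomes a perfect power of `κ *ʳ ν`. The
  -- power is cancelled, and then the norm `ν`, which vanishes only for the zero vector.
  normRatio-bound : ∀ k {t b} → t ≡ suc (suc k) → b ≡ suc k → ∀ H → (∀ m → seq H m ≡ toℚ (hom (K t t) G)) →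
    ∀ κ → 0ℝ ≲ κ → κ ↑ (t ℕ.* t) ≃ H → ∀ s → IsNormRatio (t / b) (t / 1) B s → s ≲ κ
  normRatio-bound k {t} {b} refl b≡ H H≡hom κ 0≤κ κ^≃H s (x , x≄0 , sν≈η) =
    *-cancelʳ-≲ {s} {κ} {ν} 0≤ν (λ ν≃0 → x≄0 λ i → _≃_.unwrap (norm≃0 (suc k) k {b} x b≡ ν≃0 i))
      -- The cancellation takes the exponent less one: `t * t` unfolds to `suc (suc k + suc k * t)`.
      (↑-cancel-≲ {s *ʳ ν} {κ *ʳ ν} (suc k ℕ.+ suc k ℕ.* t) (*-0≲ {κ} {ν} 0≤κ 0≤ν) (begin
        (s *ʳ ν) ↑ (t ℕ.* t)              ≈⟨ ↑-cong {s *ʳ ν} {η} (t ℕ.* t) (≃-trans (*ʳ≃* s ν) (equal sν≈η)) ⟩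
        η ↑ (t ℕ.* t)                     ≈⟨ ↑-assocʳ η t t ⟨
        (η ↑ t) ↑ t                       ≈⟨ ↑-cong {η ↑ t} {R} t (norm-integral (suc k) (B · x)) ⟩
        R ↑ t                             ≲⟨ power-bound (suc k) refl H H≡hom y x (λ i → upperRoot-nonNeg k (x i))
                                               (λ i → ∣x∣≤upperRoot^ k (x i)) ⟩
        H *ʳ (S ↑ t) ↑ suc k              ≈⟨ *-cong {H} {κ ↑ (t ℕ.* t)} {(S ↑ t) ↑ suc k} {ν ↑ (t ℕ.* t)} (≃-sym κ^≃H) S^≃ν^ ⟩
        κ ↑ (t ℕ.* t) *ʳ ν ↑ (t ℕ.* t)    ≈⟨ ↑-distrib-* κ ν (t ℕ.* t) ⟨
        (κ *ʳ ν) ↑ (t ℕ.* t)              ∎))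
    where
    open ≲-Reasoning
    y : Vector n
    y i = upperRoot k (x i)
    ν η R S : ℝ
    ν = norm (t / b) x
    η = norm (t / 1) (B · x)
    R = ∑ʳ (λ i → ∣ (B · x) i ∣ ↑ t)
    S = ∑ʳ (λ i → y i ↑ t)
    0≤ν : 0ℝ ≲ ν
    0≤ν = norm-nonNeg (suc k) b x
    S^≃ν^ : (S ↑ t) ↑ suc k ≃ ν ↑ (t ℕ.* t)
    S^≃ν^ = begin-equality
      (S ↑ t) ↑ suc k    ≈⟨ ↑-assoc-comm S t (suc k) ⟩
      (S ↑ suc k) ↑ t    ≈⟨ ↑-cong {ν ↑ t} {S ↑ suc k} t (norm-upperRoot (suc k) k {b} x b≡) ⟨
      (ν ↑ t) ↑ t        ≈⟨ ↑-assocʳ ν t t ⟩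
      ν ↑ (t ℕ.* t)      ∎

  -- The `t * t`-th root `κ` of `H` is an upper bound for all norm ratios, so the least upper bound
  -- `N` lies below it. `from-root` receives `κ` as a variable known only through its equation.
  operatorNorm-bound : ∀ k {t b e} → t ≡ suc (suc k) → b ≡ suc k → e ≡ t ℕ.* t →
    ∀ H → (∀ m → seq H m ≡ toℚ (hom (K t t) G)) →
    ∀ N → IsOperatorNorm (t / b) (t / 1) B N → N ^ e ≤ H
  operatorNorm-bound k {t} {b} {e} refl b≡ refl H H≡hom N (0≤N , _ , N-least) =
    from-root (nonNeg-root (suc k ℕ.+ suc k ℕ.* t) H λ m → subst (0ℚ ℚ.≤_) (sym (H≡hom m)) (0≤ℕ/ (hom (K t t) G) 0))
    where
    from-root : ∃[ κ ] (0ℝ ≲ κ × κ ↑ (t ℕ.* t) ≃ H) → N ^ e ≤ H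
    from-root (κ , 0≤κ , κ^≃H) = _≲_.unwrap (≲-trans {N ^ e} {N ↑ e} {H} (≃⇒≲ (≃-sym (↑≃^ N e))) (≲-trans {N ↑ e} {κ ↑ e} {H}
      (↑-mono-≲ {N} {κ} e (atMost 0≤N) (atMost (N-least κ (_≲_.unwrap 0≤κ) λ s ratio →
        _≲_.unwrap (normRatio-bound k {t} {b} refl b≡ H H≡hom κ 0≤κ κ^≃H s ratio))))
      (≃⇒≲ κ^≃H)))

-- The spectral radius

0≤q*q : ∀ q → 0ℚ ℚ.≤ q ℚ.* q
0≤q*q q with ℚ.≤-total 0ℚ q
... | inj₁ 0≤q = *-nonNeg 0≤q 0≤q
... | inj₂ q≤0 = subst (0ℚ ℚ.≤_) (solve 1 (λ q → :- q :* :- q := q :* q) refl q) (*-nonNeg 0≤-q 0≤-q)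
  where
  open +-*-Solver
  0≤-q : 0ℚ ℚ.≤ ℚ.- q
  0≤-q = subst (0ℚ ℚ.≤_) (ℚ.+-identityˡ (ℚ.- q)) (p≤q⇒0≤q-p q≤0)

square-cancel-≤ : ∀ {x y} → 0ℚ ℚ.≤ y → x ℚ.* x ℚ.≤ y ℚ.* y → x ℚ.≤ y
square-cancel-≤ {x} {y} 0≤y xx≤yy = ^ℚ-cancel-≤ 1 0≤y
  (subst₂ (λ p q → x ℚ.* p ℚ.≤ y ℚ.* q) (sym (ℚ.*-identityʳ x)) (sym (ℚ.*-identityʳ y)) xx≤yy)

-- The point `(a , b)` lies in the disc of radius `∣ c ∣`; squaring keeps the modulus rational.
Dominates : ℚ → ℚ → ℚ → Set
Dominates c a b = a ℚ.* a ℚ.+ b ℚ.* b ℚ.≤ c ℚ.* c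

-- The planar triangle inequality; a a′ + b b′ ≤ c c′ by Cauchy-Schwarz.

dominates-+ : ∀ {a b c a′ b′ c′} → 0ℚ ℚ.≤ c → 0ℚ ℚ.≤ c′ → Dominates c a b → Dominates c′ a′ b′ →
  Dominates (c ℚ.+ c′) (a ℚ.+ a′) (b ℚ.+ b′)
dominates-+ {a} {b} {c} {a′} {b′} {c′} 0≤c 0≤c′ p p′ = subst₂ ℚ._≤_
  (solve 4 (λ a b a′ b′ → (a :* a :+ b :* b) :+ (a′ :* a′ :+ b′ :* b′) :+ ((a :* a′ :+ b :* b′) :+ (a :* a′ :+ b :* b′))
    := (a :+ a′) :* (a :+ a′) :+ (b :+ b′) :* (b :+ b′)) refl a b a′ b′)
  (solve 2 (λ c c′ → c :* c :+ c′ :* c′ :+ (c :* c′ :+ c :* c′) := (c :+ c′) :* (c :+ c′)) refl c c′)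
  (ℚ.+-mono-≤ (ℚ.+-mono-≤ p p′) (ℚ.+-mono-≤ cross cross))
  where
  open +-*-Solver
  s s′ d : ℚ
  s = a ℚ.* a ℚ.+ b ℚ.* b
  s′ = a′ ℚ.* a′ ℚ.+ b′ ℚ.* b′
  d = a ℚ.* b′ ℚ.- a′ ℚ.* b
  0≤s : 0ℚ ℚ.≤ s
  0≤s = +-nonNeg (0≤q*q a) (0≤q*q b)
  0≤s′ : 0ℚ ℚ.≤ s′
  0≤s′ = +-nonNeg (0≤q*q a′) (0≤q*q b′)
  cross : a ℚ.* a′ ℚ.+ b ℚ.* b′ ℚ.≤ c ℚ.* c′
  cross = square-cancel-≤ (*-nonNeg 0≤c 0≤c′) (begin
    (a ℚ.* a′ ℚ.+ b ℚ.* b′) ℚ.* (a ℚ.* a′ ℚ.+ b ℚ.* b′)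
      ≤⟨ x≤x+y (0≤q*q d) ⟩
    (a ℚ.* a′ ℚ.+ b ℚ.* b′) ℚ.* (a ℚ.* a′ ℚ.+ b ℚ.* b′) ℚ.+ d ℚ.* d
      ≡⟨ solve 4 (λ a b a′ b′ → (a :* a′ :+ b :* b′) :* (a :* a′ :+ b :* b′) :+ (a :* b′ :- a′ :* b) :* (a :* b′ :- a′ :* b)
           := (a :* a :+ b :* b) :* (a′ :* a′ :+ b′ :* b′)) refl a b a′ b′ ⟩
    s ℚ.* s′
      ≤⟨ *-mono 0≤s p 0≤s′ p′ ⟩
    c ℚ.* c ℚ.* (c′ ℚ.* c′)
      ≡⟨ solve 2 (λ c c′ → c :* c :* (c′ :* c′) := c :* c′ :* (c :* c′)) refl c c′ ⟩
    c ℚ.* c′ ℚ.* (c ℚ.* c′) ∎)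
    where open ℚ.≤-Reasoning

dominates-* : ∀ {a b c} e → Dominates c a b → Dominates (e ℚ.* c) (e ℚ.* a) (e ℚ.* b)
dominates-* {a} {b} {c} e p = subst₂ ℚ._≤_
  (solve 3 (λ e a b → e :* e :* (a :* a :+ b :* b) := e :* a :* (e :* a) :+ e :* b :* (e :* b)) refl e a b)
  (solve 2 (λ e c → e :* e :* (c :* c) := e :* c :* (e :* c)) refl e c)
  (ℚ.*-monoˡ-≤-nonNeg (e ℚ.* e) {{ℚ.nonNegative (0≤q*q e)}} p)
  where open +-*-Solver

dominates-∑ : ∀ {I : Set} (xs : List I) (e a b c : I → ℚ) → (∀ x → 0ℚ ℚ.≤ e x) → (∀ x → 0ℚ ℚ.≤ c x) →
  (∀ x → Dominates (c x) (a x) (b x)) →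
  Dominates (∑[ x ∈ xs ] (e x ℚ.* c x)) (∑[ x ∈ xs ] (e x ℚ.* a x)) (∑[ x ∈ xs ] (e x ℚ.* b x))
dominates-∑ []       e a b c 0≤e 0≤c dom = ℚ.≤-refl
dominates-∑ (x ∷ xs) e a b c 0≤e 0≤c dom = dominates-+
  {e x ℚ.* a x} {e x ℚ.* b x} {e x ℚ.* c x}
  {∑[ x ∈ xs ] (e x ℚ.* a x)} {∑[ x ∈ xs ] (e x ℚ.* b x)} {∑[ x ∈ xs ] (e x ℚ.* c x)}
  (*-nonNeg (0≤e x) (0≤c x)) (∑-nonNeg xs λ x → *-nonNeg (0≤e x) (0≤c x))
  (dominates-* {a x} {b x} {c x} (e x) (dom x)) (dominates-∑ xs e a b c 0≤e 0≤c dom)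

*ʳ-nonNeg : ∀ {x y} → NonNeg x → NonNeg y → NonNeg (x *ʳ y)
*ʳ-nonNeg {x} {y} 0≤x 0≤y n = subst (0ℚ ℚ.≤_) (sym (seq-* x y n)) (*-nonNeg (0≤x n) (0≤y n))

↑-2 : ∀ x → x ↑ 2 ≃ x *ʳ x
↑-2 x = pointwise-≡ λ n → trans (seq-↑ x 2 n)
  (trans (cong (seq x n ℚ.*_) (ℚ.*-identityʳ (seq x n))) (sym (seq-* x x n)))

normSq : ℝ → ℝ → ℝ
normSq a b = a *ʳ a +ʳ b *ʳ b

seq-normSq : ∀ a b n → seq (normSq a b) n ≡ seq a n ℚ.* seq a n ℚ.+ seq b n ℚ.* seq b n
seq-normSq a b n = trans (seq-+ (a *ʳ a) (b *ʳ b) n) (cong₂ ℚ._+_ (seq-* a a n) (seq-* b b n))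

normSq-nonNeg : ∀ a b → NonNeg (normSq a b)
normSq-nonNeg a b n = subst (0ℚ ℚ.≤_) (sym (seq-normSq a b n)) (+-nonNeg (0≤q*q (seq a n)) (0≤q*q (seq b n)))

normSq-cong : ∀ {a a′ b b′} → a ≃ a′ → b ≃ b′ → normSq a b ≃ normSq a′ b′
normSq-cong {a} {a′} {b} {b′} p q = +-cong {a *ʳ a} {a′ *ʳ a′} {b *ʳ b} {b′ *ʳ b′}
  (*-cong {a} {a′} {a} {a′} p p) (*-cong {b} {b′} {b} {b′} q q)

square≃0 : ∀ x → x *ʳ x ≃ 0ℝ → x ≃ 0ℝ
square≃0 x xx≃0 = ↑≃0⇒≃0 {x} 1 (≃-trans (↑-2 x) xx≃0)

normSq≃0 : ∀ a b → normSq a b ≃ 0ℝ → a ≃ 0ℝ × b ≃ 0ℝ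
normSq≃0 a b q≃0 = square≃0 a (≲-antisym (≲-trans (pointwise-≤ a²≤q) (≃⇒≲ q≃0)) (pointwise-≤ (0≤x² a))) ,
  square≃0 b (≲-antisym (≲-trans (pointwise-≤ b²≤q) (≃⇒≲ q≃0)) (pointwise-≤ (0≤x² b)))
  where
  0≤x² : ∀ x → NonNeg (x *ʳ x)
  0≤x² x n = subst (0ℚ ℚ.≤_) (sym (seq-* x x n)) (0≤q*q (seq x n))
  a²≤q : ∀ n → seq (a *ʳ a) n ℚ.≤ seq (normSq a b) n
  a²≤q n = subst (seq (a *ʳ a) n ℚ.≤_) (sym (seq-+ (a *ʳ a) (b *ʳ b) n)) (x≤x+y (0≤x² b n))
  b²≤q : ∀ n → seq (b *ʳ b) n ℚ.≤ seq (normSq a b) n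
  b²≤q n = subst (seq (b *ʳ b) n ℚ.≤_) (sym (seq-+ (a *ʳ a) (b *ʳ b) n)) (y≤x+y (0≤x² a n))

normSq-*ᶜ : ∀ μ z → normSq (re (μ *ᶜ z)) (im (μ *ᶜ z)) ≃ normSq (re μ) (im μ) *ʳ normSq (re z) (im z)
normSq-*ᶜ μ z = pointwise-≡ λ n → trans (seq-normSq (re (μ *ᶜ z)) (im (μ *ᶜ z)) n)
  (trans (brahmagupta (seq (re μ) n) (seq (im μ) n) (seq (re z) n) (seq (im z) n))
    (sym (seq-*-of (normSq (re μ) (im μ)) (normSq (re z) (im z)) n (seq-normSq (re μ) (im μ) n) (seq-normSq (re z) (im z) n))))
  where
  open +-*-Solver
  brahmagupta : ∀ a b c d →
    (a ℚ.* c ℚ.+ ℚ.- (b ℚ.* d)) ℚ.* (a ℚ.* c ℚ.+ ℚ.- (b ℚ.* d)) ℚ.+ (a ℚ.* d ℚ.+ b ℚ.* c) ℚ.* (a ℚ.* d ℚ.+ b ℚ.* c) ≡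
    (a ℚ.* a ℚ.+ b ℚ.* b) ℚ.* (c ℚ.* c ℚ.+ d ℚ.* d)
  brahmagupta = solve 4 (λ a b c d →
    (a :* c :+ :- (b :* d)) :* (a :* c :+ :- (b :* d)) :+ (a :* d :+ b :* c) :* (a :* d :+ b :* c)
    := (a :* a :+ b :* b) :* (c :* c :+ d :* d)) refl

root-^′ : ∀ k {b} x → b ≡ suc k → root b x ↑ b ≃ ∣ x ∣
root-^′ k x refl = root-^ k x

modulus-↑2 : ∀ μ → modulus μ ↑ 2 ≃ normSq (re μ) (im μ)
modulus-↑2 μ = ≃-trans (root-^′ 1 {2} (re μ ^ 2 + im μ ^ 2) refl) (pointwise-≡ λ n →
  trans (cong ℚ.∣_∣ (cong₂ (λ p q → seq (re μ) n ℚ.* p ℚ.+ seq (im μ) n ℚ.* q)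
    (ℚ.*-identityʳ (seq (re μ) n)) (ℚ.*-identityʳ (seq (im μ) n))))
    (trans (cong ℚ.∣_∣ (sym (seq-normSq (re μ) (im μ) n))) (ℚ.0≤p⇒∣p∣≡p (normSq-nonNeg (re μ) (im μ) n))))

root-nonNeg′ : ∀ k {b} x → b ≡ suc k → 0ℝ ≲ root b x
root-nonNeg′ k x refl = nonNeg⇒0≲ (root-nonNeg k x)

modulus-nonNeg : ∀ μ → 0ℝ ≲ modulus μ
modulus-nonNeg μ = root-nonNeg′ 1 {2} (re μ ^ 2 + im μ ^ 2) refl

module _ {n} (G : Graph n) (B : Matrix n) (B≡A : ∀ i j m → seq (B i j) m ≡ A G i j)
  (ρ : ℝ) (0≤ρ : 0ℝ ≲ ρ) (μ : ℂ) (ρ²≃∣μ∣² : ρ ↑ 2 ≃ normSq (re μ) (im μ))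
  (z : Fin n → ℂ) (eigen : ∀ i → (B ·ᶜ z) i ≈ᶜ μ *ᶜ z i)
  (v : Vector n) (0≤v : ∀ i → NonNeg (v i)) (v²≃ : ∀ i → v i *ʳ v i ≃ normSq (re (z i)) (im (z i)))
  (z≤v : ∀ i m → Dominates (seq (v i) m) (seq (re (z i)) m) (seq (im (z i)) m)) where

  -- The triangle inequality for row `i` of `A` times `z`, whose modulus is `∣ μ ∣ ∣ z i ∣` by the
  -- eigenvalue equation. Comparing squares makes the moduli polynomial and multiplicative.
  eigenvector-bound : ∀ i → ρ *ʳ v i ≲ (B · v) i
  eigenvector-bound i = ↑-cancel-≲ {ρ *ʳ v i} {(B · v) i} 1 (nonNeg⇒0≲ 0≤Bv) (begin
    (ρ *ʳ v i) ↑ 2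
      ≈⟨ ↑-distrib-* ρ (v i) 2 ⟩
    ρ ↑ 2 *ʳ v i ↑ 2
      ≈⟨ *-cong {ρ ↑ 2} {normSq (re μ) (im μ)} {v i ↑ 2} {normSq (re (z i)) (im (z i))} ρ²≃∣μ∣² (≃-trans (↑-2 (v i)) (v²≃ i)) ⟩
    normSq (re μ) (im μ) *ʳ normSq (re (z i)) (im (z i))
      ≈⟨ normSq-*ᶜ μ (z i) ⟨
    normSq (re (μ *ᶜ z i)) (im (μ *ᶜ z i))
      ≈⟨ normSq-cong (equal (proj₁ (eigen i))) (equal (proj₂ (eigen i))) ⟨
    normSq (re ((B ·ᶜ z) i)) (im ((B ·ᶜ z) i))
      ≲⟨ pointwise-≤ triangle ⟩
    (B · v) i *ʳ (B · v) i
      ≈⟨ ↑-2 ((B · v) i) ⟨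
    (B · v) i ↑ 2 ∎)
    where
    open ≲-Reasoning
    0≤Bv : NonNeg ((B · v) i)
    0≤Bv m = subst (0ℚ ℚ.≤_) (sym (seq-·-A G B B≡A v i m))
      (∑-nonNeg (List.allFin n) λ j → *-nonNeg (0≤A G i j) (0≤v j m))
    triangle : ∀ m → seq (normSq (re ((B ·ᶜ z) i)) (im ((B ·ᶜ z) i))) m ℚ.≤ seq ((B · v) i *ʳ (B · v) i) m
    triangle m = subst₂ ℚ._≤_
      (sym (trans (seq-normSq (re ((B ·ᶜ z) i)) (im ((B ·ᶜ z) i)) m)
        (cong₂ (λ p q → p ℚ.* p ℚ.+ q ℚ.* q) (seq-·-A G B B≡A (re ∘ z) i m) (seq-·-A G B B≡A (im ∘ z) i m))))
      (sym (seq-*-of ((B · v) i) ((B · v) i) m (seq-·-A G B B≡A v i m) (seq-·-A G B B≡A v i m)))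
      (dominates-∑ (List.allFin n) (A G i) (λ j → seq (re (z j)) m) (λ j → seq (im (z j)) m) (λ j → seq (v j) m)
        (0≤A G i) (λ j → 0≤v j m) (λ j → z≤v j m))

  rayleigh-bound : ρ *ʳ ∑ʳ (λ i → v i *ʳ v i) ≲ ∑ʳ (λ i → v i *ʳ (B · v) i)
  rayleigh-bound = begin
    ρ *ʳ ∑ʳ (λ i → v i *ʳ v i)        ≈⟨ pointwise-≡ distribute ⟩
    ∑ʳ (λ i → (ρ *ʳ v i) *ʳ v i)      ≲⟨ ∑ʳ-mono (λ i → *-monoʳ-≲ {ρ *ʳ v i} {(B · v) i} {v i}
                                           (nonNeg⇒0≲ (0≤v i)) (eigenvector-bound i)) ⟩
    ∑ʳ (λ i → (B · v) i *ʳ v i)       ≈⟨ ∑ʳ-cong (λ i → *-comm ((B · v) i) (v i)) ⟩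
    ∑ʳ (λ i → v i *ʳ (B · v) i)       ∎
    where
    open ≲-Reasoning
    distribute : ∀ m → seq (ρ *ʳ ∑ʳ (λ i → v i *ʳ v i)) m ≡ seq (∑ʳ (λ i → (ρ *ʳ v i) *ʳ v i)) m
    distribute m = trans (seq-*-of ρ (∑ʳ (λ i → v i *ʳ v i)) m refl
        (trans (seq-∑ʳ (λ i → v i *ʳ v i) m) (∑-cong (List.allFin n) λ i → seq-* (v i) (v i) m)))
      (trans (*-distribˡ-∑ (seq ρ m) (List.allFin n) (λ i → seq (v i) m ℚ.* seq (v i) m))
      (trans (∑-cong (List.allFin n) λ i → sym (trans (seq-*-of (ρ *ʳ v i) (v i) m (seq-* ρ (v i) m) refl)
          (ℚ.*-assoc (seq ρ m) (seq (v i) m) (seq (v i) m))))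
        (sym (seq-∑ʳ (λ i → (ρ *ʳ v i) *ʳ v i) m))))

module _ {n} (G : Graph n) (B : Matrix n) (B≡A : ∀ i j m → seq (B i j) m ≡ A G i j) where

  form-bound : ∀ k {t e} → t ≡ suc (suc k) → e ≡ 2 ℕ.* t ℕ.* suc k →
    ∀ D → (∀ m → seq D m ≡ toℚ (hom (K t t) G) ℚ.* toℚ (M G) ^ℚ (t ℕ.* k)) →
    ∀ (w v : Vector n) → (∀ i → NonNeg (w i)) → (∀ i m → seq (v i) m ≡ seq (w i) m ^ℚ t) →
    ∑ʳ (λ i → v i *ʳ (B · v) i) ↑ e ≲ D *ʳ ∑ʳ (λ i → v i *ʳ v i) ↑ e
  form-bound k {t} {e} refl refl D D≡ w v 0≤w v≡ = pointwise-≤ λ m → subst₂ ℚ._≤_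
    (sym (seq-↑-of (∑ʳ (λ i → v i *ʳ (B · v) i)) e m (trans (seq-∑ʳ (λ i → v i *ʳ (B · v) i) m)
      (∑-cong (List.allFin n) λ i → seq-*-of (v i) ((B · v) i) m (v≡ i m)
        (trans (seq-·-A G B B≡A v i m) (∑-cong (List.allFin n) λ j → cong (A G i j ℚ.*_) (v≡ j m)))))))
    (trans (sym (ℚ.*-assoc (toℚ (hom (K t t) G)) (toℚ (M G) ^ℚ (t ℕ.* k)) (S m ^ℚ e)))
      (sym (seq-*-of D (∑ʳ (λ i → v i *ʳ v i) ↑ e) m (D≡ m)
        (seq-↑-of (∑ʳ (λ i → v i *ʳ v i)) e m (trans (seq-∑ʳ (λ i → v i *ʳ v i) m)
          (∑-cong (List.allFin n) λ i → seq-*-of (v i) (v i) m (v≡ i m) (v≡ i m)))))))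
    (QuadraticForm.quadratic-form-bound G k (toℚ (hom (K t t) G)) (hom-bound G (suc k)) (λ i → seq (w i) m) (λ i → 0≤w i m))
    where
    S : ℕ → ℚ
    S m = ∑[ i ∈ List.allFin n ] (seq (w i) m ^ℚ t ℚ.* seq (w i) m ^ℚ t)

-- Division by the power of M(G), and the theorem

toℚ-* : ∀ m n → toℚ (m ℕ.* n) ≡ toℚ m ℚ.* toℚ n
toℚ-* zero    n = sym (ℚ.*-zeroˡ (toℚ n))
toℚ-* (suc m) n = trans (toℚ-+ n (m ℕ.* n)) (trans (cong (toℚ n ℚ.+_) (toℚ-* m n))
  (trans (cong (ℚ._+ toℚ m ℚ.* toℚ n) (sym (ℚ.*-identityˡ (toℚ n))))
    (trans (sym (ℚ.*-distribʳ-+ (toℚ n) 1ℚ (toℚ m))) (cong (ℚ._* toℚ n) (sym (toℚ-suc m))))))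

toℚ-^ : ∀ m k → toℚ (m ℕ.^ k) ≡ toℚ m ^ℚ k
toℚ-^ m zero    = refl
toℚ-^ m (suc k) = trans (toℚ-* m (m ℕ.^ k)) (cong (toℚ m ℚ.*_) (toℚ-^ m k))

toℚ-*-1/ : ∀ m .{{_ : ℕ.NonZero m}} → toℚ m ℚ.* (+ 1 ℚ./ m) ≡ 1ℚ
toℚ-*-1/ (suc m) = ℚ.toℚᵘ-injective (ℚᵘ.≃-trans (ℚ.toℚᵘ-homo-* (toℚ (suc m)) (+ 1 ℚ./ suc m))
  (ℚᵘ.≃-trans (ℚᵘ.*-cong (toℚᵘ-/ (+ suc m) 0) (toℚᵘ-/ (+ 1) m)) (ℚᵘ.*≡* eq)))
  where
  eq : + suc m ℤ.* + 1 ℤ.* + 1 ≡ + 1 ℤ.* (+ 1 ℤ.* + suc m)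
  eq = trans (ℤ.*-identityʳ (+ suc m ℤ.* + 1)) (trans (ℤ.*-comm (+ suc m) (+ 1)) (sym (ℤ.*-identityˡ (+ 1 ℤ.* + suc m))))

*-bound : ∀ x D c H → NonNeg c → (∀ n → seq D n ℚ.* seq c n ≡ seq H n) → x ≲ D → x *ʳ c ≲ H
*-bound x D c H 0≤c Dc≡H x≲D = ≲-trans (*-monoʳ-≲ {x} {D} {c} (nonNeg⇒0≲ 0≤c) x≲D)
  (≃⇒≲ (pointwise-≡ λ n → trans (seq-* D c n) (Dc≡H n)))

pointwise-≲-trans : ∀ {x y z} → (∀ n → seq x n ≡ seq y n) → y ≲ z → x ≲ z
pointwise-≲-trans x≡y y≲z = ≲-trans (≃⇒≲ (pointwise-≡ x≡y)) y≲z

*-cancel-inverse : ∀ {d h a c b} → d ≡ h ℚ.* a → c ≡ b → a ℚ.* b ≡ 1ℚ → d ℚ.* c ≡ h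
*-cancel-inverse {h = h} {a} {b = b} refl refl ab≡1 =
  trans (ℚ.*-assoc h a b) (trans (cong (h ℚ.*_) ab≡1) (ℚ.*-identityʳ h))

0≤1/ : ∀ m .{{_ : ℕ.NonZero m}} → 0ℚ ℚ.≤ + 1 ℚ./ m
0≤1/ m = ℚ.nonNegative⁻¹ (+ 1 ℚ./ m) {{ℚ.normalize-nonNeg 1 m}}

-- The divisor is a natural number, so its inverse is an exact rational constant and no reciprocal
-- of a real arises.
÷ℕ-bound : ∀ x y H D c m .{{_ : ℕ.NonZero m}} → (∀ n → seq D n ≡ seq H n ℚ.* toℚ m) →
  (∀ n → seq c n ≡ + 1 ℚ./ m) → (∀ n → seq y n ≡ seq x n ℚ.* (+ 1 ℚ./ m)) → x ≲ D → y ≲ H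
÷ℕ-bound x y H D c m D≡ c≡ y≡ x≲D = pointwise-≲-trans {y} {x *ʳ c} {H}
  (λ n → trans (y≡ n) (trans (cong (seq x n ℚ.*_) (sym (c≡ n))) (sym (seq-* x c n)))) (*-bound x D c H
  (λ n → subst (0ℚ ℚ.≤_) (sym (c≡ n)) (0≤1/ m))
  (λ n → *-cancel-inverse (D≡ n) (c≡ n) (toℚ-*-1/ m)) x≲D)

module _ {n} (G : Graph n) (B : Matrix n) (B≡A : ∀ i j m → seq (B i j) m ≡ A G i j) where

  -- The Rayleigh bound raised to the power `e` meets the form bound, and `S ↑ e` is cancelled. If
  -- it vanished, so would every `v i`, and with it the eigenvector.
  spectralRadius-bound : ∀ k {t e} → t ≡ suc (suc k) → e ≡ 2 ℕ.* t ℕ.* suc k →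
    ∀ D → (∀ m → seq D m ≡ toℚ (hom (K t t) G) ℚ.* toℚ (M G) ^ℚ (t ℕ.* k)) →
    ∀ ρ → IsSpectralRadius B ρ → ρ ↑ e ≲ D
  spectralRadius-bound k {t} {e} t≡ e≡ D D≡ ρ ((μ , (z , z≄0 , eigen) , ∣μ∣≈ρ) , _) =
    *-cancelʳ-≲ {ρ ↑ e} {D} {S ↑ e} (↑-0≲ {S} e (nonNeg⇒0≲ 0≤S)) S^≄0 (begin
      ρ ↑ e *ʳ S ↑ e     ≈⟨ ↑-distrib-* ρ S e ⟨
      (ρ *ʳ S) ↑ e       ≲⟨ ↑-mono-≲ {ρ *ʳ S} {E} e (*-0≲ {ρ} {S} 0≤ρ (nonNeg⇒0≲ 0≤S))
                              (rayleigh-bound G B B≡A ρ 0≤ρ μ ρ²≃ z eigen v 0≤v v²≃ z≤v) ⟩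
      E ↑ e              ≲⟨ form-bound G B B≡A k {t} {e} t≡ e≡ D D≡ w v (λ i → upperRoot-nonNeg j (q i)) (λ i → seq-↑ (w i) t) ⟩
      D *ʳ S ↑ e         ∎)
    where
    open ≲-Reasoning
    -- `suc j` is 2t, so `w i` is the 2t-th root of `q i` and its `t`-th power `v i` is the modulus
    -- of `z i`. Rounding up in this single root gives the domination `z≤v` at every index.
    j : ℕ
    j = suc k ℕ.+ t
    t+t≡ : t ℕ.+ t ≡ suc j
    t+t≡ = cong (ℕ._+ t) t≡
    q w v : Vector n
    q i = normSq (re (z i)) (im (z i))
    w i = upperRoot j (q i)
    v i = w i ↑ t
    S E : ℝ
    S = ∑ʳ (λ i → v i *ʳ v i)
    E = ∑ʳ (λ i → v i *ʳ (B · v) i)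
    0≤v : ∀ i → NonNeg (v i)
    0≤v i = ↑-nonNeg t (upperRoot-nonNeg j (q i))
    0≤S : NonNeg S
    0≤S = ∑ʳ-nonNeg λ i → *ʳ-nonNeg (0≤v i) (0≤v i)
    0≤ρ : 0ℝ ≲ ρ
    0≤ρ = ≲-trans (modulus-nonNeg μ) (≃⇒≲ (equal ∣μ∣≈ρ))
    ρ²≃ : ρ ↑ 2 ≃ normSq (re μ) (im μ)
    ρ²≃ = ≃-trans (↑-cong {ρ} {modulus μ} 2 (≃-sym (equal ∣μ∣≈ρ))) (modulus-↑2 μ)
    seq-v² : ∀ i m → seq (v i) m ℚ.* seq (v i) m ≡ seq (w i) m ^ℚ suc j
    seq-v² i m = trans (cong₂ ℚ._*_ (seq-↑ (w i) t m) (seq-↑ (w i) t m))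
      (trans (sym (^ℚ-homo-* (seq (w i) m) t t)) (cong (seq (w i) m ^ℚ_) t+t≡))
    v²≃ : ∀ i → v i *ʳ v i ≃ q i
    v²≃ i = begin-equality
      v i *ʳ v i      ≈⟨ pointwise-≡ (λ m → trans (seq-* (v i) (v i) m) (trans (seq-v² i m) (sym (seq-↑ (w i) (suc j) m)))) ⟩
      w i ↑ suc j     ≈⟨ upperRoot-^ j (q i) ⟩
      ∣ q i ∣         ≈⟨ nonNeg⇒∣x∣≃x (normSq-nonNeg (re (z i)) (im (z i))) ⟩
      q i             ∎
    z≤v : ∀ i m → Dominates (seq (v i) m) (seq (re (z i)) m) (seq (im (z i)) m)
    z≤v i m = subst₂ ℚ._≤_ (seq-normSq (re (z i)) (im (z i)) m) (sym (seq-v² i m))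
      (ℚ.≤-trans (p≤∣p∣ (seq (q i) m)) (∣x∣≤upperRoot^ j (q i) m))
    S^≄0 : ¬ S ↑ e ≃ 0ℝ
    S^≄0 S^≃0 = z≄0 λ i → let re≃0 , im≃0 = normSq≃0 (re (z i)) (im (z i)) (≃-trans (≃-sym (v²≃ i)) (v²≃0 i))
                          in _≃_.unwrap re≃0 , _≃_.unwrap im≃0
      where
      -- The predecessor of `e`, exposed by replacing only the first `t` in `2 * t * suc k`, that is
      -- in `(t + (t + 0)) * suc k`, by `suc (suc k)`.
      e-1 : ℕ
      e-1 = k ℕ.+ (suc k ℕ.+ (t ℕ.+ 0)) ℕ.* suc k
      v²≃0 : ∀ i → v i *ʳ v i ≃ 0ℝ
      v²≃0 = ∑ʳ≃0⇒≃0 (λ i → *ʳ-nonNeg (0≤v i) (0≤v i))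
        (↑≃0⇒≃0 {S} e-1 (subst (λ e → S ↑ e ≃ 0ℝ) (trans e≡ (cong (λ u → (u ℕ.+ (t ℕ.+ 0)) ℕ.* suc k) t≡)) S^≃0))

  spectralRadius-÷-bound : ∀ k {t e m} .{{_ : ℕ.NonZero m}} → t ≡ suc (suc k) →
    e ≡ 2 ℕ.* t ℕ.* suc k → m ≡ M G ℕ.^ (t ℕ.* k) →
    ∀ H → (∀ i → seq H i ≡ toℚ (hom (K t t) G)) → ∀ ρ → IsSpectralRadius B ρ →
    ∀ y → (∀ i → seq y i ≡ seq (ρ ^ e) i ℚ.* (+ 1 ℚ./ m)) → y ≤ H
  spectralRadius-÷-bound k {t} {e} {m} t≡ e≡ m≡ H H≡hom ρ isRadius y y≡ = _≲_.unwrap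
    (÷ℕ-bound (ρ ↑ e) y H D (fromℚ (+ 1 ℚ./ m)) m
    D≡H*m (λ _ → refl) (λ i → trans (y≡ i) (cong (ℚ._* (+ 1 ℚ./ m)) (trans (seq-^ ρ e i) (sym (seq-↑ ρ e i)))))
    (spectralRadius-bound k {t} {e} t≡ e≡ D
      (λ i → trans (D≡H*m i) (cong₂ ℚ._*_ (H≡hom i) (trans (cong toℚ m≡) (toℚ-^ (M G) (t ℕ.* k))))) ρ isRadius))
    where
    D : ℝ
    D = H *ʳ fromℕ m
    D≡H*m : ∀ i → seq D i ≡ seq H i ℚ.* toℚ m
    D≡H*m = seq-* H (fromℕ m)

2≤⇒≡2+ : ∀ {t} → 2 ℕ.≤ t → ∃[ k ] (t ≡ suc (suc k))
2≤⇒≡2+ {suc (suc k)} (ℕ.s≤s (ℕ.s≤s _)) = k , refl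

lemma2p4 : ∀ t → 2 ℕ.≤ t → ∀ {n} (G : Graph n) →
    let A = adjacencyMatrix G in
    (∀ N → IsOperatorNorm (t / (t ∸ 1)) (t / 1) A N →
    N ^ (t ℕ.* t) ≤ fromℕ (hom (K t t) G))
    × ((M>0 : 0 ℕ.< M G) → ∀ ρ → IsSpectralRadius A ρ →
    _÷ℕ_ (ρ ^ (2 ℕ.* t ℕ.* (t ∸ 1))) (M G ℕ.^ (t ℕ.* (t ∸ 2)))
    {{m^n≢0 (M G) (t ℕ.* (t ∸ 2)) {{>-nonZero M>0}}}}
    ≤ fromℕ (hom (K t t) G))
lemma2p4 t 2≤t {n} G = norm-part (2≤⇒≡2+ 2≤t) , radius-part (2≤⇒≡2+ 2≤t)
  where
  norm-part : ∃[ k ] (t ≡ suc (suc k)) → ∀ N → IsOperatorNorm (t / (t ∸ 1)) (t / 1) (adjacencyMatrix G) N →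
    N ^ (t ℕ.* t) ≤ fromℕ (hom (K t t) G)
  norm-part (k , t≡) = operatorNorm-bound G (adjacencyMatrix G) (seq-adjacency G) k {t} {t ∸ 1} {t ℕ.* t}
    t≡ (cong (_∸ 1) t≡) refl (fromℕ (hom (K t t) G)) (λ _ → refl)

  radius-part : ∃[ k ] (t ≡ suc (suc k)) → (M>0 : 0 ℕ.< M G) → ∀ ρ → IsSpectralRadius (adjacencyMatrix G) ρ →
    _÷ℕ_ (ρ ^ (2 ℕ.* t ℕ.* (t ∸ 1))) (M G ℕ.^ (t ℕ.* (t ∸ 2)))
    {{m^n≢0 (M G) (t ℕ.* (t ∸ 2)) {{>-nonZero M>0}}}}
    ≤ fromℕ (hom (K t t) G)
  radius-part (k , t≡) M>0 ρ isRadius = spectralRadius-÷-bound G (adjacencyMatrix G) (seq-adjacency G) k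
    {t} {2 ℕ.* t ℕ.* (t ∸ 1)} {M G ℕ.^ (t ℕ.* (t ∸ 2))} {{m^n≢0 (M G) (t ℕ.* (t ∸ 2)) {{>-nonZero M>0}}}}
    t≡ (cong (λ s → 2 ℕ.* t ℕ.* (s ∸ 1)) t≡) (cong (λ s → M G ℕ.^ (t ℕ.* (s ∸ 2))) t≡)
    (fromℕ (hom (K t t) G)) (λ _ → refl) ρ isRadius
    (_÷ℕ_ (ρ ^ (2 ℕ.* t ℕ.* (t ∸ 1))) (M G ℕ.^ (t ℕ.* (t ∸ 2))) {{m^n≢0 (M G) (t ℕ.* (t ∸ 2)) {{>-nonZero M>0}}}})
    (λ _ → refl)
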